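{- For any $\lambda\in[0,1)$: $\mathbb{L}^{=1}(\mathrm{QBA}|\mathrm{D})\not\subseteq\mathbb{L}^{>\lambda}(\mathrm{QBA}|\mathrm{D})$.
   Context: A quantum automaton is a tuple $\mathcal{A}=(\mathcal{H},|s_0\rangle,\Sigma,\{U_\sigma:\sigma\in\Sigma\},F)$ where $\mathcal{H}$ is a finite-dimensional complex Hilbert space, $|s_0\rangle$ a unit vector, $\Sigma$ a finite alphabet, each $U_\sigma$ unitary, and $F$ a subspace. For $w=\sigma_1\sigma_2\cdots\in\Sigma^\omega$, a unit vector $|\psi\rangle\in F$ and checkpoints $0\le n_1<n_2<\cdots$, the disturbing run is $|s_0\rangle$ (initial state) and for $n\ge1$: $|s_n\rangle=U_{\sigma_n}|\psi\rangle$ if $n-1=n_i$ for some $i$, else $|s_n\rangle=U_{\sigma_n}|s_{n-1}\rangle$. Then $f^{\mathrm{D}}_{\mathcal{A}}(w)=\sup_{|\psi\rangle}\sup_{\{n_i\}}\inf_{i\ge1}|\langle\psi|s_{n_i}\rangle|^2$ over unit $|\psi\rangle\in F$ and strictly increasing checkpoint sequences. $\mathcal{L}^{=1}(\mathcal{A}|\mathrm{D})=\{w\in\Sigma^\omega:f^{\mathrm{D}}_{\mathcal{A}}(w)=1\}$, $\mathcal{L}^{>\lambda}(\mathcal{A}|\mathrm{D})=\{w:f^{\mathrm{D}}_{\mathcal{A}}(w)>\lambda\}$; $\mathbb{L}^{=1}(\mathrm{QBA}|\mathrm{D})$ and $\mathbb{L}^{>\lambda}(\mathrm{QBA}|\mathrm{D})$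 are the classes of all such languages as $\mathcal{A}$ ranges over all quantum automata. -}

module Defs where

open import Data.Fin using (Fin; _≟_)
open import Data.Nat as ℕ using (ℕ; zero; suc; _⊔_)
import Data.Nat.Properties as ℕₚ
open import Data.Product using (Σ; ∃-syntax; _×_; _,_)
open import Data.Rational as ℚ using (ℚ; 0ℚ; 1ℚ; ½; ∣_∣)
import Data.Rational.Properties as ℚₚ
open import Data.Rational.Solver using (module +-*-Solver)
open import Data.Vec.Functional using (Vector; foldr)
open import Relation.Binary.PropositionalEquality using (_≡_; refl; sym; trans; cong; subst)
open import Relation.Nullary using (Dec; does)
open import Relation.Nullary.Decidable using (map′)
open import Relation.Unary using (Pred; _≐_)
open import Data.Bool using (if_then_else_)
open import Level using (0ℓ) renaming (suc to ℓsuc)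

-- Cauchy sequences of rationals; equality of reals is the setoid equality _≈_.
record ℝ : Set where
  constructor mkℝ
  field
    seq    : ℕ → ℚ
    cauchy : ∀ ε → 0ℚ ℚ.< ε →
             ∃[ N ] (∀ m n → N ℕ.≤ m → N ℕ.≤ n → ∣ seq m ℚ.- seq n ∣ ℚ.< ε)

open ℝ public

infix 4 _≈_ _≤_ _<_

_≈_ : ℝ → ℝ → Set
x ≈ y = ∀ ε → 0ℚ ℚ.< ε → ∃[ N ] (∀ n → N ℕ.≤ n → ∣ seq x n ℚ.- seq y n ∣ ℚ.< ε)

_≤_ : ℝ → ℝ → Set
x ≤ y = ∀ ε → 0ℚ ℚ.< ε → ∃[ N ] (∀ n → N ℕ.≤ n → seq x n ℚ.≤ seq y n ℚ.+ ε)

_<_ : ℝ → ℝ → Set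
x < y = ∃[ ε ] (0ℚ ℚ.< ε × ∃[ N ] (∀ n → N ℕ.≤ n → seq x n ℚ.+ ε ℚ.≤ seq y n))

fromℚ : ℚ → ℝ
fromℚ q .seq _ = q
fromℚ q .cauchy ε 0<ε = 0 , λ _ _ _ _ →
  subst (ℚ._< ε) (sym (cong ∣_∣ (ℚₚ.+-inverseʳ q))) 0<ε

0ℝ 1ℝ : ℝ
0ℝ = fromℚ 0ℚ
1ℝ = fromℚ 1ℚ

private
  half-pos : ∀ {ε} → 0ℚ ℚ.< ε → 0ℚ ℚ.< ½ ℚ.* ε
  half-pos {ε} 0<ε = subst (ℚ._< ½ ℚ.* ε) (ℚₚ.*-zeroʳ ½) (ℚₚ.*-monoʳ-<-pos ½ 0<ε)

  halves : ∀ ε → ½ ℚ.* ε ℚ.+ ½ ℚ.* ε ≡ ε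
  halves ε = trans (sym (ℚₚ.*-distribʳ-+ ε ½ ½)) (ℚₚ.*-identityˡ ε)

  interchange : ∀ a b c d → (a ℚ.+ b) ℚ.- (c ℚ.+ d) ≡ (a ℚ.- c) ℚ.+ (b ℚ.- d)
  interchange = solve 4 (λ a b c d → (a :+ b) :- (c :+ d) := (a :- c) :+ (b :- d)) refl
    where open +-*-Solver

  product-difference : ∀ a b c d →
    a ℚ.* b ℚ.- c ℚ.* d ≡ a ℚ.* (b ℚ.- d) ℚ.+ d ℚ.* (a ℚ.- c)
  product-difference = solve 4 (λ a b c d →
      a :* b :- c :* d := a :* (b :- d) :+ d :* (a :- c)) refl
    where open +-*-Solver

  neg-difference : ∀ a b → ℚ.- a ℚ.- ℚ.- b ≡ ℚ.- (a ℚ.- b)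
  neg-difference = solve 2 (λ a b → :- a :- :- b := :- (a :- b)) refl
    where open +-*-Solver

  recover : ∀ a b → (a ℚ.- b) ℚ.+ b ≡ a
  recover = solve 2 (λ a b → (a :- b) :+ b := a) refl
    where open +-*-Solver

  eventuallyBounded : (x : ℝ) →
    ∃[ B ] (0ℚ ℚ.< B × ∃[ N ] (∀ n → N ℕ.≤ n → ∣ seq x n ∣ ℚ.< B))
  eventuallyBounded x with cauchy x 1ℚ (ℚₚ.positive⁻¹ 1ℚ)
  ... | N , close = 1ℚ ℚ.+ ∣ seq x N ∣
                  , ℚₚ.+-mono-<-≤ (ℚₚ.positive⁻¹ 1ℚ) (ℚₚ.0≤∣p∣ (seq x N))
                  , N , bound
    where
    open ℚₚ.≤-Reasoning
    bound : ∀ n → N ℕ.≤ n → ∣ seq x n ∣ ℚ.< 1ℚ ℚ.+ ∣ seq x N ∣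
    bound n N≤n = begin-strict
      ∣ seq x n ∣                               ≡⟨ cong ∣_∣ (recover (seq x n) (seq x N)) ⟨
      ∣ (seq x n ℚ.- seq x N) ℚ.+ seq x N ∣     ≤⟨ ℚₚ.∣p+q∣≤∣p∣+∣q∣ (seq x n ℚ.- seq x N) (seq x N) ⟩
      ∣ seq x n ℚ.- seq x N ∣ ℚ.+ ∣ seq x N ∣   <⟨ ℚₚ.+-monoˡ-< ∣ seq x N ∣ (close n N N≤n ℕₚ.≤-refl) ⟩
      1ℚ ℚ.+ ∣ seq x N ∣                        ∎

  product-bound : ∀ {B δ} a b → 0ℚ ℚ.< B → ∣ a ∣ ℚ.< B → ∣ b ∣ ℚ.< δ → ∣ a ℚ.* b ∣ ℚ.< B ℚ.* δ
  product-bound {B} {δ} a b 0<B a<B b<δ = begin-strict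
    ∣ a ℚ.* b ∣       ≡⟨ ℚₚ.∣p*q∣≡∣p∣*∣q∣ a b ⟩
    ∣ a ∣ ℚ.* ∣ b ∣   ≤⟨ ℚₚ.*-monoʳ-≤-nonNeg ∣ b ∣ {{ℚₚ.∣-∣-nonNeg b}} (ℚₚ.<⇒≤ a<B) ⟩
    B ℚ.* ∣ b ∣       <⟨ ℚₚ.*-monoʳ-<-pos B {{ℚ.positive 0<B}} b<δ ⟩
    B ℚ.* δ           ∎
    where open ℚₚ.≤-Reasoning

  product-close : ∀ {A B δ} a b c d → 0ℚ ℚ.< A → 0ℚ ℚ.< B → ∣ a ∣ ℚ.< A → ∣ d ∣ ℚ.< B →
                  ∣ a ℚ.- c ∣ ℚ.< δ → ∣ b ℚ.- d ∣ ℚ.< δ →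
                  ∣ a ℚ.* b ℚ.- c ℚ.* d ∣ ℚ.< A ℚ.* δ ℚ.+ B ℚ.* δ
  product-close {A} {B} {δ} a b c d 0<A 0<B a<A d<B ac bd = begin-strict
    ∣ a ℚ.* b ℚ.- c ℚ.* d ∣
      ≡⟨ cong ∣_∣ (product-difference a b c d) ⟩
    ∣ a ℚ.* (b ℚ.- d) ℚ.+ d ℚ.* (a ℚ.- c) ∣
      ≤⟨ ℚₚ.∣p+q∣≤∣p∣+∣q∣ (a ℚ.* (b ℚ.- d)) (d ℚ.* (a ℚ.- c)) ⟩
    ∣ a ℚ.* (b ℚ.- d) ∣ ℚ.+ ∣ d ℚ.* (a ℚ.- c) ∣
      <⟨ ℚₚ.+-mono-< (product-bound a (b ℚ.- d) 0<A a<A bd)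
                     (product-bound d (a ℚ.- c) 0<B d<B ac) ⟩
    A ℚ.* δ ℚ.+ B ℚ.* δ ∎
    where open ℚₚ.≤-Reasoning

  product-cauchy : ∀ (x y : ℕ → ℚ) {A B δ ε} → 0ℚ ℚ.< A → 0ℚ ℚ.< B → A ℚ.* δ ℚ.+ B ℚ.* δ ≡ ε →
    ∀ Nᴬ Nᴮ Nˣ Nʸ →
    (∀ n → Nᴬ ℕ.≤ n → ∣ x n ∣ ℚ.< A) →
    (∀ n → Nᴮ ℕ.≤ n → ∣ y n ∣ ℚ.< B) →
    (∀ m n → Nˣ ℕ.≤ m → Nˣ ℕ.≤ n → ∣ x m ℚ.- x n ∣ ℚ.< δ) →
    (∀ m n → Nʸ ℕ.≤ m → Nʸ ℕ.≤ n → ∣ y m ℚ.- y n ∣ ℚ.< δ) →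
    ∃[ N ] (∀ m n → N ℕ.≤ m → N ℕ.≤ n → ∣ x m ℚ.* y m ℚ.- x n ℚ.* y n ∣ ℚ.< ε)
  product-cauchy x y 0<A 0<B Aδ+Bδ≡ε Nᴬ Nᴮ Nˣ Nʸ boundˣ boundʸ closeˣ closeʸ =
    (Nᴬ ⊔ Nᴮ) ⊔ (Nˣ ⊔ Nʸ) , λ m n ≤m ≤n →
      subst (∣ x m ℚ.* y m ℚ.- x n ℚ.* y n ∣ ℚ.<_) Aδ+Bδ≡ε
        (product-close (x m) (y m) (x n) (y n) 0<A 0<B
          (boundˣ m (ℕₚ.m⊔n≤o⇒m≤o Nᴬ Nᴮ (bounds ≤m)))
          (boundʸ n (ℕₚ.m⊔n≤o⇒n≤o Nᴬ Nᴮ (bounds ≤n)))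
          (closeˣ m n (ℕₚ.m⊔n≤o⇒m≤o Nˣ Nʸ (closes ≤m)) (ℕₚ.m⊔n≤o⇒m≤o Nˣ Nʸ (closes ≤n)))
          (closeʸ m n (ℕₚ.m⊔n≤o⇒n≤o Nˣ Nʸ (closes ≤m)) (ℕₚ.m⊔n≤o⇒n≤o Nˣ Nʸ (closes ≤n))))
    where
    bounds : ∀ {l} → (Nᴬ ⊔ Nᴮ) ⊔ (Nˣ ⊔ Nʸ) ℕ.≤ l → Nᴬ ⊔ Nᴮ ℕ.≤ l
    bounds = ℕₚ.m⊔n≤o⇒m≤o (Nᴬ ⊔ Nᴮ) (Nˣ ⊔ Nʸ)

    closes : ∀ {l} → (Nᴬ ⊔ Nᴮ) ⊔ (Nˣ ⊔ Nʸ) ℕ.≤ l → Nˣ ⊔ Nʸ ℕ.≤ l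
    closes = ℕₚ.m⊔n≤o⇒n≤o (Nᴬ ⊔ Nᴮ) (Nˣ ⊔ Nʸ)

  divide : ∀ C ε → 0ℚ ℚ.< C → 0ℚ ℚ.< ε → ∃[ δ ] (0ℚ ℚ.< δ × C ℚ.* δ ≡ ε)
  divide C ε 0<C 0<ε = C⁻¹ ℚ.* ε
    , subst (ℚ._< C⁻¹ ℚ.* ε) (ℚₚ.*-zeroʳ C⁻¹) (ℚₚ.*-monoʳ-<-pos C⁻¹ {{ℚₚ.1/pos⇒pos C}} 0<ε)
    , trans (sym (ℚₚ.*-assoc C C⁻¹ ε))
            (trans (cong (ℚ._* ε) (ℚₚ.*-inverseʳ C)) (ℚₚ.*-identityˡ ε))
    where
    instance
      C-pos : ℚ.Positive C
      C-pos = ℚ.positive 0<C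

      C-nonZero : ℚ.NonZero C
      C-nonZero = ℚₚ.pos⇒nonZero C

    C⁻¹ : ℚ
    C⁻¹ = ℚ.1/ C

infixl 6 _+_ _-_
infixl 7 _*_
infix  8 -_

_+_ : ℝ → ℝ → ℝ
(x + y) .seq n = seq x n ℚ.+ seq y n
(x + y) .cauchy ε 0<ε with cauchy x (½ ℚ.* ε) (half-pos 0<ε) | cauchy y (½ ℚ.* ε) (half-pos 0<ε)
... | M , closeˣ | N , closeʸ = M ⊔ N , close
  where
  open ℚₚ.≤-Reasoning
  close : ∀ m n → M ⊔ N ℕ.≤ m → M ⊔ N ℕ.≤ n →
          ∣ (seq x m ℚ.+ seq y m) ℚ.- (seq x n ℚ.+ seq y n) ∣ ℚ.< ε
  close m n ≤m ≤n = begin-strict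
    ∣ (seq x m ℚ.+ seq y m) ℚ.- (seq x n ℚ.+ seq y n) ∣
      ≡⟨ cong ∣_∣ (interchange (seq x m) (seq y m) (seq x n) (seq y n)) ⟩
    ∣ (seq x m ℚ.- seq x n) ℚ.+ (seq y m ℚ.- seq y n) ∣
      ≤⟨ ℚₚ.∣p+q∣≤∣p∣+∣q∣ (seq x m ℚ.- seq x n) (seq y m ℚ.- seq y n) ⟩
    ∣ seq x m ℚ.- seq x n ∣ ℚ.+ ∣ seq y m ℚ.- seq y n ∣
      <⟨ ℚₚ.+-mono-< (closeˣ m n (ℕₚ.m⊔n≤o⇒m≤o M N ≤m) (ℕₚ.m⊔n≤o⇒m≤o M N ≤n))
                     (closeʸ m n (ℕₚ.m⊔n≤o⇒n≤o M N ≤m) (ℕₚ.m⊔n≤o⇒n≤o M N ≤n)) ⟩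
    ½ ℚ.* ε ℚ.+ ½ ℚ.* ε
      ≡⟨ halves ε ⟩
    ε ∎

-_ : ℝ → ℝ
(- x) .seq n = ℚ.- seq x n
(- x) .cauchy ε 0<ε with cauchy x ε 0<ε
... | N , close = N , λ m n ≤m ≤n →
  subst (ℚ._< ε)
        (sym (trans (cong ∣_∣ (neg-difference (seq x m) (seq x n)))
                    (ℚₚ.∣-p∣≡∣p∣ (seq x m ℚ.- seq x n))))
        (close m n ≤m ≤n)

_-_ : ℝ → ℝ → ℝ
x - y = x + - y

_*_ : ℝ → ℝ → ℝ
(x * y) .seq n = seq x n ℚ.* seq y n
(x * y) .cauchy ε 0<ε =
  let A , 0<A , Nᴬ , boundˣ = eventuallyBounded x
      B , 0<B , Nᴮ , boundʸ = eventuallyBounded y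
      δ , 0<δ , [A+B]δ≡ε    = divide (A ℚ.+ B) ε (ℚₚ.+-mono-< 0<A 0<B) 0<ε
      Nˣ , closeˣ           = cauchy x δ 0<δ
      Nʸ , closeʸ           = cauchy y δ 0<δ
  in product-cauchy (seq x) (seq y) 0<A 0<B
       (trans (sym (ℚₚ.*-distribʳ-+ δ A B)) [A+B]δ≡ε)
       Nᴬ Nᴮ Nˣ Nʸ boundˣ boundʸ closeˣ closeʸ

-- Suprema and infima are taken in the complete lattice [0,1], where all
-- acceptance probabilities live; in particular the supremum of the empty
-- set (which occurs when F = {0}) is 0.
UnitInterval : Pred ℝ 0ℓ
UnitInterval x = 0ℝ ≤ x × x ≤ 1ℝ

IsSup : Pred ℝ 0ℓ → Pred ℝ 0ℓ
IsSup S s = UnitInterval s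
          × (∀ x → S x → x ≤ s)
          × (∀ u → UnitInterval u → (∀ x → S x → x ≤ u) → s ≤ u)

IsInf : Pred ℝ 0ℓ → Pred ℝ 0ℓ
IsInf S s = UnitInterval s
          × (∀ x → S x → s ≤ x)
          × (∀ l → UnitInterval l → (∀ x → S x → l ≤ x) → l ≤ s)

infix 4 _≈ᶜ_
infixl 6 _+ᶜ_
infixl 7 _*ᶜ_

record ℂ : Set where
  constructor _+i_
  field
    re im : ℝ

open ℂ public

_≈ᶜ_ : ℂ → ℂ → Set
z ≈ᶜ w = re z ≈ re w × im z ≈ im w

0ᶜ 1ᶜ : ℂ
0ᶜ = 0ℝ +i 0ℝ
1ᶜ = 1ℝ +i 0ℝ

_+ᶜ_ _*ᶜ_ : ℂ → ℂ → ℂ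
z +ᶜ w = (re z + re w) +i (im z + im w)
z *ᶜ w = (re z * re w - im z * im w) +i (re z * im w + im z * re w)

conj : ℂ → ℂ
conj z = re z +i (- im z)

∣_∣² : ℂ → ℝ
∣ z ∣² = re z * re z + im z * im z

sumᶜ : ∀ {d} → Vector ℂ d → ℂ
sumᶜ = foldr _+ᶜ_ 0ᶜ

Matrix : ℕ → Set
Matrix d = Fin d → Fin d → ℂ

infix 4 _≈ᵛ_

_≈ᵛ_ : ∀ {d} → Vector ℂ d → Vector ℂ d → Set
φ ≈ᵛ ψ = ∀ i → φ i ≈ᶜ ψ i

⟨_∣_⟩ : ∀ {d} → Vector ℂ d → Vector ℂ d → ℂ
⟨ φ ∣ ψ ⟩ = sumᶜ λ i → conj (φ i) *ᶜ ψ i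

IsUnit : ∀ {d} → Pred (Vector ℂ d) 0ℓ
IsUnit ψ = ⟨ ψ ∣ ψ ⟩ ≈ᶜ 1ᶜ

_·_ : ∀ {d} → Matrix d → Vector ℂ d → Vector ℂ d
(U · ψ) i = sumᶜ λ j → U i j *ᶜ ψ j

_⊗_ : ∀ {d} → Matrix d → Matrix d → Matrix d
(U ⊗ V) i k = sumᶜ λ j → U i j *ᶜ V j k

_† : ∀ {d} → Matrix d → Matrix d
(U †) i j = conj (U j i)

identity : ∀ {d} → Matrix d
identity i j = if does (i ≟ j) then 1ᶜ else 0ᶜ

IsUnitary : ∀ {d} → Pred (Matrix d) 0ℓ
IsUnitary U = (∀ i j → ((U †) ⊗ U) i j ≈ᶜ identity i j)
            × (∀ i j → (U ⊗ (U †)) i j ≈ᶜ identity i j)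

record Subspace (d : ℕ) : Set₁ where
  field
    _∈F   : Pred (Vector ℂ d) 0ℓ
    resp  : ∀ {φ ψ} → φ ≈ᵛ ψ → φ ∈F → ψ ∈F
    zero∈ : (λ _ → 0ᶜ) ∈F
    +∈    : ∀ {φ ψ} → φ ∈F → ψ ∈F → (λ i → φ i +ᶜ ψ i) ∈F
    *∈    : ∀ c {ψ} → ψ ∈F → (λ i → c *ᶜ ψ i) ∈F

-- The Hilbert space is ℂᵈ with d = dim, the alphabet is Fin k.
record QuantumAutomaton (k : ℕ) : Set₁ where
  field
    dim       : ℕ
    s₀        : Vector ℂ dim
    s₀-unit   : IsUnit s₀
    U         : Fin k → Matrix dim
    U-unitary : ∀ σ → IsUnitary (U σ)
    F         : Subspace dim

-- The letter σₙ₊₁ of an ω-word w is w n.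
ωWord : ℕ → Set
ωWord k = ℕ → Fin k

-- The checkpoint nᵢ₊₁ is  at i.
record Checkpoints : Set where
  field
    at         : ℕ → ℕ
    increasing : ∀ i → at i ℕ.< at (suc i)

  i≤at : ∀ i → i ℕ.≤ at i
  i≤at zero    = ℕ.z≤n
  i≤at (suc i) = ℕₚ.≤-<-trans (i≤at i) (increasing i)

  isCheckpoint? : ∀ n → Dec (∃[ i ] at i ≡ n)
  isCheckpoint? n = map′
    (λ { (i , _ , eq) → i , eq })
    (λ { (i , eq) → i , ℕ.s≤s (subst (i ℕ.≤_) eq (i≤at i)) , eq })
    (ℕₚ.anyUpTo? (λ i → at i ℕ.≟ n) (suc n))

module _ {k} (𝒜 : QuantumAutomaton k) (w : ωWord k) where
  open QuantumAutomaton 𝒜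
  open Checkpoints using (at; isCheckpoint?)

  disturbingRun : Vector ℂ dim → Checkpoints → ℕ → Vector ℂ dim
  disturbingRun ψ c zero    = s₀
  disturbingRun ψ c (suc n) =
    U (w n) · (if does (isCheckpoint? c n) then ψ else disturbingRun ψ c n)

  -- v = inf_i |⟨ψ|s_{nᵢ}⟩|²
  IsInfOverCheckpoints : Vector ℂ dim → Checkpoints → Pred ℝ 0ℓ
  IsInfOverCheckpoints ψ c = IsInf λ x →
    ∃[ i ] x ≈ ∣ ⟨ ψ ∣ disturbingRun ψ c (at c i) ⟩ ∣²

  -- v = sup_{nᵢ} inf_i |⟨ψ|s_{nᵢ}⟩|²
  IsSupOverSequences : Vector ℂ dim → Pred ℝ 0ℓ
  IsSupOverSequences ψ = IsSup λ x → ∃[ c ] IsInfOverCheckpoints ψ c x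

  -- The graph of f (f is total under excluded middle): v = sup_ψ sup_{nᵢ} inf_i |⟨ψ|s_{nᵢ}⟩|²
  IsfD : Pred ℝ 0ℓ
  IsfD = IsSup λ x →
    ∃[ ψ ] (Subspace._∈F F ψ × IsUnit ψ × IsSupOverSequences ψ x)

𝓛⁼¹ : ∀ {k} → QuantumAutomaton k → Pred (ωWord k) 0ℓ
𝓛⁼¹ 𝒜 w = IsfD 𝒜 w 1ℝ

𝓛^> : ∀ {k} → ℝ → QuantumAutomaton k → Pred (ωWord k) 0ℓ
𝓛^> r 𝒜 w = ∃[ v ] (IsfD 𝒜 w v × r < v)

ωLanguage : Set₁
ωLanguage = Σ ℕ λ k → Pred (ωWord k) 0ℓ

𝕃⁼¹ : Pred ωLanguage (ℓsuc 0ℓ)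
𝕃⁼¹ (k , L) = Σ (QuantumAutomaton k) λ 𝒜 → L ≐ 𝓛⁼¹ 𝒜

𝕃^> : ℝ → Pred ωLanguage (ℓsuc 0ℓ)
𝕃^> r (k , L) = Σ (QuantumAutomaton k) λ 𝒜 → L ≐ 𝓛^> r 𝒜

{-# OPTIONS --safe #-}
module Submission where

-- The separating language is the = 1 language of a two-dimensional automaton:
-- the letter a is the rotation with cosine 3/5 and sine 4/5, the letter c is
-- the identity, and both s₀ and F lie on the first axis.  The word cᵚ has value 1.
-- In aᴺcᵚ with N ≥ 1 some inter-checkpoint segment applies a power aʲ with
-- 1 ≤ j ≤ N and ends after the block aᴺ, so the value is at most
-- max cos²(jθ), which is < 1 because (3 + 4i)ʲ ≡ 3 + 4i modulo 5.
--
-- A > r language containing cᵚ also contains some aᴺcᵚ with N ≥ 1: the orbit of s₀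
-- under the unitary of a is bounded, so by the pigeonhole principle it returns
-- arbitrarily close to s₀.  Shifting the checkpoints by such a return time N changes
-- only the first amplitude, and that one by an arbitrarily small amount, because
-- every checkpoint resets the run.

open import Defs
open import Algebra.Bundles using (CommutativeSemiring)
import Algebra.Properties.Semiring.Sum as SemiringSum
open import Algebra.Structures.Biased using (IsCommutativeSemiringˡ)
open import Axiom.ExcludedMiddle using (ExcludedMiddle)
open import Data.Bool using (if_then_else_)
open import Data.Fin as Fin using (Fin; zero; suc)
import Data.Fin.Properties as Finₚ
open import Data.Integer as ℤ using (ℤ; +_; -[1+_])
import Data.Integer.Properties as ℤₚ
open import Data.Nat as ℕ using (ℕ; zero; suc; _⊔_)
import Data.Nat.Divisibility as ℕ∣
import Data.Nat.Properties as ℕₚ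
open import Data.Product using (Σ; ∃-syntax; _×_; _,_; proj₁; proj₂)
open import Data.Rational as ℚ using (ℚ; 0ℚ; 1ℚ; ½; ∣_∣)
import Data.Rational.Properties as ℚₚ
open import Data.Rational.Solver using (module +-*-Solver)
import Data.Rational.Unnormalised as ℚᵘ
import Data.Rational.Unnormalised.Properties as ℚᵘₚ
open import Data.Sum using (_⊎_; inj₁; inj₂)
open import Data.Vec.Functional using (Vector)
open import Function using (_∘_)
open import Level using (0ℓ)
open import Relation.Binary.Definitions using (tri<; tri≈; tri>)
open import Relation.Binary.PropositionalEquality using (_≡_; refl; sym; trans; cong; cong₂; subst; subst₂; module ≡-Reasoning)
import Relation.Binary.Reasoning.Setoid as SetoidReasoning
open import Relation.Binary.Structures using (IsEquivalence)
open import Relation.Nullary using (¬_; Dec; yes; no; does; contradiction)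
open import Relation.Nullary.Decidable using (dec-true; dec-false)
open import Relation.Unary using (Pred; _⊈_)
open import Relation.Unary.Properties using (≐-refl)
open +-*-Solver using (solve; _:=_; _:+_; _:*_; _:-_; :-_; con)

-- With a checkpoint at every position from N on, aᴺcᵚ attains cos²(Nθ), and return times bring this
-- arbitrarily close to 1. The values of these words therefore leave no gap below 1, and only the
-- exact test "= 1" separates all of them from cᵚ. For a fixed N only the powers up to N compete,
-- and this keeps the supremum over all checkpoint sequences away from 1.
--
-- The order of choices carries the other half. A value strictly above r is witnessed by one vector
-- ψ and one checkpoint sequence whose amplitudes all exceed r by a common margin. Both are fixed
-- before the return time, so the return time may depend on ψ and on the first checkpoint, and it
-- has to control a single amplitude.
--
-- The 3-4-5 triangle gives a rotation with rational entries, so unitarity and the numbers cos²(jθ)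
-- are matters of rational arithmetic. No positive power of it has sine 0, so none maps the line F
-- to itself.
--
-- Excluded middle provides suprema and infima of arbitrary sets of reals and decides comparisons of
-- reals.

Eventually : Pred ℕ 0ℓ → Set
Eventually P = ∃[ N ] (∀ n → N ℕ.≤ n → P n)

always : ∀ {P : Pred ℕ 0ℓ} → (∀ n → P n) → Eventually P
always p = 0 , λ n _ → p n

map-eventually : ∀ {P Q : Pred ℕ 0ℓ} → (∀ n → P n → Q n) → Eventually P → Eventually Q
map-eventually f (N , p) = N , λ n N≤n → f n (p n N≤n)

map₂-eventually : ∀ {P Q R : Pred ℕ 0ℓ} → (∀ n → P n → Q n → R n) →
                  Eventually P → Eventually Q → Eventually R
map₂-eventually f (M , p) (N , q) = M ⊔ N , λ n ≤n →
  f n (p n (ℕₚ.m⊔n≤o⇒m≤o M N ≤n)) (q n (ℕₚ.m⊔n≤o⇒n≤o M N ≤n))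

-- Estimates in the rationals.

half : ℚ → ℚ
half ε = ½ ℚ.* ε

half-pos : ∀ {ε} → 0ℚ ℚ.< ε → 0ℚ ℚ.< half ε
half-pos {ε} 0<ε = subst (ℚ._< half ε) (ℚₚ.*-zeroʳ ½) (ℚₚ.*-monoʳ-<-pos ½ 0<ε)

half+half : ∀ ε → half ε ℚ.+ half ε ≡ ε
half+half = solve 1 (λ ε → con ½ :* ε :+ con ½ :* ε := ε) refl

half< : ∀ {ε} → 0ℚ ℚ.< ε → half ε ℚ.< ε
half< {ε} 0<ε = begin-strict
  half ε              ≡⟨ ℚₚ.+-identityʳ (half ε) ⟨
  half ε ℚ.+ 0ℚ       <⟨ ℚₚ.+-monoʳ-< (half ε) (half-pos 0<ε) ⟩
  half ε ℚ.+ half ε   ≡⟨ half+half ε ⟩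
  ε                   ∎
  where open ℚₚ.≤-Reasoning

0<1 : 0ℚ ℚ.< 1ℚ
0<1 = ℚₚ.positive⁻¹ 1ℚ

0≤-* : ∀ {p q} → 0ℚ ℚ.≤ p → 0ℚ ℚ.≤ q → 0ℚ ℚ.≤ p ℚ.* q
0≤-* {p} {q} 0≤p 0≤q = subst (ℚ._≤ p ℚ.* q) (ℚₚ.*-zeroʳ p)
  (ℚₚ.*-monoˡ-≤-nonNeg p {{ℚ.nonNegative 0≤p}} 0≤q)

0≤-square : ∀ p → 0ℚ ℚ.≤ p ℚ.* p
0≤-square p with ℚₚ.≤-total 0ℚ p
... | inj₁ 0≤p = 0≤-* 0≤p 0≤p
... | inj₂ p≤0 = subst (0ℚ ℚ.≤_) (solve 1 (λ p → :- p :* :- p := p :* p) refl p)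
                   (0≤-* (ℚₚ.neg-antimono-≤ p≤0) (ℚₚ.neg-antimono-≤ p≤0))

≤-by-difference : ∀ {p q t} → 0ℚ ℚ.≤ t → p ℚ.+ t ≡ q → p ℚ.≤ q
≤-by-difference {p} 0≤t eq = subst₂ ℚ._≤_ (ℚₚ.+-identityʳ p) eq (ℚₚ.+-monoʳ-≤ p 0≤t)

p≤∣p∣ : ∀ p → p ℚ.≤ ∣ p ∣
p≤∣p∣ p with ℚₚ.≤-total 0ℚ p
... | inj₁ 0≤p = ℚₚ.≤-reflexive (sym (ℚₚ.0≤p⇒∣p∣≡p 0≤p))
... | inj₂ p≤0 = ℚₚ.≤-trans p≤0 (ℚₚ.0≤∣p∣ p)

∣p-q∣<ε⇒p≤q+ε : ∀ p q {ε} → ∣ p ℚ.- q ∣ ℚ.< ε → p ℚ.≤ q ℚ.+ ε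
∣p-q∣<ε⇒p≤q+ε p q {ε} close = begin
  p                    ≡⟨ solve 2 (λ p q → p := q :+ (p :- q)) refl p q ⟩
  q ℚ.+ (p ℚ.- q)      ≤⟨ ℚₚ.+-monoʳ-≤ q (p≤∣p∣ (p ℚ.- q)) ⟩
  q ℚ.+ ∣ p ℚ.- q ∣    ≤⟨ ℚₚ.+-monoʳ-≤ q (ℚₚ.<⇒≤ close) ⟩
  q ℚ.+ ε              ∎
  where open ℚₚ.≤-Reasoning

∣-∣-sym : ∀ p q → ∣ p ℚ.- q ∣ ≡ ∣ q ℚ.- p ∣
∣-∣-sym p q = trans (cong ∣_∣ (solve 2 (λ p q → p :- q := :- (q :- p)) refl p q)) (ℚₚ.∣-p∣≡∣p∣ (q ℚ.- p))

∣p-q∣≤ : ∀ p q {ε} → p ℚ.≤ q ℚ.+ ε → q ℚ.≤ p ℚ.+ ε → ∣ p ℚ.- q ∣ ℚ.≤ ε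
∣p-q∣≤ p q {ε} p≤ q≤ with ℚₚ.∣p∣≡p∨∣p∣≡-p (p ℚ.- q)
... | inj₁ eq = subst₂ ℚ._≤_ (sym eq) (solve 2 (λ q ε → (q :+ ε) :- q := ε) refl q ε)
                  (ℚₚ.+-monoˡ-≤ (ℚ.- q) p≤)
... | inj₂ eq = subst₂ ℚ._≤_ (trans (solve 2 (λ p q → q :- p := :- (p :- q)) refl p q) (sym eq))
                  (solve 2 (λ p ε → (p :+ ε) :- p := ε) refl p ε)
                  (ℚₚ.+-monoˡ-≤ (ℚ.- p) q≤)

-- Order and setoid equality of the reals

≤-refl : ∀ x → x ≤ x
≤-refl x ε 0<ε = always λ n → ≤-by-difference (ℚₚ.<⇒≤ 0<ε) refl

pointwise-≤ : ∀ x y → (∀ n → seq x n ℚ.≤ seq y n) → x ≤ y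
pointwise-≤ x y p ε 0<ε = always λ n → ℚₚ.≤-trans (p n) (≤-by-difference (ℚₚ.<⇒≤ 0<ε) refl)

≤-trans : ∀ x y z → x ≤ y → y ≤ z → x ≤ z
≤-trans x y z x≤y y≤z ε 0<ε =
  map₂-eventually step (x≤y (half ε) (half-pos 0<ε)) (y≤z (half ε) (half-pos 0<ε))
  where
  open ℚₚ.≤-Reasoning
  step : ∀ n → seq x n ℚ.≤ seq y n ℚ.+ half ε → seq y n ℚ.≤ seq z n ℚ.+ half ε →
         seq x n ℚ.≤ seq z n ℚ.+ ε
  step n p q = begin
    seq x n                           ≤⟨ p ⟩
    seq y n ℚ.+ half ε                ≤⟨ ℚₚ.+-monoˡ-≤ (half ε) q ⟩
    seq z n ℚ.+ half ε ℚ.+ half ε     ≡⟨ ℚₚ.+-assoc (seq z n) (half ε) (half ε) ⟩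
    seq z n ℚ.+ (half ε ℚ.+ half ε)   ≡⟨ cong (seq z n ℚ.+_) (half+half ε) ⟩
    seq z n ℚ.+ ε                     ∎

+-mono-≤ : ∀ x y u v → x ≤ y → u ≤ v → x + u ≤ y + v
+-mono-≤ x y u v x≤y u≤v ε 0<ε =
  map₂-eventually step (x≤y (half ε) (half-pos 0<ε)) (u≤v (half ε) (half-pos 0<ε))
  where
  open ℚₚ.≤-Reasoning
  step : ∀ n → seq x n ℚ.≤ seq y n ℚ.+ half ε → seq u n ℚ.≤ seq v n ℚ.+ half ε →
         seq x n ℚ.+ seq u n ℚ.≤ seq y n ℚ.+ seq v n ℚ.+ ε
  step n p q = begin
    seq x n ℚ.+ seq u n
      ≤⟨ ℚₚ.+-mono-≤ p q ⟩
    seq y n ℚ.+ half ε ℚ.+ (seq v n ℚ.+ half ε)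
      ≡⟨ solve 3 (λ y v ε → y :+ con ½ :* ε :+ (v :+ con ½ :* ε) := y :+ v :+ ε) refl (seq y n) (seq v n) ε ⟩
    seq y n ℚ.+ seq v n ℚ.+ ε
      ∎

≈⇒≤ : ∀ x y → x ≈ y → x ≤ y
≈⇒≤ x y x≈y ε 0<ε = map-eventually (λ n → ∣p-q∣<ε⇒p≤q+ε (seq x n) (seq y n)) (x≈y ε 0<ε)

≤-antisym : ∀ x y → x ≤ y → y ≤ x → x ≈ y
≤-antisym x y x≤y y≤x ε 0<ε = map₂-eventually
  (λ n p q → ℚₚ.≤-<-trans (∣p-q∣≤ (seq x n) (seq y n) p q) (half< 0<ε))
  (x≤y (half ε) (half-pos 0<ε)) (y≤x (half ε) (half-pos 0<ε))

≈-sym : ∀ x y → x ≈ y → y ≈ x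
≈-sym x y x≈y ε 0<ε =
  map-eventually (λ n → subst (ℚ._< ε) (∣-∣-sym (seq x n) (seq y n))) (x≈y ε 0<ε)

≈⇒≥ : ∀ x y → x ≈ y → y ≤ x
≈⇒≥ x y x≈y = ≈⇒≤ y x (≈-sym x y x≈y)

≈-trans : ∀ x y z → x ≈ y → y ≈ z → x ≈ z
≈-trans x y z x≈y y≈z = ≤-antisym x z
  (≤-trans x y z (≈⇒≤ x y x≈y) (≈⇒≤ y z y≈z))
  (≤-trans z y x (≈⇒≥ y z y≈z) (≈⇒≥ x y x≈y))

pointwise-≈ : ∀ x y → (∀ n → seq x n ≡ seq y n) → x ≈ y
pointwise-≈ x y p = ≤-antisym x y
  (pointwise-≤ x y λ n → ℚₚ.≤-reflexive (p n)) (pointwise-≤ y x λ n → ℚₚ.≤-reflexive (sym (p n)))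

≈-refl : ∀ x → x ≈ x
≈-refl x = pointwise-≈ x x λ _ → refl

+-cong : ∀ x y u v → x ≈ y → u ≈ v → x + u ≈ y + v
+-cong x y u v x≈y u≈v = ≤-antisym (x + u) (y + v)
  (+-mono-≤ x y u v (≈⇒≤ x y x≈y) (≈⇒≤ u v u≈v))
  (+-mono-≤ y x v u (≈⇒≥ x y x≈y) (≈⇒≥ u v u≈v))

-‿cong : ∀ x y → x ≈ y → - x ≈ - y
-‿cong x y x≈y ε 0<ε = map-eventually (λ n → subst (ℚ._< ε) (negate n)) (x≈y ε 0<ε)
  where
  negate : ∀ n → ∣ seq x n ℚ.- seq y n ∣ ≡ ∣ ℚ.- seq x n ℚ.- ℚ.- seq y n ∣
  negate n = trans (∣-∣-sym (seq x n) (seq y n))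
    (cong ∣_∣ (solve 2 (λ a b → b :- a := :- a :- :- b) refl (seq x n) (seq y n)))

eventually-bounded : ∀ x → ∃[ B ] (0ℚ ℚ.< B × Eventually λ n → ∣ seq x n ∣ ℚ.≤ B)
eventually-bounded x with cauchy x 1ℚ 0<1
... | N , close = 1ℚ ℚ.+ ∣ seq x N ∣ , ℚₚ.+-mono-<-≤ 0<1 (ℚₚ.0≤∣p∣ (seq x N)) , N , bound
  where
  open ℚₚ.≤-Reasoning
  bound : ∀ n → N ℕ.≤ n → ∣ seq x n ∣ ℚ.≤ 1ℚ ℚ.+ ∣ seq x N ∣
  bound n N≤n = begin
    ∣ seq x n ∣
      ≡⟨ cong ∣_∣ (solve 2 (λ a b → a := a :- b :+ b) refl (seq x n) (seq x N)) ⟩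
    ∣ seq x n ℚ.- seq x N ℚ.+ seq x N ∣
      ≤⟨ ℚₚ.∣p+q∣≤∣p∣+∣q∣ (seq x n ℚ.- seq x N) (seq x N) ⟩
    ∣ seq x n ℚ.- seq x N ∣ ℚ.+ ∣ seq x N ∣
      ≤⟨ ℚₚ.+-monoˡ-≤ ∣ seq x N ∣ (ℚₚ.<⇒≤ (close n N N≤n ℕₚ.≤-refl)) ⟩
    1ℚ ℚ.+ ∣ seq x N ∣
      ∎

divide : ∀ C ε → 0ℚ ℚ.< C → 0ℚ ℚ.< ε → ∃[ δ ] (0ℚ ℚ.< δ × C ℚ.* δ ≡ ε)
divide C ε 0<C 0<ε = C⁻¹ ℚ.* ε
  , subst (ℚ._< C⁻¹ ℚ.* ε) (ℚₚ.*-zeroʳ C⁻¹) (ℚₚ.*-monoʳ-<-pos C⁻¹ {{ℚₚ.1/pos⇒pos C}} 0<ε)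
  , trans (sym (ℚₚ.*-assoc C C⁻¹ ε))
          (trans (cong (ℚ._* ε) (ℚₚ.*-inverseʳ C)) (ℚₚ.*-identityˡ ε))
  where
  instance
    C-pos : ℚ.Positive C
    C-pos = ℚ.positive 0<C

    C-nonZero : ℚ.NonZero C
    C-nonZero = ℚₚ.pos⇒nonZero C

  C⁻¹ : ℚ
  C⁻¹ = ℚ.1/ C

*-congˡ : ∀ x y z → x ≈ y → z * x ≈ z * y
*-congˡ x y z x≈y ε 0<ε =
  let B , 0<B , bounded = eventually-bounded z
      δ , 0<δ , Bδ≡ε    = divide B ε 0<B 0<ε
      step : ∀ n → ∣ seq z n ∣ ℚ.≤ B → ∣ seq x n ℚ.- seq y n ∣ ℚ.< δ →
             ∣ seq z n ℚ.* seq x n ℚ.- seq z n ℚ.* seq y n ∣ ℚ.< ε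
      step n z≤B close = begin-strict
        ∣ seq z n ℚ.* seq x n ℚ.- seq z n ℚ.* seq y n ∣
          ≡⟨ cong ∣_∣ (solve 3 (λ x y z → z :* x :- z :* y := z :* (x :- y)) refl (seq x n) (seq y n) (seq z n)) ⟩
        ∣ seq z n ℚ.* (seq x n ℚ.- seq y n) ∣
          ≡⟨ ℚₚ.∣p*q∣≡∣p∣*∣q∣ (seq z n) (seq x n ℚ.- seq y n) ⟩
        ∣ seq z n ∣ ℚ.* ∣ seq x n ℚ.- seq y n ∣
          ≤⟨ ℚₚ.*-monoʳ-≤-nonNeg _ {{ℚₚ.∣-∣-nonNeg (seq x n ℚ.- seq y n)}} z≤B ⟩
        B ℚ.* ∣ seq x n ℚ.- seq y n ∣
          <⟨ ℚₚ.*-monoʳ-<-pos B {{ℚ.positive 0<B}} close ⟩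
        B ℚ.* δ
          ≡⟨ Bδ≡ε ⟩
        ε ∎
  in map₂-eventually step bounded (x≈y δ 0<δ)
  where open ℚₚ.≤-Reasoning

*-comm : ∀ x y → x * y ≈ y * x
*-comm x y = pointwise-≈ (x * y) (y * x) λ n → ℚₚ.*-comm (seq x n) (seq y n)

*-cong : ∀ x y u v → x ≈ y → u ≈ v → x * u ≈ y * v
*-cong x y u v x≈y u≈v =
  ≈-trans (x * u) (x * v) (y * v) (*-congˡ u v x u≈v)
    (≈-trans (x * v) (v * x) (y * v) (*-comm x v)
      (≈-trans (v * x) (v * y) (y * v) (*-congˡ x y v x≈y) (*-comm v y)))

0≤-square-ℝ : ∀ x → 0ℝ ≤ x * x
0≤-square-ℝ x = pointwise-≤ 0ℝ (x * x) λ n → 0≤-square (seq x n)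

fromℚ-mono-≤ : ∀ {p q} → p ℚ.≤ q → fromℚ p ≤ fromℚ q
fromℚ-mono-≤ {p} {q} p≤q = pointwise-≤ (fromℚ p) (fromℚ q) λ _ → p≤q

fromℚ-cancel-≤ : ∀ {p q} → fromℚ p ≤ fromℚ q → p ℚ.≤ q
fromℚ-cancel-≤ {p} {q} p≤q = ℚₚ.≮⇒≥ λ q<p → ℚₚ.<-irrefl refl (ℚₚ.<-≤-trans (gap q<p) (below q<p))
  where
  ε = half (p ℚ.- q)
  0<p-q : q ℚ.< p → 0ℚ ℚ.< p ℚ.- q
  0<p-q q<p = subst (ℚ._< p ℚ.- q) (ℚₚ.+-inverseʳ q) (ℚₚ.+-monoˡ-< (ℚ.- q) q<p)
  below : q ℚ.< p → p ℚ.≤ q ℚ.+ ε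
  below q<p = let N , le = p≤q ε (half-pos (0<p-q q<p)) in le N ℕₚ.≤-refl
  gap : q ℚ.< p → q ℚ.+ ε ℚ.< p
  gap q<p = subst (q ℚ.+ ε ℚ.<_) (solve 2 (λ p q → q :+ (p :- q) := p) refl p q)
              (ℚₚ.+-monoʳ-< q (half< (0<p-q q<p)))

<⇒≤ : ∀ x y → x < y → x ≤ y
<⇒≤ x y (ε , 0<ε , x+ε≤y) δ 0<δ = map-eventually
  (λ n le → ℚₚ.≤-trans (≤-by-difference (ℚₚ.<⇒≤ 0<ε) refl) (ℚₚ.≤-trans le (≤-by-difference (ℚₚ.<⇒≤ 0<δ) refl)))
  x+ε≤y

<⇒≱ : ∀ x y → x < y → ¬ (y ≤ x)
<⇒≱ x y (ε , 0<ε , x+ε≤y) y≤x =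
  let N , impossible = map₂-eventually
        (λ n p q → ℚₚ.<-irrefl refl (ℚₚ.<-≤-trans (ℚₚ.+-monoʳ-< (seq x n) (half< 0<ε)) (ℚₚ.≤-trans p q)))
        x+ε≤y (y≤x (half ε) (half-pos 0<ε))
  in impossible N ℕₚ.≤-refl

+ε≤⇒< : ∀ x y {ε} → 0ℚ ℚ.< ε → x + fromℚ ε ≤ y → x < y
+ε≤⇒< x y {ε} 0<ε x+ε≤y = half ε , half-pos 0<ε ,
  map-eventually step (x+ε≤y (half ε) (half-pos 0<ε))
  where
  step : ∀ n → seq x n ℚ.+ ε ℚ.≤ seq y n ℚ.+ half ε → seq x n ℚ.+ half ε ℚ.≤ seq y n
  step n le = subst₂ ℚ._≤_
    (solve 2 (λ x ε → x :+ ε :- con ½ :* ε := x :+ con ½ :* ε) refl (seq x n) ε)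
    (solve 2 (λ y ε → y :+ con ½ :* ε :- con ½ :* ε := y) refl (seq y n) ε)
    (ℚₚ.+-monoˡ-≤ (ℚ.- half ε) le)

<⇒+ε≤ : ∀ x y → x < y → ∃[ ε ] (0ℚ ℚ.< ε × x + fromℚ ε ≤ y)
<⇒+ε≤ x y (ε , 0<ε , le) = ε , 0<ε , λ δ 0<δ →
  map-eventually (λ n p → ℚₚ.≤-trans p (≤-by-difference (ℚₚ.<⇒≤ 0<δ) refl)) le

<-≤-trans : ∀ x y z → x < y → y ≤ z → x < z
<-≤-trans x y z x<y y≤z =
  let ε , 0<ε , le = <⇒+ε≤ x y x<y in +ε≤⇒< x z 0<ε (≤-trans (x + fromℚ ε) y z le y≤z)

-- Beyond some index `K` both sequences stay within ε/8 of their `K`-th terms, so one rational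
-- comparison at `K` settles the matter: either y exceeds x there by at most ε/2, which bounds all
-- later terms, or by at least ε/2, which leaves a permanent gap of ε/8 and contradicts the
-- hypothesis.
≮⇒≥ : ∀ x y → ¬ (x < y) → y ≤ x
≮⇒≥ x y x≮y ε 0<ε =
  let M , closeˣ = cauchy x δ 0<δ
      N , closeʸ = cauchy y δ 0<δ
      K          = M ⊔ N
      M≤ : ∀ {n} → K ℕ.≤ n → M ℕ.≤ n
      M≤ = ℕₚ.m⊔n≤o⇒m≤o M N
      N≤ : ∀ {n} → K ℕ.≤ n → N ℕ.≤ n
      N≤ = ℕₚ.m⊔n≤o⇒n≤o M N
  in compare K
       (λ n K≤n → ∣p-q∣<ε⇒p≤q+ε (seq x K) (seq x n) (closeˣ K n (M≤ ℕₚ.≤-refl) (M≤ K≤n)))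
       (λ n K≤n → ∣p-q∣<ε⇒p≤q+ε (seq x n) (seq x K) (closeˣ n K (M≤ K≤n) (M≤ ℕₚ.≤-refl)))
       (λ n K≤n → ∣p-q∣<ε⇒p≤q+ε (seq y K) (seq y n) (closeʸ K n (N≤ ℕₚ.≤-refl) (N≤ K≤n)))
       (λ n K≤n → ∣p-q∣<ε⇒p≤q+ε (seq y n) (seq y K) (closeʸ n K (N≤ K≤n) (N≤ ℕₚ.≤-refl)))
  where
  open ℚₚ.≤-Reasoning
  δ = half (half (half ε))
  0<δ : 0ℚ ℚ.< δ
  0<δ = half-pos (half-pos (half-pos 0<ε))

  compare : ∀ K → (∀ n → K ℕ.≤ n → seq x K ℚ.≤ seq x n ℚ.+ δ) → (∀ n → K ℕ.≤ n → seq x n ℚ.≤ seq x K ℚ.+ δ) →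
            (∀ n → K ℕ.≤ n → seq y K ℚ.≤ seq y n ℚ.+ δ) → (∀ n → K ℕ.≤ n → seq y n ℚ.≤ seq y K ℚ.+ δ) →
            Eventually λ n → seq y n ℚ.≤ seq x n ℚ.+ ε
  compare K x₁ x₂ y₁ y₂ with ℚₚ.≤-total (seq y K) (seq x K ℚ.+ half ε)
  ... | inj₁ le = K , λ n K≤n → begin
    seq y n                                  ≤⟨ y₂ n K≤n ⟩
    seq y K ℚ.+ δ                            ≤⟨ ℚₚ.+-monoˡ-≤ δ le ⟩
    seq x K ℚ.+ half ε ℚ.+ δ                 ≤⟨ ℚₚ.+-monoˡ-≤ δ (ℚₚ.+-monoˡ-≤ (half ε) (x₁ n K≤n)) ⟩
    seq x n ℚ.+ δ ℚ.+ half ε ℚ.+ δ           ≤⟨ ≤-by-difference (ℚₚ.<⇒≤ (half-pos (half-pos 0<ε)))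
                                                  (solve 2 (λ x ε → x :+ h (h (h ε)) :+ h ε :+ h (h (h ε)) :+ h (h ε) := x :+ ε) refl (seq x n) ε) ⟩
    seq x n ℚ.+ ε                            ∎
    where h = λ {n} (e : +-*-Solver.Polynomial n) → con ½ :* e
  ... | inj₂ ge = contradiction (δ , 0<δ , K , λ n K≤n → begin
    seq x n ℚ.+ δ                            ≤⟨ ℚₚ.+-monoˡ-≤ δ (x₂ n K≤n) ⟩
    seq x K ℚ.+ δ ℚ.+ δ                      ≤⟨ ≤-by-difference (ℚₚ.<⇒≤ 0<δ)
                                                  (solve 2 (λ x ε → x :+ h (h (h ε)) :+ h (h (h ε)) :+ h (h (h ε)) := x :+ h ε :- h (h (h ε))) refl (seq x K) ε) ⟩
    seq x K ℚ.+ half ε ℚ.- δ                 ≤⟨ ℚₚ.+-monoˡ-≤ (ℚ.- δ) ge ⟩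
    seq y K ℚ.- δ                            ≤⟨ ℚₚ.+-monoˡ-≤ (ℚ.- δ) (y₁ n K≤n) ⟩
    seq y n ℚ.+ δ ℚ.- δ                      ≡⟨ solve 2 (λ y δ → y :+ δ :- δ := y) refl (seq y n) δ ⟩
    seq y n                                  ∎) x≮y
    where h = λ {n} (e : +-*-Solver.Polynomial n) → con ½ :* e

-- Integers among the rationals, the Archimedean property, vanishing meshes.

fromℤ : ℤ → ℚ
fromℤ i = i ℚ./ 1

toℚᵘ-fromℤ : ∀ i → ℚ.toℚᵘ (fromℤ i) ℚᵘ.≃ ℚᵘ.mkℚᵘ i 0
toℚᵘ-fromℤ i = ℚₚ.toℚᵘ-fromℚᵘ (ℚᵘ.mkℚᵘ i 0)

fromℤ-+ : ∀ i j → fromℤ (i ℤ.+ j) ≡ fromℤ i ℚ.+ fromℤ j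
fromℤ-+ i j = ℚₚ.toℚᵘ-injective (begin
  ℚ.toℚᵘ (fromℤ (i ℤ.+ j))                  ≈⟨ toℚᵘ-fromℤ (i ℤ.+ j) ⟩
  ℚᵘ.mkℚᵘ (i ℤ.+ j) 0                        ≈⟨ ℚᵘ.*≡* (cong (ℤ._* ℤ.1ℤ) (cong₂ ℤ._+_ (sym (ℤₚ.*-identityʳ i)) (sym (ℤₚ.*-identityʳ j)))) ⟩
  ℚᵘ.mkℚᵘ i 0 ℚᵘ.+ ℚᵘ.mkℚᵘ j 0               ≈⟨ ℚᵘₚ.+-cong (toℚᵘ-fromℤ i) (toℚᵘ-fromℤ j) ⟨
  ℚ.toℚᵘ (fromℤ i) ℚᵘ.+ ℚ.toℚᵘ (fromℤ j)     ≈⟨ ℚₚ.toℚᵘ-homo-+ (fromℤ i) (fromℤ j) ⟨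
  ℚ.toℚᵘ (fromℤ i ℚ.+ fromℤ j)               ∎)
  where open ℚᵘₚ.≃-Reasoning

fromℤ-* : ∀ i j → fromℤ (i ℤ.* j) ≡ fromℤ i ℚ.* fromℤ j
fromℤ-* i j = ℚₚ.toℚᵘ-injective (begin
  ℚ.toℚᵘ (fromℤ (i ℤ.* j))                  ≈⟨ toℚᵘ-fromℤ (i ℤ.* j) ⟩
  ℚᵘ.mkℚᵘ i 0 ℚᵘ.* ℚᵘ.mkℚᵘ j 0               ≈⟨ ℚᵘₚ.*-cong (toℚᵘ-fromℤ i) (toℚᵘ-fromℤ j) ⟨
  ℚ.toℚᵘ (fromℤ i) ℚᵘ.* ℚ.toℚᵘ (fromℤ j)     ≈⟨ ℚₚ.toℚᵘ-homo-* (fromℤ i) (fromℤ j) ⟨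
  ℚ.toℚᵘ (fromℤ i ℚ.* fromℤ j)               ∎)
  where open ℚᵘₚ.≃-Reasoning

fromℤ-injective : ∀ {i j} → fromℤ i ≡ fromℤ j → i ≡ j
fromℤ-injective {i} {j} eq
  with ℚᵘₚ.≃-trans (ℚᵘₚ.≃-sym (toℚᵘ-fromℤ i)) (ℚᵘₚ.≃-trans (ℚᵘₚ.≃-reflexive (cong ℚ.toℚᵘ eq)) (toℚᵘ-fromℤ j))
... | ℚᵘ.*≡* i*1≡j*1 = ℤₚ.*-cancelʳ-≡ i j ℤ.1ℤ i*1≡j*1

fromℕ : ℕ → ℚ
fromℕ n = fromℤ (+ n)

fromℕ-suc : ∀ n → fromℕ (suc n) ≡ 1ℚ ℚ.+ fromℕ n
fromℕ-suc n = fromℤ-+ (+ 1) (+ n)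

0≤fromℕ : ∀ n → 0ℚ ℚ.≤ fromℕ n
0≤fromℕ zero    = ℚₚ.≤-refl
0≤fromℕ (suc n) = subst (0ℚ ℚ.≤_) (sym (fromℕ-suc n)) (ℚₚ.+-mono-≤ (ℚₚ.<⇒≤ 0<1) (0≤fromℕ n))

0<fromℕ-suc : ∀ n → 0ℚ ℚ.< fromℕ (suc n)
0<fromℕ-suc n = subst (0ℚ ℚ.<_) (sym (fromℕ-suc n)) (ℚₚ.+-mono-<-≤ 0<1 (0≤fromℕ n))

fromℕ-mono-≤ : ∀ {m n} → m ℕ.≤ n → fromℕ m ℚ.≤ fromℕ n
fromℕ-mono-≤ {n = n} ℕ.z≤n = 0≤fromℕ n
fromℕ-mono-≤ {suc m} {suc n} (ℕ.s≤s m≤n) = subst₂ ℚ._≤_ (sym (fromℕ-suc m)) (sym (fromℕ-suc n))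
  (ℚₚ.+-monoʳ-≤ 1ℚ (fromℕ-mono-≤ m≤n))

-- The absolute value of the numerator is large enough, since denominators are at least 1.
archimedean : ∀ p → ∃[ K ] p ℚ.≤ fromℕ K
archimedean p@(ℚ.mkℚ _ _ _) = K , ℚₚ.toℚᵘ-cancel-≤ (ℚᵘₚ.≤-respʳ-≃ (ℚᵘₚ.≃-sym (toℚᵘ-fromℤ (+ K))) (ℚᵘ.*≤* (begin
  ℚ.↥ p ℤ.* ℤ.1ℤ      ≡⟨ ℤₚ.*-identityʳ (ℚ.↥ p) ⟩
  ℚ.↥ p               ≤⟨ i≤∣i∣ (ℚ.↥ p) ⟩
  + K                 ≤⟨ ℤ.+≤+ (ℕₚ.m≤m*n K (ℚ.↧ₙ p)) ⟩
  + (K ℕ.* ℚ.↧ₙ p)    ≡⟨ ℤₚ.pos-* K (ℚ.↧ₙ p) ⟩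
  + K ℤ.* ℚ.↧ p       ∎)))
  where
  open ℤₚ.≤-Reasoning
  K = ℤ.∣ ℚ.↥ p ∣
  i≤∣i∣ : ∀ i → i ℤ.≤ + ℤ.∣ i ∣
  i≤∣i∣ (+ n)    = ℤₚ.≤-refl
  i≤∣i∣ -[1+ n ] = ℤ.-≤+

mesh-divides : ∀ n → ∃[ h ] (0ℚ ℚ.< h × fromℕ (suc n) ℚ.* h ≡ 1ℚ)
mesh-divides n = divide (fromℕ (suc n)) 1ℚ (0<fromℕ-suc n) 0<1

-- mesh n = 1 / (n + 1)
mesh : ℕ → ℚ
mesh n = proj₁ (mesh-divides n)

0<mesh : ∀ n → 0ℚ ℚ.< mesh n
0<mesh n = proj₁ (proj₂ (mesh-divides n))

mesh-vanishes : ∀ {ε} → 0ℚ ℚ.< ε → Eventually λ n → mesh n ℚ.≤ ε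
mesh-vanishes {ε} 0<ε =
  let η , 0<η , εη≡1 = divide ε 1ℚ 0<ε 0<1
      K , η≤K        = archimedean η
  in K , λ n K≤n → ℚₚ.*-cancelˡ-≤-pos (fromℕ (suc n)) {{ℚ.positive (0<fromℕ-suc n)}} (begin
    fromℕ (suc n) ℚ.* mesh n   ≡⟨ proj₂ (proj₂ (mesh-divides n)) ⟩
    1ℚ                         ≡⟨ εη≡1 ⟨
    ε ℚ.* η                    ≤⟨ ℚₚ.*-monoˡ-≤-nonNeg ε {{ℚ.nonNegative (ℚₚ.<⇒≤ 0<ε)}}
                                    (ℚₚ.≤-trans η≤K (fromℕ-mono-≤ (ℕₚ.≤-trans K≤n (ℕₚ.n≤1+n n)))) ⟩
    ε ℚ.* fromℕ (suc n)        ≡⟨ ℚₚ.*-comm ε (fromℕ (suc n)) ⟩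
    fromℕ (suc n) ℚ.* ε        ∎)
  where open ℚₚ.≤-Reasoning

-- Suprema and infima in [0,1]

UpperBound : Pred ℝ 0ℓ → Pred ℝ 0ℓ
UpperBound S u = ∀ x → S x → x ≤ u

-- `below` ranges over all nonnegative upper bounds, not only those in [0,1]: approximations of
-- different meshes are compared by taking `approximant + h` of one as an upper bound for the other,
-- and that number may exceed 1.
record SupApproximation (S : Pred ℝ 0ℓ) (h : ℚ) : Set where
  field
    approximant : ℚ
    nonNegative : 0ℚ ℚ.≤ approximant
    above       : UpperBound S (fromℚ (approximant ℚ.+ h))
    below       : ∀ u → 0ℝ ≤ u → UpperBound S u → fromℚ approximant ≤ u

open SupApproximation

-- Walk upwards from `q` in steps of `h` until the next grid point is an upper bound; `K` limits the
-- number of steps. While `q + h` is not an upper bound, no upper bound lies strictly below it, so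
-- moving on preserves the invariant that `q` is below every upper bound.
approximate-sup : ExcludedMiddle 0ℓ → ∀ S {h} → 0ℚ ℚ.< h → ∀ K q → 0ℚ ℚ.≤ q →
                  UpperBound S (fromℚ (q ℚ.+ fromℕ K ℚ.* h)) →
                  (∀ u → 0ℝ ≤ u → UpperBound S u → fromℚ q ≤ u) → SupApproximation S h
approximate-sup em S {h} 0<h zero q 0≤q ub lb = record
  { approximant = q ; nonNegative = 0≤q ; below = lb
  ; above = λ x x∈S → ≤-trans x (fromℚ (q ℚ.+ 0ℚ ℚ.* h)) (fromℚ (q ℚ.+ h)) (ub x x∈S)
      (fromℚ-mono-≤ (ℚₚ.+-monoʳ-≤ q (subst (ℚ._≤ h) (sym (ℚₚ.*-zeroˡ h)) (ℚₚ.<⇒≤ 0<h))))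
  }
approximate-sup em S {h} 0<h (suc K) q 0≤q ub lb with em {UpperBound S (fromℚ (q ℚ.+ h))}
... | yes ub′ = record { approximant = q ; nonNegative = 0≤q ; above = ub′ ; below = lb }
... | no ¬ub′ = approximate-sup em S 0<h K (q ℚ.+ h) (ℚₚ.+-mono-≤ 0≤q (ℚₚ.<⇒≤ 0<h))
  (subst (λ t → UpperBound S (fromℚ t)) shift ub)
  (λ u 0≤u u-ub → ≮⇒≥ u (fromℚ (q ℚ.+ h)) λ u<q+h →
    ¬ub′ λ x x∈S → ≤-trans x u (fromℚ (q ℚ.+ h)) (u-ub x x∈S) (<⇒≤ u (fromℚ (q ℚ.+ h)) u<q+h))
  where
  shift : q ℚ.+ fromℕ (suc K) ℚ.* h ≡ q ℚ.+ h ℚ.+ fromℕ K ℚ.* h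
  shift = trans (cong (λ t → q ℚ.+ t ℚ.* h) (fromℕ-suc K))
    (solve 3 (λ q k h → q :+ (con 1ℚ :+ k) :* h := q :+ h :+ k :* h) refl q (fromℕ K) h)

-- The approximants for the meshes 1/(n+1) themselves form the Cauchy sequence of the supremum: each
-- is below every nonnegative upper bound, and each becomes an upper bound once its own mesh is
-- added, so two of them differ by at most the larger mesh.
sup-exists : ExcludedMiddle 0ℓ → ∀ S → UpperBound S 1ℝ → ∃[ s ] IsSup S s
sup-exists em S S≤1 = s , (0≤s , s≤1) , s-above , s-least
  where
  open ℚₚ.≤-Reasoning

  approx : ∀ n → SupApproximation S (mesh n)
  approx n = approximate-sup em S (0<mesh n) (suc n) 0ℚ ℚₚ.≤-refl
    (subst (λ t → UpperBound S (fromℚ t)) (sym (trans (ℚₚ.+-identityˡ _) (proj₂ (proj₂ (mesh-divides n))))) S≤1)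
    (λ u 0≤u _ → 0≤u)

  q : ℕ → ℚ
  q n = approximant (approx n)

  q≤q+mesh : ∀ m n → q m ℚ.≤ q n ℚ.+ mesh n
  q≤q+mesh m n = fromℚ-cancel-≤ (below (approx m) (fromℚ (q n ℚ.+ mesh n))
    (fromℚ-mono-≤ (ℚₚ.+-mono-≤ (nonNegative (approx n)) (ℚₚ.<⇒≤ (0<mesh n)))) (above (approx n)))

  s : ℝ
  s .seq = q
  s .cauchy ε 0<ε =
    let N , small = mesh-vanishes (half-pos 0<ε)
    in N , λ m n N≤m N≤n → ℚₚ.≤-<-trans
         (∣p-q∣≤ (q m) (q n) (ℚₚ.≤-trans (q≤q+mesh m n) (ℚₚ.+-monoʳ-≤ (q n) (small n N≤n)))
                             (ℚₚ.≤-trans (q≤q+mesh n m) (ℚₚ.+-monoʳ-≤ (q m) (small m N≤m))))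
         (half< 0<ε)

  0≤s : 0ℝ ≤ s
  0≤s = pointwise-≤ 0ℝ s λ n → nonNegative (approx n)

  s≤1 : s ≤ 1ℝ
  s≤1 = pointwise-≤ s 1ℝ λ n →
    fromℚ-cancel-≤ (below (approx n) 1ℝ (fromℚ-mono-≤ (ℚₚ.<⇒≤ 0<1)) S≤1)

  s-above : UpperBound S s
  s-above x x∈S ε 0<ε =
    let δ         = half (half ε)
        0<δ       = half-pos (half-pos 0<ε)
        N , small = mesh-vanishes 0<δ
        step : ∀ n → mesh n ℚ.≤ δ → seq x n ℚ.≤ q N ℚ.+ mesh N ℚ.+ δ → seq x n ℚ.≤ q n ℚ.+ ε
        step n mesh≤δ le = begin
          seq x n                               ≤⟨ le ⟩
          q N ℚ.+ mesh N ℚ.+ δ                  ≤⟨ ℚₚ.+-monoˡ-≤ δ (ℚₚ.+-mono-≤ (q≤q+mesh N n) (small N ℕₚ.≤-refl)) ⟩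
          q n ℚ.+ mesh n ℚ.+ δ ℚ.+ δ            ≤⟨ ℚₚ.+-monoˡ-≤ δ (ℚₚ.+-monoˡ-≤ δ (ℚₚ.+-monoʳ-≤ (q n) mesh≤δ)) ⟩
          q n ℚ.+ δ ℚ.+ δ ℚ.+ δ                 ≤⟨ ≤-by-difference (ℚₚ.<⇒≤ 0<δ)
            (solve 2 (λ q ε → let δ = con ½ :* (con ½ :* ε) in q :+ δ :+ δ :+ δ :+ δ := q :+ ε) refl (q n) ε) ⟩
          q n ℚ.+ ε                             ∎
    in map₂-eventually step (N , small) (above (approx N) x x∈S δ 0<δ)

  s-least : ∀ u → UnitInterval u → UpperBound S u → s ≤ u
  s-least u (0≤u , _) u-ub ε 0<ε =
    let N , small = mesh-vanishes (half-pos 0<ε)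
        step : ∀ n → q N ℚ.≤ seq u n ℚ.+ half ε → q n ℚ.≤ seq u n ℚ.+ ε
        step n le = begin
          q n                               ≤⟨ q≤q+mesh n N ⟩
          q N ℚ.+ mesh N                    ≤⟨ ℚₚ.+-mono-≤ le (small N ℕₚ.≤-refl) ⟩
          seq u n ℚ.+ half ε ℚ.+ half ε     ≡⟨ solve 2 (λ u ε → u :+ con ½ :* ε :+ con ½ :* ε := u :+ ε) refl (seq u n) ε ⟩
          seq u n ℚ.+ ε                     ∎
    in map-eventually step (below (approx N) u 0≤u u-ub (half ε) (half-pos 0<ε))

<⊎≥ : ExcludedMiddle 0ℓ → ∀ x y → x < y ⊎ y ≤ x
<⊎≥ em x y with em {x < y}
... | yes x<y = inj₁ x<y
... | no  x≮y = inj₂ (≮⇒≥ x y x≮y)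

-- The infimum is the supremum of the lower bounds in [0,1]. Elements of `S` above 1 are treated
-- separately, because leastness of a supremum only speaks of bounds inside [0,1].
inf-exists : ExcludedMiddle 0ℓ → ∀ S → (∀ x → S x → 0ℝ ≤ x) → ∃[ s ] IsInf S s
inf-exists em S 0≤S =
  let s , s∈[0,1]@(_ , s≤1) , s-above , s-least = sup-exists em LowerBound λ l ((_ , l≤1) , _) → l≤1
      s-below : ∀ x → S x → s ≤ x
      s-below x x∈S = compare s s≤1 x (s-least x) x∈S (<⊎≥ em 1ℝ x)
  in s , s∈[0,1] , s-below , λ l l∈[0,1] l-lb → s-above l (l∈[0,1] , l-lb)
  where
  LowerBound : Pred ℝ 0ℓ
  LowerBound l = UnitInterval l × (∀ x → S x → l ≤ x)

  compare : ∀ s → s ≤ 1ℝ → ∀ x → (UnitInterval x → UpperBound LowerBound x → s ≤ x) →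
            S x → 1ℝ < x ⊎ x ≤ 1ℝ → s ≤ x
  compare s s≤1 x least x∈S (inj₁ 1<x) = ≤-trans s 1ℝ x s≤1 (<⇒≤ 1ℝ x 1<x)
  compare s s≤1 x least x∈S (inj₂ x≤1) = least (0≤S x x∈S , x≤1) λ l (_ , l-lb) → l-lb x x∈S

exceeded-below-sup : ExcludedMiddle 0ℓ → ∀ S {s} → IsSup S s → ∀ u → UnitInterval u → u < s →
                     ∃[ x ] (S x × u < x)
exceeded-below-sup em S {s} (_ , _ , least) u u∈[0,1] u<s with em {∃[ x ] (S x × u < x)}
... | yes found = found
... | no ¬found = contradiction
  (least u u∈[0,1] λ x x∈S → ≮⇒≥ u x λ u<x → ¬found (x , x∈S , u<x))
  (<⇒≱ u s u<s)

-- A nonnegative real may have negative terms in its sequence, so the product is not nonnegative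
-- termwise. A strictly positive real has eventually positive terms, and the remaining case is a
-- factor equal to zero.
0≤-*-ℝ : ExcludedMiddle 0ℓ → ∀ x y → 0ℝ ≤ x → 0ℝ ≤ y → 0ℝ ≤ x * y
0≤-*-ℝ em x y 0≤x 0≤y with <⊎≥ em 0ℝ x | <⊎≥ em 0ℝ y
... | inj₁ (ε , 0<ε , ε≤x) | inj₁ (δ , 0<δ , δ≤y) = λ η 0<η → map₂-eventually
  (λ n p q → ℚₚ.≤-trans (0≤-* (positive 0<ε p) (positive 0<δ q)) (≤-by-difference (ℚₚ.<⇒≤ 0<η) refl)) ε≤x δ≤y
  where
  positive : ∀ {ε p} → 0ℚ ℚ.< ε → 0ℚ ℚ.+ ε ℚ.≤ p → 0ℚ ℚ.≤ p
  positive {ε} 0<ε le = ℚₚ.≤-trans (ℚₚ.<⇒≤ 0<ε) (subst (ℚ._≤ _) (ℚₚ.+-identityˡ ε) le)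
... | inj₂ x≤0 | _ = ≈⇒≤ 0ℝ (x * y) (≈-trans 0ℝ (0ℝ * y) (x * y)
  (pointwise-≈ 0ℝ (0ℝ * y) λ n → sym (ℚₚ.*-zeroˡ (seq y n)))
  (*-cong 0ℝ x y y (≤-antisym 0ℝ x 0≤x x≤0) (≈-refl y)))
... | inj₁ _ | inj₂ y≤0 = ≈⇒≤ 0ℝ (x * y) (≈-trans 0ℝ (x * 0ℝ) (x * y)
  (pointwise-≈ 0ℝ (x * 0ℝ) λ n → sym (ℚₚ.*-zeroʳ (seq x n)))
  (*-congˡ 0ℝ y x (≤-antisym 0ℝ y 0≤y y≤0)))

-- The complex numbers as a commutative semiring.

≈ᶜ-refl : ∀ z → z ≈ᶜ z
≈ᶜ-refl z = ≈-refl (re z) , ≈-refl (im z)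

≈ᶜ-sym : ∀ z w → z ≈ᶜ w → w ≈ᶜ z
≈ᶜ-sym z w (p , q) = ≈-sym (re z) (re w) p , ≈-sym (im z) (im w) q

≈ᶜ-trans : ∀ z w v → z ≈ᶜ w → w ≈ᶜ v → z ≈ᶜ v
≈ᶜ-trans z w v (p , q) (p′ , q′) =
  ≈-trans (re z) (re w) (re v) p p′ , ≈-trans (im z) (im w) (im v) q q′

pointwise-≈ᶜ : ∀ z w → (∀ n → seq (re z) n ≡ seq (re w) n) → (∀ n → seq (im z) n ≡ seq (im w) n) → z ≈ᶜ w
pointwise-≈ᶜ z w p q = pointwise-≈ (re z) (re w) p , pointwise-≈ (im z) (im w) q

+ᶜ-cong : ∀ z w u v → z ≈ᶜ w → u ≈ᶜ v → z +ᶜ u ≈ᶜ w +ᶜ v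
+ᶜ-cong z w u v (p , q) (p′ , q′) =
  +-cong (re z) (re w) (re u) (re v) p p′ , +-cong (im z) (im w) (im u) (im v) q q′

conj-cong : ∀ z w → z ≈ᶜ w → conj z ≈ᶜ conj w
conj-cong z w (p , q) = p , -‿cong (im z) (im w) q

*ᶜ-cong : ∀ z w u v → z ≈ᶜ w → u ≈ᶜ v → z *ᶜ u ≈ᶜ w *ᶜ v
*ᶜ-cong z w u v (p , q) (p′ , q′) =
  +-cong (re z * re u) (re w * re v) (- (im z * im u)) (- (im w * im v))
    (*-cong (re z) (re w) (re u) (re v) p p′)
    (-‿cong (im z * im u) (im w * im v) (*-cong (im z) (im w) (im u) (im v) q q′)) ,
  +-cong (re z * im u) (re w * im v) (im z * re u) (im w * re v)
    (*-cong (re z) (re w) (im u) (im v) p q′)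
    (*-cong (im z) (im w) (re u) (re v) q p′)

-- Exchanging and distributing finite sums is all that the matrix identities below require. Each law
-- holds termwise for the rational sequences, where it is a polynomial identity.
ℂ-commutativeSemiring : CommutativeSemiring 0ℓ 0ℓ
ℂ-commutativeSemiring = record
  { Carrier = ℂ ; _≈_ = _≈ᶜ_ ; _+_ = _+ᶜ_ ; _*_ = _*ᶜ_ ; 0# = 0ᶜ ; 1# = 1ᶜ
  ; isCommutativeSemiring = IsCommutativeSemiringˡ.isCommutativeSemiring (record
    { +-isCommutativeMonoid = record
      { isMonoid = record
        { isSemigroup = record
          { isMagma = record { isEquivalence = isEquivalence ; ∙-cong = λ {z w u v} → +ᶜ-cong z w u v }
          ; assoc = +ᶜ-assoc }
        ; identity = (λ z → ≈ᶜ-trans (0ᶜ +ᶜ z) (z +ᶜ 0ᶜ) z (+ᶜ-comm 0ᶜ z) (+ᶜ-identityʳ z)) , +ᶜ-identityʳ }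
      ; comm = +ᶜ-comm }
    ; *-isCommutativeMonoid = record
      { isMonoid = record
        { isSemigroup = record
          { isMagma = record { isEquivalence = isEquivalence ; ∙-cong = λ {z w u v} → *ᶜ-cong z w u v }
          ; assoc = *ᶜ-assoc }
        ; identity = (λ z → ≈ᶜ-trans (1ᶜ *ᶜ z) (z *ᶜ 1ᶜ) z (*ᶜ-comm 1ᶜ z) (*ᶜ-identityʳ z)) , *ᶜ-identityʳ }
      ; comm = *ᶜ-comm }
    ; distribʳ = distribʳ
    ; zeroˡ = zeroˡ })
  }
  where
  isEquivalence : IsEquivalence _≈ᶜ_
  isEquivalence = record { refl = λ {z} → ≈ᶜ-refl z ; sym = λ {z w} → ≈ᶜ-sym z w ; trans = λ {z w v} → ≈ᶜ-trans z w v }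

  +ᶜ-assoc : ∀ z w v → z +ᶜ w +ᶜ v ≈ᶜ z +ᶜ (w +ᶜ v)
  +ᶜ-assoc z@(a +i b) w@(c +i d) v@(e +i f) = pointwise-≈ᶜ (z +ᶜ w +ᶜ v) (z +ᶜ (w +ᶜ v))
    (λ n → solve 3 (λ a c e → a :+ c :+ e := a :+ (c :+ e)) refl (seq a n) (seq c n) (seq e n))
    (λ n → solve 3 (λ a c e → a :+ c :+ e := a :+ (c :+ e)) refl (seq b n) (seq d n) (seq f n))

  +ᶜ-comm : ∀ z w → z +ᶜ w ≈ᶜ w +ᶜ z
  +ᶜ-comm z@(a +i b) w@(c +i d) = pointwise-≈ᶜ (z +ᶜ w) (w +ᶜ z)
    (λ n → solve 2 (λ a c → a :+ c := c :+ a) refl (seq a n) (seq c n))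
    (λ n → solve 2 (λ a c → a :+ c := c :+ a) refl (seq b n) (seq d n))

  +ᶜ-identityʳ : ∀ z → z +ᶜ 0ᶜ ≈ᶜ z
  +ᶜ-identityʳ z@(a +i b) = pointwise-≈ᶜ (z +ᶜ 0ᶜ) z
    (λ n → solve 1 (λ a → a :+ con 0ℚ := a) refl (seq a n))
    (λ n → solve 1 (λ a → a :+ con 0ℚ := a) refl (seq b n))

  *ᶜ-assoc : ∀ z w v → z *ᶜ w *ᶜ v ≈ᶜ z *ᶜ (w *ᶜ v)
  *ᶜ-assoc z@(a +i b) w@(c +i d) v@(e +i f) = pointwise-≈ᶜ (z *ᶜ w *ᶜ v) (z *ᶜ (w *ᶜ v))
    (λ n → solve 6 (λ a b c d e f →
        (a :* c :- b :* d) :* e :- (a :* d :+ b :* c) :* f := a :* (c :* e :- d :* f) :- b :* (c :* f :+ d :* e)) refl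
      (seq a n) (seq b n) (seq c n) (seq d n) (seq e n) (seq f n))
    (λ n → solve 6 (λ a b c d e f →
        (a :* c :- b :* d) :* f :+ (a :* d :+ b :* c) :* e := a :* (c :* f :+ d :* e) :+ b :* (c :* e :- d :* f)) refl
      (seq a n) (seq b n) (seq c n) (seq d n) (seq e n) (seq f n))

  *ᶜ-comm : ∀ z w → z *ᶜ w ≈ᶜ w *ᶜ z
  *ᶜ-comm z@(a +i b) w@(c +i d) = pointwise-≈ᶜ (z *ᶜ w) (w *ᶜ z)
    (λ n → solve 4 (λ a b c d → a :* c :- b :* d := c :* a :- d :* b) refl (seq a n) (seq b n) (seq c n) (seq d n))
    (λ n → solve 4 (λ a b c d → a :* d :+ b :* c := c :* b :+ d :* a) refl (seq a n) (seq b n) (seq c n) (seq d n))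

  *ᶜ-identityʳ : ∀ z → z *ᶜ 1ᶜ ≈ᶜ z
  *ᶜ-identityʳ z@(a +i b) = pointwise-≈ᶜ (z *ᶜ 1ᶜ) z
    (λ n → solve 2 (λ a b → a :* con 1ℚ :- b :* con 0ℚ := a) refl (seq a n) (seq b n))
    (λ n → solve 2 (λ a b → a :* con 0ℚ :+ b :* con 1ℚ := b) refl (seq a n) (seq b n))

  distribʳ : ∀ v z w → (z +ᶜ w) *ᶜ v ≈ᶜ z *ᶜ v +ᶜ w *ᶜ v
  distribʳ v@(e +i f) z@(a +i b) w@(c +i d) = pointwise-≈ᶜ ((z +ᶜ w) *ᶜ v) (z *ᶜ v +ᶜ w *ᶜ v)
    (λ n → solve 6 (λ a b c d e f →
        (a :+ c) :* e :- (b :+ d) :* f := a :* e :- b :* f :+ (c :* e :- d :* f)) refl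
      (seq a n) (seq b n) (seq c n) (seq d n) (seq e n) (seq f n))
    (λ n → solve 6 (λ a b c d e f →
        (a :+ c) :* f :+ (b :+ d) :* e := a :* f :+ b :* e :+ (c :* f :+ d :* e)) refl
      (seq a n) (seq b n) (seq c n) (seq d n) (seq e n) (seq f n))

  zeroˡ : ∀ z → 0ᶜ *ᶜ z ≈ᶜ 0ᶜ
  zeroˡ z@(a +i b) = pointwise-≈ᶜ (0ᶜ *ᶜ z) 0ᶜ
    (λ n → solve 2 (λ a b → con 0ℚ :* a :- con 0ℚ :* b := con 0ℚ) refl (seq a n) (seq b n))
    (λ n → solve 2 (λ a b → con 0ℚ :* b :+ con 0ℚ :* a := con 0ℚ) refl (seq a n) (seq b n))

-- Inner products, adjoints and unitaries over a semiring with involution.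

module Hermitian (R : CommutativeSemiring 0ℓ 0ℓ) where

  private module R = CommutativeSemiring R
  open CommutativeSemiring R using (Carrier; 0#; 1#) renaming (_≈_ to _≋_; _+_ to _⊕_; _*_ to _⊛_)
  open SemiringSum R.semiring

  Vec : ℕ → Set
  Vec = Vector Carrier

  Mat : ℕ → Set
  Mat d = Fin d → Fin d → Carrier

  -- The operations are parameters specified by equations, rather than the
  -- definitions themselves, to keep the Cauchy sequences of Defs folded.
  module Algebra
    (star            : Carrier → Carrier)
    (star-cong       : ∀ x y → x ≋ y → star x ≋ star y)
    (star-0          : star 0# ≋ 0#)
    (star-+          : ∀ x y → star (x ⊕ y) ≋ star x ⊕ star y)
    (star-*          : ∀ x y → star (x ⊛ y) ≋ star x ⊛ star y)
    (star-involutive : ∀ x → star (star x) ≋ x)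
    (inner           : ∀ {d} → Vec d → Vec d → Carrier)
    (inner-def       : ∀ {d} (φ ψ : Vec d) → inner φ ψ ≋ sum λ i → star (φ i) ⊛ ψ i)
    (_$_             : ∀ {d} → Mat d → Vec d → Vec d)
    ($-def           : ∀ {d} (U : Mat d) (ψ : Vec d) i → (U $ ψ) i ≋ sum λ j → U i j ⊛ ψ j)
    (_∙_             : ∀ {d} → Mat d → Mat d → Mat d)
    (∙-def           : ∀ {d} (U V : Mat d) i k → (U ∙ V) i k ≋ sum λ j → U i j ⊛ V j k)
    (adj             : ∀ {d} → Mat d → Mat d)
    (adj-def         : ∀ {d} (U : Mat d) i j → adj U i j ≋ star (U j i))
    (𝟙               : ∀ {d} → Mat d)
    (𝟙-def           : ∀ {d} (i j : Fin d) → 𝟙 i j ≋ (if does (i Fin.≟ j) then 1# else 0#))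
    where

    open SetoidReasoning R.setoid

    infix 4 _≋ᵛ_
    _≋ᵛ_ : ∀ {d} → Vec d → Vec d → Set
    φ ≋ᵛ ψ = ∀ i → φ i ≋ ψ i

    inner-cong : ∀ {d} {φ φ′ ψ ψ′ : Vec d} → φ ≋ᵛ φ′ → ψ ≋ᵛ ψ′ → inner φ ψ ≋ inner φ′ ψ′
    inner-cong {φ = φ} {φ′} {ψ} {ψ′} p q = begin
      inner φ ψ                       ≈⟨ inner-def φ ψ ⟩
      (sum λ i → star (φ i) ⊛ ψ i)    ≈⟨ sum-cong-≋ (λ i → R.*-cong (star-cong (φ i) (φ′ i) (p i)) (q i)) ⟩
      (sum λ i → star (φ′ i) ⊛ ψ′ i)  ≈⟨ inner-def φ′ ψ′ ⟨
      inner φ′ ψ′                     ∎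

    $-cong : ∀ {d} {U V : Mat d} {φ ψ : Vec d} → (∀ i j → U i j ≋ V i j) → φ ≋ᵛ ψ → U $ φ ≋ᵛ V $ ψ
    $-cong {U = U} {V} {φ} {ψ} p q i = begin
      (U $ φ) i                 ≈⟨ $-def U φ i ⟩
      (sum λ j → U i j ⊛ φ j)   ≈⟨ sum-cong-≋ (λ j → R.*-cong (p i j) (q j)) ⟩
      (sum λ j → V i j ⊛ ψ j)   ≈⟨ $-def V ψ i ⟨
      (V $ ψ) i                 ∎

    $-congʳ : ∀ {d} (U : Mat d) {φ ψ : Vec d} → φ ≋ᵛ ψ → U $ φ ≋ᵛ U $ ψ
    $-congʳ U = $-cong λ i j → R.refl

    star-sum : ∀ {n} (f : Vec n) → star (sum f) ≋ sum (λ i → star (f i))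
    star-sum {zero}  f = star-0
    star-sum {suc n} f = R.trans (star-+ (f zero) (sum (f ∘ suc))) (R.+-congˡ (star-sum (f ∘ suc)))

    adjoint : ∀ {d} (U : Mat d) φ ψ → inner φ (U $ ψ) ≋ inner (adj U $ φ) ψ
    adjoint U φ ψ = begin
      inner φ (U $ ψ)
        ≈⟨ inner-def φ (U $ ψ) ⟩
      (sum λ i → star (φ i) ⊛ (U $ ψ) i)
        ≈⟨ sum-cong-≋ (λ i → R.*-congˡ ($-def U ψ i)) ⟩
      (sum λ i → star (φ i) ⊛ sum λ j → U i j ⊛ ψ j)
        ≈⟨ sum-cong-≋ (λ i → *-distribˡ-sum (star (φ i)) (λ j → U i j ⊛ ψ j)) ⟩
      (sum λ i → sum λ j → star (φ i) ⊛ (U i j ⊛ ψ j))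
        ≈⟨ ∑-comm (λ i j → star (φ i) ⊛ (U i j ⊛ ψ j)) ⟩
      (sum λ j → sum λ i → star (φ i) ⊛ (U i j ⊛ ψ j))
        ≈⟨ sum-cong-≋ (λ j → sum-cong-≋ (λ i → reassociate i j)) ⟩
      (sum λ j → sum λ i → star (adj U j i ⊛ φ i) ⊛ ψ j)
        ≈⟨ sum-cong-≋ (λ j → *-distribʳ-sum (ψ j) (λ i → star (adj U j i ⊛ φ i))) ⟨
      (sum λ j → (sum λ i → star (adj U j i ⊛ φ i)) ⊛ ψ j)
        ≈⟨ sum-cong-≋ (λ j → R.*-congʳ (star-sum (λ i → adj U j i ⊛ φ i))) ⟨
      (sum λ j → star (sum λ i → adj U j i ⊛ φ i) ⊛ ψ j)
        ≈⟨ sum-cong-≋ (λ j → R.*-congʳ (star-cong ((adj U $ φ) j) (sum λ i → adj U j i ⊛ φ i) ($-def (adj U) φ j))) ⟨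
      (sum λ j → star ((adj U $ φ) j) ⊛ ψ j)
        ≈⟨ inner-def (adj U $ φ) ψ ⟨
      inner (adj U $ φ) ψ
        ∎
      where
      reassociate : ∀ i j → star (φ i) ⊛ (U i j ⊛ ψ j) ≋ star (adj U j i ⊛ φ i) ⊛ ψ j
      reassociate i j = begin
        star (φ i) ⊛ (U i j ⊛ ψ j)              ≈⟨ R.*-assoc (star (φ i)) (U i j) (ψ j) ⟨
        star (φ i) ⊛ U i j ⊛ ψ j                ≈⟨ R.*-congʳ (R.*-comm (star (φ i)) (U i j)) ⟩
        U i j ⊛ star (φ i) ⊛ ψ j                ≈⟨ R.*-congʳ (R.*-congʳ (star-involutive (U i j))) ⟨
        star (star (U i j)) ⊛ star (φ i) ⊛ ψ j  ≈⟨ R.*-congʳ (R.*-congʳ (star-cong (adj U j i) (star (U i j)) (adj-def U j i))) ⟨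
        star (adj U j i) ⊛ star (φ i) ⊛ ψ j     ≈⟨ R.*-congʳ (star-* (adj U j i) (φ i)) ⟨
        star (adj U j i ⊛ φ i) ⊛ ψ j            ∎

    $-∙ : ∀ {d} (U V : Mat d) ψ → U $ (V $ ψ) ≋ᵛ (U ∙ V) $ ψ
    $-∙ U V ψ i = begin
      (U $ (V $ ψ)) i
        ≈⟨ $-def U (V $ ψ) i ⟩
      (sum λ j → U i j ⊛ (V $ ψ) j)
        ≈⟨ sum-cong-≋ (λ j → R.*-congˡ ($-def V ψ j)) ⟩
      (sum λ j → U i j ⊛ sum λ k → V j k ⊛ ψ k)
        ≈⟨ sum-cong-≋ (λ j → *-distribˡ-sum (U i j) (λ k → V j k ⊛ ψ k)) ⟩
      (sum λ j → sum λ k → U i j ⊛ (V j k ⊛ ψ k))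
        ≈⟨ ∑-comm (λ j k → U i j ⊛ (V j k ⊛ ψ k)) ⟩
      (sum λ k → sum λ j → U i j ⊛ (V j k ⊛ ψ k))
        ≈⟨ sum-cong-≋ (λ k → sum-cong-≋ (λ j → R.*-assoc (U i j) (V j k) (ψ k))) ⟨
      (sum λ k → sum λ j → U i j ⊛ V j k ⊛ ψ k)
        ≈⟨ sum-cong-≋ (λ k → *-distribʳ-sum (ψ k) (λ j → U i j ⊛ V j k)) ⟨
      (sum λ k → (sum λ j → U i j ⊛ V j k) ⊛ ψ k)
        ≈⟨ sum-cong-≋ (λ k → R.*-congʳ (∙-def U V i k)) ⟨
      (sum λ k → (U ∙ V) i k ⊛ ψ k)
        ≈⟨ $-def (U ∙ V) ψ i ⟨
      ((U ∙ V) $ ψ) i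
        ∎

    kronecker-sum : ∀ {d} (ψ : Vec d) i → sum (λ j → (if does (i Fin.≟ j) then 1# else 0#) ⊛ ψ j) ≋ ψ i
    kronecker-sum {suc d} ψ zero = begin
      1# ⊛ ψ zero ⊕ (sum λ j → 0# ⊛ ψ (suc j))   ≈⟨ R.+-cong (R.*-identityˡ (ψ zero)) (sum-cong-≋ (λ j → R.zeroˡ (ψ (suc j)))) ⟩
      ψ zero ⊕ (sum {d} λ _ → 0#)                ≈⟨ R.+-congˡ (sum-replicate-zero d) ⟩
      ψ zero ⊕ 0#                                ≈⟨ R.+-identityʳ (ψ zero) ⟩
      ψ zero                                     ∎
    kronecker-sum {suc d} ψ (suc i) = begin
      0# ⊛ ψ zero ⊕ sum (λ j → (if does (i Fin.≟ j) then 1# else 0#) ⊛ ψ (suc j))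
        ≈⟨ R.+-cong (R.zeroˡ (ψ zero)) (kronecker-sum (ψ ∘ suc) i) ⟩
      0# ⊕ ψ (suc i)
        ≈⟨ R.+-identityˡ (ψ (suc i)) ⟩
      ψ (suc i)
        ∎

    𝟙-$ : ∀ {d} (ψ : Vec d) → 𝟙 $ ψ ≋ᵛ ψ
    𝟙-$ ψ i = begin
      (𝟙 $ ψ) i                                                 ≈⟨ $-def 𝟙 ψ i ⟩
      (sum λ j → 𝟙 i j ⊛ ψ j)                                   ≈⟨ sum-cong-≋ (λ j → R.*-congʳ (𝟙-def i j)) ⟩
      (sum λ j → (if does (i Fin.≟ j) then 1# else 0#) ⊛ ψ j)   ≈⟨ kronecker-sum ψ i ⟩
      ψ i                                                       ∎

    Unitary : ∀ {d} → Mat d → Set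
    Unitary U = (∀ i j → (adj U ∙ U) i j ≋ 𝟙 i j) × (∀ i j → (U ∙ adj U) i j ≋ 𝟙 i j)

    inverse-$ : ∀ {d} (U V : Mat d) → (∀ i j → (U ∙ V) i j ≋ 𝟙 i j) → ∀ ψ → U $ (V $ ψ) ≋ᵛ ψ
    inverse-$ U V UV≋𝟙 ψ i = begin
      (U $ (V $ ψ)) i   ≈⟨ $-∙ U V ψ i ⟩
      ((U ∙ V) $ ψ) i   ≈⟨ $-cong UV≋𝟙 (λ _ → R.refl) i ⟩
      (𝟙 $ ψ) i         ≈⟨ 𝟙-$ ψ i ⟩
      ψ i               ∎

    unitary-inner : ∀ {d} (U : Mat d) → Unitary U → ∀ φ ψ → inner (U $ φ) (U $ ψ) ≋ inner φ ψ
    unitary-inner U (U*U≋𝟙 , _) φ ψ = begin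
      inner (U $ φ) (U $ ψ)         ≈⟨ adjoint U (U $ φ) ψ ⟩
      inner (adj U $ (U $ φ)) ψ     ≈⟨ inner-cong (inverse-$ (adj U) U U*U≋𝟙 φ) (λ _ → R.refl) ⟩
      inner φ ψ                     ∎

    adj-inner : ∀ {d} (U : Mat d) → Unitary U → ∀ φ → inner (adj U $ φ) (adj U $ φ) ≋ inner φ φ
    adj-inner U (_ , UU*≋𝟙) φ = begin
      inner (adj U $ φ) (adj U $ φ)   ≈⟨ adjoint U φ (adj U $ φ) ⟨
      inner φ (U $ (adj U $ φ))       ≈⟨ inner-cong (λ _ → R.refl) (inverse-$ U (adj U) UU*≋𝟙 φ) ⟩
      inner φ φ                       ∎

conj-0 : conj 0ᶜ ≈ᶜ 0ᶜ
conj-0 = pointwise-≈ᶜ (conj 0ᶜ) 0ᶜ (λ _ → refl) (λ _ → refl)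

conj-+ : ∀ z w → conj (z +ᶜ w) ≈ᶜ conj z +ᶜ conj w
conj-+ z@(a +i b) w@(c +i d) = pointwise-≈ᶜ (conj (z +ᶜ w)) (conj z +ᶜ conj w) (λ _ → refl)
  (λ n → solve 2 (λ b d → :- (b :+ d) := :- b :+ :- d) refl (seq b n) (seq d n))

conj-* : ∀ z w → conj (z *ᶜ w) ≈ᶜ conj z *ᶜ conj w
conj-* z@(a +i b) w@(c +i d) = pointwise-≈ᶜ (conj (z *ᶜ w)) (conj z *ᶜ conj w)
  (λ n → solve 4 (λ a b c d → a :* c :- b :* d := a :* c :- :- b :* :- d) refl
    (seq a n) (seq b n) (seq c n) (seq d n))
  (λ n → solve 4 (λ a b c d → :- (a :* d :+ b :* c) := a :* :- d :+ :- b :* c) refl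
    (seq a n) (seq b n) (seq c n) (seq d n))

conj-involutive : ∀ z → conj (conj z) ≈ᶜ z
conj-involutive z@(a +i b) = pointwise-≈ᶜ (conj (conj z)) z (λ _ → refl)
  (λ n → solve 1 (λ b → :- :- b := b) refl (seq b n))

module H = Hermitian.Algebra ℂ-commutativeSemiring
  conj conj-cong conj-0 conj-+ conj-* conj-involutive
  ⟨_∣_⟩ (λ φ ψ → ≈ᶜ-refl ⟨ φ ∣ ψ ⟩)
  _·_ (λ U ψ i → ≈ᶜ-refl ((U · ψ) i))
  _⊗_ (λ U V i k → ≈ᶜ-refl ((U ⊗ V) i k))
  _† (λ U i j → ≈ᶜ-refl ((U †) i j))
  identity (λ i j → ≈ᶜ-refl (identity i j))

-- Iterates of a unitary matrix.

·-cong-≡ : ∀ {d} (U : Matrix d) φ ψ → φ ≡ ψ → U · φ ≡ U · ψ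
·-cong-≡ U φ .φ refl = refl

-- Abstract, so that iterates inside inner products are never unfolded.
abstract
  iterate : ∀ {d} → Matrix d → ℕ → Vector ℂ d → Vector ℂ d
  iterate U zero    ψ = ψ
  iterate U (suc n) ψ = U · iterate U n ψ

  iterate-zero : ∀ {d} (U : Matrix d) ψ → iterate U zero ψ ≡ ψ
  iterate-zero U ψ = refl

  iterate-suc : ∀ {d} (U : Matrix d) n ψ → iterate U (suc n) ψ ≡ U · iterate U n ψ
  iterate-suc U n ψ = refl

  iterate-+ : ∀ {d} (U : Matrix d) m n ψ → iterate U (m ℕ.+ n) ψ ≡ iterate U m (iterate U n ψ)
  iterate-+ U zero    n ψ = refl
  iterate-+ U (suc m) n ψ = ·-cong-≡ U (iterate U (m ℕ.+ n) ψ) (iterate U m (iterate U n ψ)) (iterate-+ U m n ψ)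

-- A reset applies the letter read at the checkpoint directly to ψ; this merges it with the letters
-- read afterwards.
iterate-shift : ∀ {d} (U : Matrix d) n ψ → iterate U n (U · ψ) ≡ iterate U (suc n) ψ
iterate-shift U n ψ =
  trans (cong (iterate U n) (sym (trans (iterate-suc U zero ψ) (·-cong-≡ U (iterate U zero ψ) ψ (iterate-zero U ψ)))))
    (trans (sym (iterate-+ U n 1 ψ)) (cong (λ m → iterate U m ψ) (ℕₚ.+-comm n 1)))

iterate-inner : ∀ {d} (U : Matrix d) → IsUnitary U → ∀ n φ ψ →
                ⟨ iterate U n φ ∣ iterate U n ψ ⟩ ≈ᶜ ⟨ φ ∣ ψ ⟩
iterate-inner U U-unitary zero φ ψ = subst₂ (λ χ ω → ⟨ χ ∣ ω ⟩ ≈ᶜ ⟨ φ ∣ ψ ⟩)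
  (sym (iterate-zero U φ)) (sym (iterate-zero U ψ)) (≈ᶜ-refl ⟨ φ ∣ ψ ⟩)
iterate-inner U U-unitary (suc n) φ ψ = subst₂ (λ χ ω → ⟨ χ ∣ ω ⟩ ≈ᶜ ⟨ φ ∣ ψ ⟩)
  (sym (iterate-suc U n φ)) (sym (iterate-suc U n ψ))
  (≈ᶜ-trans ⟨ U · iterate U n φ ∣ U · iterate U n ψ ⟩ ⟨ iterate U n φ ∣ iterate U n ψ ⟩ ⟨ φ ∣ ψ ⟩
    (H.unitary-inner U U-unitary (iterate U n φ) (iterate U n ψ)) (iterate-inner U U-unitary n φ ψ))

iterate-unit : ∀ {d} (U : Matrix d) → IsUnitary U → ∀ n ψ → IsUnit ψ → IsUnit (iterate U n ψ)
iterate-unit U U-unitary n ψ =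
  ≈ᶜ-trans ⟨ iterate U n ψ ∣ iterate U n ψ ⟩ ⟨ ψ ∣ ψ ⟩ 1ᶜ (iterate-inner U U-unitary n ψ ψ)

-- The vector χ is the n-th power of `U †` applied to φ, a unit vector because `U †` also preserves
-- norms. It serves to move the letters c read before the first checkpoint onto the test vector.
iterate-adjoint : ∀ {d} (U : Matrix d) → IsUnitary U → ∀ n φ → IsUnit φ →
                  ∃[ χ ] (IsUnit χ × (∀ ψ → ⟨ φ ∣ iterate U n ψ ⟩ ≈ᶜ ⟨ χ ∣ ψ ⟩))
iterate-adjoint U U-unitary zero φ φ-unit = φ , φ-unit , λ ψ →
  subst (λ ω → ⟨ φ ∣ ω ⟩ ≈ᶜ ⟨ φ ∣ ψ ⟩) (sym (iterate-zero U ψ)) (≈ᶜ-refl ⟨ φ ∣ ψ ⟩)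
iterate-adjoint U U-unitary (suc n) φ φ-unit =
  let χ , χ-unit , pull = iterate-adjoint U U-unitary n ((U †) · φ)
        (≈ᶜ-trans ⟨ (U †) · φ ∣ (U †) · φ ⟩ ⟨ φ ∣ φ ⟩ 1ᶜ (H.adj-inner U U-unitary φ) φ-unit)
  in χ , χ-unit , λ ψ → subst (λ ω → ⟨ φ ∣ ω ⟩ ≈ᶜ ⟨ χ ∣ ψ ⟩) (sym (iterate-suc U n ψ))
       (≈ᶜ-trans ⟨ φ ∣ U · iterate U n ψ ⟩ ⟨ (U †) · φ ∣ iterate U n ψ ⟩ ⟨ χ ∣ ψ ⟩
         (H.adjoint U φ (iterate U n ψ)) (pull ψ))

≡⇒≈ᵛ : ∀ {d} (φ ψ : Vector ℂ d) → φ ≡ ψ → φ ≈ᵛ ψ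
≡⇒≈ᵛ φ .φ refl i = ≈ᶜ-refl (φ i)

≈ᵛ-trans : ∀ {d} (φ ψ χ : Vector ℂ d) → φ ≈ᵛ ψ → ψ ≈ᵛ χ → φ ≈ᵛ χ
≈ᵛ-trans φ ψ χ p q i = ≈ᶜ-trans (φ i) (ψ i) (χ i) (p i) (q i)

iterate-cong : ∀ {d} (U : Matrix d) n φ ψ → φ ≈ᵛ ψ → iterate U n φ ≈ᵛ iterate U n ψ
iterate-cong U zero φ ψ φ≈ψ =
  ≈ᵛ-trans (iterate U zero φ) φ (iterate U zero ψ) (≡⇒≈ᵛ (iterate U zero φ) φ (iterate-zero U φ))
    (≈ᵛ-trans φ ψ (iterate U zero ψ) φ≈ψ (≡⇒≈ᵛ ψ (iterate U zero ψ) (sym (iterate-zero U ψ))))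
iterate-cong U (suc n) φ ψ φ≈ψ =
  ≈ᵛ-trans (iterate U (suc n) φ) (U · iterate U n φ) (iterate U (suc n) ψ)
    (≡⇒≈ᵛ (iterate U (suc n) φ) (U · iterate U n φ) (iterate-suc U n φ))
    (≈ᵛ-trans (U · iterate U n φ) (U · iterate U n ψ) (iterate U (suc n) ψ)
      (H.$-congʳ U {iterate U n φ} {iterate U n ψ} (iterate-cong U n φ ψ φ≈ψ))
      (≡⇒≈ᵛ (U · iterate U n ψ) (iterate U (suc n) ψ) (sym (iterate-suc U n ψ))))

iterate-fixed : ∀ {d} (U : Matrix d) → (∀ ψ → U · ψ ≈ᵛ ψ) → ∀ n ψ → iterate U n ψ ≈ᵛ ψ
iterate-fixed U fixed zero    ψ = ≡⇒≈ᵛ (iterate U zero ψ) ψ (iterate-zero U ψ)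
iterate-fixed U fixed (suc n) ψ =
  ≈ᵛ-trans (iterate U (suc n) ψ) (U · iterate U n ψ) ψ
    (≡⇒≈ᵛ (iterate U (suc n) ψ) (U · iterate U n ψ) (iterate-suc U n ψ))
    (≈ᵛ-trans (U · iterate U n ψ) (iterate U n ψ) ψ (fixed (iterate U n ψ)) (iterate-fixed U fixed n ψ))

inner-congʳ : ∀ {d} (φ ψ χ : Vector ℂ d) → ψ ≈ᵛ χ → ⟨ φ ∣ ψ ⟩ ≈ᶜ ⟨ φ ∣ χ ⟩
inner-congʳ φ ψ χ = H.inner-cong {φ = φ} {φ} {ψ} {χ} λ i → ≈ᶜ-refl (φ i)

-- Bounds on entries and perturbation of amplitudes.

≤-by-difference-ℝ : ∀ x y t → 0ℝ ≤ t → (∀ n → seq x n ℚ.+ seq t n ≡ seq y n) → x ≤ y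
≤-by-difference-ℝ x y t 0≤t eq ε 0<ε = map-eventually step (0≤t ε 0<ε)
  where
  step : ∀ n → 0ℚ ℚ.≤ seq t n ℚ.+ ε → seq x n ℚ.≤ seq y n ℚ.+ ε
  step n 0≤t+ε = ≤-by-difference 0≤t+ε
    (trans (sym (ℚₚ.+-assoc (seq x n) (seq t n) ε)) (cong (ℚ._+ ε) (eq n)))

0≤-difference : ∀ x y → x ≤ y → 0ℝ ≤ y - x
0≤-difference x y x≤y ε 0<ε = map-eventually step (x≤y ε 0<ε)
  where
  step : ∀ n → seq x n ℚ.≤ seq y n ℚ.+ ε → 0ℚ ℚ.≤ seq y n ℚ.- seq x n ℚ.+ ε
  step n le = subst₂ ℚ._≤_ (ℚₚ.+-inverseʳ (seq x n))
    (solve 3 (λ x y ε → y :+ ε :- x := y :- x :+ ε) refl (seq x n) (seq y n) ε)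
    (ℚₚ.+-monoˡ-≤ (ℚ.- seq x n) le)

0≤-+-ℝ : ∀ x y → 0ℝ ≤ x → 0ℝ ≤ y → 0ℝ ≤ x + y
0≤-+-ℝ x y = +-mono-≤ 0ℝ x 0ℝ y

neg-antimono-≤ : ∀ x y → x ≤ y → - y ≤ - x
neg-antimono-≤ x y x≤y = ≤-by-difference-ℝ (- y) (- x) (y - x) (0≤-difference x y x≤y)
  λ n → solve 2 (λ x y → :- y :+ (y :- x) := :- x) refl (seq x n) (seq y n)

-- This is |x| ≤ h, written as two inequalities so that every bound reduces to the order on ℝ.
record Within (h : ℚ) (x : ℝ) : Set where
  constructor _&_
  field
    upper : x ≤ fromℚ h
    lower : - x ≤ fromℚ h

open Within

infix 3 _&_

Within-≐ : ∀ {h} x y → (∀ n → seq x n ≡ seq y n) → Within h x → Within h y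
Within-≐ {h} x y x≐y (p & q) =
  ≤-trans y x (fromℚ h) (pointwise-≤ y x λ n → ℚₚ.≤-reflexive (sym (x≐y n))) p &
  ≤-trans (- y) (- x) (fromℚ h) (pointwise-≤ (- y) (- x) λ n → ℚₚ.≤-reflexive (cong ℚ.-_ (sym (x≐y n)))) q

Within-neg : ∀ {h} x → Within h x → Within h (- x)
Within-neg {h} x (p & q) = q &
  ≤-trans (- - x) x (fromℚ h)
    (pointwise-≤ (- - x) x λ n → ℚₚ.≤-reflexive (solve 1 (λ x → :- :- x := x) refl (seq x n))) p

Within-+ : ∀ {a b} x y → Within a x → Within b y → Within (a ℚ.+ b) (x + y)
Within-+ {a} {b} x y (p & q) (p′ & q′) =
  +-mono-≤ x (fromℚ a) y (fromℚ b) p p′ &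
  ≤-trans (- (x + y)) (- x + - y) (fromℚ a + fromℚ b)
    (pointwise-≤ (- (x + y)) (- x + - y) λ n → ℚₚ.≤-reflexive (ℚₚ.neg-distrib-+ (seq x n) (seq y n)))
    (+-mono-≤ (- x) (fromℚ a) (- y) (fromℚ b) q q′)

-- From 2(ab - xy) = (a - x)(b + y) + (a + x)(b - y), where all four factors are nonnegative;
-- replacing y by -y gives the other half.
Within-* : ExcludedMiddle 0ℓ → ∀ {a b} x y → Within a x → Within b y → Within (a ℚ.* b) (x * y)
Within-* em {a} {b} x y (x≤a & -x≤a) (y≤b & -y≤b) =
  ≤-by-difference-ℝ (x * y) (fromℚ (a ℚ.* b)) (fromℚ ½ * (a-x * b+y + a+x * b-y))
    (0≤-*-ℝ em (fromℚ ½) (a-x * b+y + a+x * b-y) 0≤½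
      (0≤-+-ℝ (a-x * b+y) (a+x * b-y) (0≤-*-ℝ em a-x b+y 0≤a-x 0≤b+y) (0≤-*-ℝ em a+x b-y 0≤a+x 0≤b-y)))
    (λ n → solve 4 (λ a b x y →
        x :* y :+ con ½ :* ((a :- x) :* (b :- :- y) :+ (a :- :- x) :* (b :- y)) := a :* b) refl
      a b (seq x n) (seq y n)) &
  ≤-by-difference-ℝ (- (x * y)) (fromℚ (a ℚ.* b)) (fromℚ ½ * (a-x * b-y + a+x * b+y))
    (0≤-*-ℝ em (fromℚ ½) (a-x * b-y + a+x * b+y) 0≤½
      (0≤-+-ℝ (a-x * b-y) (a+x * b+y) (0≤-*-ℝ em a-x b-y 0≤a-x 0≤b-y) (0≤-*-ℝ em a+x b+y 0≤a+x 0≤b+y)))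
    (λ n → solve 4 (λ a b x y →
        :- (x :* y) :+ con ½ :* ((a :- x) :* (b :- y) :+ (a :- :- x) :* (b :- :- y)) := a :* b) refl
      a b (seq x n) (seq y n))
  where
  a-x = fromℚ a - x
  a+x = fromℚ a - - x
  b-y = fromℚ b - y
  b+y = fromℚ b - - y
  0≤a-x = 0≤-difference x (fromℚ a) x≤a
  0≤a+x = 0≤-difference (- x) (fromℚ a) -x≤a
  0≤b-y = 0≤-difference y (fromℚ b) y≤b
  0≤b+y = 0≤-difference (- y) (fromℚ b) -y≤b
  0≤½ : 0ℝ ≤ fromℚ ½
  0≤½ = fromℚ-mono-≤ (ℚₚ.nonNegative⁻¹ ½)

-- From 2(1 - a) = (1 - (a² + b²)) + (1 - a)² + b², a sum of nonnegative terms, used for ±x and ±y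
-- in the role of a.
Within-1 : ExcludedMiddle 0ℓ → ∀ x y → x * x + y * y ≤ 1ℝ → Within 1ℚ x × Within 1ℚ y
Within-1 em x y x²+y²≤1 =
  (bound x y (λ _ → refl) &
   bound (- x) y λ n → solve 2 (λ x y → :- x :* :- x :+ y :* y := x :* x :+ y :* y) refl (seq x n) (seq y n)) ,
  (bound y x (λ n → ℚₚ.+-comm (seq y n ℚ.* seq y n) (seq x n ℚ.* seq x n)) &
   bound (- y) x λ n → solve 2 (λ x y → :- y :* :- y :+ x :* x := x :* x :+ y :* y) refl (seq x n) (seq y n))
  where
  bound : ∀ a b → (∀ n → seq (a * a + b * b) n ≡ seq (x * x + y * y) n) → a ≤ 1ℝ
  bound a b eq = ≤-by-difference-ℝ a 1ℝ (fromℚ ½ * t)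
    (0≤-*-ℝ em (fromℚ ½) t (fromℚ-mono-≤ (ℚₚ.nonNegative⁻¹ ½))
      (0≤-+-ℝ (1ℝ - (x * x + y * y)) ((1ℝ - a) * (1ℝ - a) + b * b)
        (0≤-difference (x * x + y * y) 1ℝ x²+y²≤1)
        (0≤-+-ℝ ((1ℝ - a) * (1ℝ - a)) (b * b) (0≤-square-ℝ (1ℝ - a)) (0≤-square-ℝ b))))
    (λ n → trans
      (cong (λ u → seq a n ℚ.+ ½ ℚ.* (1ℚ ℚ.- u ℚ.+ seq ((1ℝ - a) * (1ℝ - a) + b * b) n)) (sym (eq n)))
      (solve 2 (λ a b → a :+ con ½ :* (con 1ℚ :- (a :* a :+ b :* b) :+ ((con 1ℚ :- a) :* (con 1ℚ :- a) :+ b :* b))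
          := con 1ℚ) refl (seq a n) (seq b n)))
    where t = 1ℝ - (x * x + y * y) + ((1ℝ - a) * (1ℝ - a) + b * b)

Withinᶜ : ℚ → Pred ℂ 0ℓ
Withinᶜ h z = Within h (re z) × Within h (im z)

-- Here positivity does hold termwise, each term being a sum of rational squares.
norm-nonNegative : ∀ {d} (φ : Vector ℂ d) n → 0ℚ ℚ.≤ seq (re ⟨ φ ∣ φ ⟩) n
norm-nonNegative {zero}  φ n = ℚₚ.≤-refl
norm-nonNegative {suc d} φ n = ℚₚ.+-mono-≤
  (subst (0ℚ ℚ.≤_) (solve 2 (λ x y → x :* x :+ y :* y := x :* x :- :- y :* y) refl (seq (re (φ zero)) n) (seq (im (φ zero)) n))
    (ℚₚ.+-mono-≤ (0≤-square (seq (re (φ zero)) n)) (0≤-square (seq (im (φ zero)) n))))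
  (norm-nonNegative (φ ∘ suc) n)

∣coordinate∣²≤norm : ∀ {d} (φ : Vector ℂ d) i n → seq ∣ φ i ∣² n ℚ.≤ seq (re ⟨ φ ∣ φ ⟩) n
∣coordinate∣²≤norm φ zero n = ≤-by-difference (norm-nonNegative (φ ∘ suc) n)
  (cong (ℚ._+ seq (re ⟨ φ ∘ suc ∣ φ ∘ suc ⟩) n)
    (solve 2 (λ x y → x :* x :+ y :* y := x :* x :- :- y :* y) refl (seq (re (φ zero)) n) (seq (im (φ zero)) n)))
∣coordinate∣²≤norm φ (suc i) n = ℚₚ.≤-trans (∣coordinate∣²≤norm (φ ∘ suc) i n)
  (≤-by-difference (ℚₚ.+-mono-≤ (0≤-square (seq (re (φ zero)) n)) (0≤-square (seq (im (φ zero)) n)))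
    (solve 3 (λ x y t → t :+ (x :* x :+ y :* y) := x :* x :- :- y :* y :+ t) refl
      (seq (re (φ zero)) n) (seq (im (φ zero)) n) (seq (re ⟨ φ ∘ suc ∣ φ ∘ suc ⟩) n)))

unit-Within : ExcludedMiddle 0ℓ → ∀ {d} (φ : Vector ℂ d) → IsUnit φ → ∀ i → Withinᶜ 1ℚ (φ i)
unit-Within em φ (φφ≈1 , _) i = Within-1 em (re (φ i)) (im (φ i))
  (≤-trans ∣ φ i ∣² (re ⟨ φ ∣ φ ⟩) 1ℝ
    (pointwise-≤ ∣ φ i ∣² (re ⟨ φ ∣ φ ⟩) (∣coordinate∣²≤norm φ i)) (≈⇒≤ (re ⟨ φ ∣ φ ⟩) 1ℝ φφ≈1))

-- The number 2d: each coordinate contributes two real products to the real part of an inner product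
-- and two to the imaginary part.
twice : ℕ → ℚ
twice zero    = 0ℚ
twice (suc d) = 1ℚ ℚ.+ 1ℚ ℚ.+ twice d

inner-Within : ExcludedMiddle 0ℓ → ∀ {d h} (φ ψ : Vector ℂ d) →
               (∀ i → Withinᶜ 1ℚ (φ i)) → (∀ i → Withinᶜ h (ψ i)) → Withinᶜ (twice d ℚ.* h) ⟨ φ ∣ ψ ⟩
inner-Within em {zero} {h} φ ψ φ≤1 ψ≤h = zero-Within , zero-Within
  where
  zero-Within : Within (0ℚ ℚ.* h) 0ℝ
  zero-Within = fromℚ-mono-≤ (ℚₚ.≤-reflexive (sym (ℚₚ.*-zeroˡ h))) & fromℚ-mono-≤ (ℚₚ.≤-reflexive (sym (ℚₚ.*-zeroˡ h)))
inner-Within em {suc d} {h} φ ψ φ≤1 ψ≤h =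
  let φr , φi = φ≤1 zero
      ψr , ψi = ψ≤h zero
      r , i   = inner-Within em (φ ∘ suc) (ψ ∘ suc) (φ≤1 ∘ suc) (ψ≤h ∘ suc)
      -b      = - im (φ zero)
      re₀     = re (φ zero) * re (ψ zero) - -b * im (ψ zero)
      im₀     = re (φ zero) * im (ψ zero) + -b * re (ψ zero)
      re₁     = re ⟨ φ ∘ suc ∣ ψ ∘ suc ⟩
      im₁     = im ⟨ φ ∘ suc ∣ ψ ∘ suc ⟩
  in  Within-≐ (re₀ + re₁) (re ⟨ φ ∣ ψ ⟩) (λ _ → refl) (subst (λ t → Within t (re₀ + re₁)) bound
        (Within-+ re₀ re₁
          (Within-+ (re (φ zero) * re (ψ zero)) (- (-b * im (ψ zero)))
            (Within-* em (re (φ zero)) (re (ψ zero)) φr ψr)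
            (Within-neg (-b * im (ψ zero)) (Within-* em -b (im (ψ zero)) (Within-neg (im (φ zero)) φi) ψi)))
          r)) ,
      Within-≐ (im₀ + im₁) (im ⟨ φ ∣ ψ ⟩) (λ _ → refl) (subst (λ t → Within t (im₀ + im₁)) bound
        (Within-+ im₀ im₁
          (Within-+ (re (φ zero) * im (ψ zero)) (-b * re (ψ zero))
            (Within-* em (re (φ zero)) (im (ψ zero)) φr ψi)
            (Within-* em -b (re (ψ zero)) (Within-neg (im (φ zero)) φi) ψr))
          i))
  where
  bound : 1ℚ ℚ.* h ℚ.+ 1ℚ ℚ.* h ℚ.+ twice d ℚ.* h ≡ (1ℚ ℚ.+ 1ℚ ℚ.+ twice d) ℚ.* h
  bound = solve 2 (λ h t → con 1ℚ :* h :+ con 1ℚ :* h :+ t :* h := (con 1ℚ :+ con 1ℚ :+ t) :* h) refl h (twice d)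

infixl 6 _-ᶜ_
_-ᶜ_ : ℂ → ℂ → ℂ
z -ᶜ w = (re z - re w) +i (im z - im w)

inner-difference : ∀ {d} (φ ψ χ : Vector ℂ d) n →
  seq (re ⟨ φ ∣ (λ i → ψ i -ᶜ χ i) ⟩) n ≡ seq (re ⟨ φ ∣ ψ ⟩) n ℚ.- seq (re ⟨ φ ∣ χ ⟩) n ×
  seq (im ⟨ φ ∣ (λ i → ψ i -ᶜ χ i) ⟩) n ≡ seq (im ⟨ φ ∣ ψ ⟩) n ℚ.- seq (im ⟨ φ ∣ χ ⟩) n
inner-difference {zero}  φ ψ χ n = refl , refl
inner-difference {suc d} φ ψ χ n =
  let r , i = inner-difference (φ ∘ suc) (ψ ∘ suc) (χ ∘ suc) n
  in trans (cong (λ t → seq (re (conj (φ zero) *ᶜ (ψ zero -ᶜ χ zero))) n ℚ.+ t) r)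
       (solve 8 (λ a b c d e f s t →
           a :* (c :- e) :- :- b :* (d :- f) :+ (s :- t) := a :* c :- :- b :* d :+ s :- (a :* e :- :- b :* f :+ t)) refl
         (seq (re (φ zero)) n) (seq (im (φ zero)) n) (seq (re (ψ zero)) n) (seq (im (ψ zero)) n)
         (seq (re (χ zero)) n) (seq (im (χ zero)) n)
         (seq (re ⟨ φ ∘ suc ∣ ψ ∘ suc ⟩) n) (seq (re ⟨ φ ∘ suc ∣ χ ∘ suc ⟩) n)) ,
     trans (cong (λ t → seq (im (conj (φ zero) *ᶜ (ψ zero -ᶜ χ zero))) n ℚ.+ t) i)
       (solve 8 (λ a b c d e f s t →
           a :* (d :- f) :+ :- b :* (c :- e) :+ (s :- t) := a :* d :+ :- b :* c :+ s :- (a :* f :+ :- b :* e :+ t)) refl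
         (seq (re (φ zero)) n) (seq (im (φ zero)) n) (seq (re (ψ zero)) n) (seq (im (ψ zero)) n)
         (seq (re (χ zero)) n) (seq (im (χ zero)) n)
         (seq (im ⟨ φ ∘ suc ∣ ψ ∘ suc ⟩) n) (seq (im ⟨ φ ∘ suc ∣ χ ∘ suc ⟩) n))

-- With s = y - x one has y² + 2AB - x² = s² + 2(AB + xs), and |xs| ≤ AB.
square-perturbation : ExcludedMiddle 0ℓ → ∀ {A B} x y → Within A x → Within B (y - x) →
                      x * x ≤ y * y + fromℚ (A ℚ.* B ℚ.+ A ℚ.* B)
square-perturbation em {A} {B} x y x≤A y-x≤B =
  ≤-by-difference-ℝ (x * x) (y * y + fromℚ (A ℚ.* B ℚ.+ A ℚ.* B)) (s * s + (t + t))
    (0≤-+-ℝ (s * s) (t + t) (0≤-square-ℝ s) (0≤-+-ℝ t t 0≤t 0≤t))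
    (λ n → solve 3 (λ x y c → let s = y :- x ; t = c :- :- (x :* s) in
        x :* x :+ (s :* s :+ (t :+ t)) := y :* y :+ (c :+ c)) refl (seq x n) (seq y n) (A ℚ.* B))
  where
  s = y - x
  t = fromℚ (A ℚ.* B) - - (x * s)
  0≤t : 0ℝ ≤ t
  0≤t = 0≤-difference (- (x * s)) (fromℚ (A ℚ.* B)) (lower (Within-* em x s x≤A y-x≤B))

∣∣²-perturbation : ExcludedMiddle 0ℓ → ∀ {A B} z w → Withinᶜ A z → Withinᶜ B (w -ᶜ z) →
  ∣ z ∣² ≤ ∣ w ∣² + fromℚ (A ℚ.* B ℚ.+ A ℚ.* B ℚ.+ (A ℚ.* B ℚ.+ A ℚ.* B))
∣∣²-perturbation em {A} {B} z w (zr , zi) (dr , di) =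
  ≤-trans ∣ z ∣² (re w * re w + c + (im w * im w + c)) (∣ w ∣² + fromℚ (C ℚ.+ C))
    (+-mono-≤ (re z * re z) (re w * re w + c) (im z * im z) (im w * im w + c)
      (square-perturbation em (re z) (re w) zr dr) (square-perturbation em (im z) (im w) zi di))
    (pointwise-≤ (re w * re w + c + (im w * im w + c)) (∣ w ∣² + fromℚ (C ℚ.+ C)) λ n → ℚₚ.≤-reflexive
      (solve 3 (λ x y c → x :* x :+ c :+ (y :* y :+ c) := x :* x :+ y :* y :+ (c :+ c)) refl
        (seq (re w) n) (seq (im w) n) C))
  where
  C = A ℚ.* B ℚ.+ A ℚ.* B
  c = fromℚ C

∣∣²-cong : ∀ z w → z ≈ᶜ w → ∣ z ∣² ≈ ∣ w ∣²
∣∣²-cong z w (p , q) = +-cong (re z * re z) (re w * re w) (im z * im z) (im w * im w)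
  (*-cong (re z) (re w) (re z) (re w) p p) (*-cong (im z) (im w) (im z) (im w) q q)

-- Recurrence of unitary orbits

gridPoint : ℚ → ℚ → ∀ {K} → Fin K → ℚ
gridPoint lo h zero    = lo
gridPoint lo h (suc i) = gridPoint (lo ℚ.+ h) h i

InCell : ℚ → ℚ → ∀ {K} → Fin K → Pred ℝ 0ℓ
InCell lo h i x = fromℚ (gridPoint lo h i) ≤ x × x ≤ fromℚ (gridPoint lo h i ℚ.+ h)

-- There is one cell more than the interval has steps, so that a point remaining after `K` steps
-- still has a cell to fall into.
cell : ExcludedMiddle 0ℓ → ∀ {h} → 0ℚ ℚ.< h → ∀ K lo x → fromℚ lo ≤ x → x ≤ fromℚ (lo ℚ.+ fromℕ K ℚ.* h) →
       ∃[ i ] InCell lo h {suc K} i x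
cell em {h} 0<h zero lo x lo≤x x≤hi = zero , lo≤x ,
  ≤-trans x (fromℚ (lo ℚ.+ 0ℚ ℚ.* h)) (fromℚ (lo ℚ.+ h)) x≤hi
    (fromℚ-mono-≤ (ℚₚ.+-monoʳ-≤ lo (subst (ℚ._≤ h) (sym (ℚₚ.*-zeroˡ h)) (ℚₚ.<⇒≤ 0<h))))
cell em {h} 0<h (suc K) lo x lo≤x x≤hi with <⊎≥ em (fromℚ (lo ℚ.+ h)) x
... | inj₂ x≤lo+h = zero , lo≤x , x≤lo+h
... | inj₁ lo+h<x =
  let i , inCell = cell em 0<h K (lo ℚ.+ h) x (<⇒≤ (fromℚ (lo ℚ.+ h)) x lo+h<x)
                     (subst (λ t → x ≤ fromℚ t) shift x≤hi)
  in suc i , inCell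
  where
  shift : lo ℚ.+ fromℕ (suc K) ℚ.* h ≡ lo ℚ.+ h ℚ.+ fromℕ K ℚ.* h
  shift = trans (cong (λ t → lo ℚ.+ t ℚ.* h) (fromℕ-suc K))
    (solve 3 (λ q k h → q :+ (con 1ℚ :+ k) :* h := q :+ h :+ k :* h) refl lo (fromℕ K) h)

same-cell : ∀ lo h {K} (i j : Fin K) x y → i ≡ j → InCell lo h i x → InCell lo h j y → Within h (x - y)
same-cell lo h i .i x y refl (g≤x , x≤g+h) (g≤y , y≤g+h) =
  bound x y g≤y x≤g+h &
  ≤-trans (- (x - y)) (y - x) (fromℚ h)
    (pointwise-≤ (- (x - y)) (y - x) λ n → ℚₚ.≤-reflexive (solve 2 (λ x y → :- (x :- y) := y :- x) refl (seq x n) (seq y n)))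
    (bound y x g≤x y≤g+h)
  where
  g = gridPoint lo h i
  bound : ∀ a b → fromℚ g ≤ b → a ≤ fromℚ (g ℚ.+ h) → a - b ≤ fromℚ h
  bound a b g≤b a≤g+h = ≤-trans (a - b) (fromℚ (g ℚ.+ h) - fromℚ g) (fromℚ h)
    (+-mono-≤ a (fromℚ (g ℚ.+ h)) (- b) (- fromℚ g) a≤g+h (neg-antimono-≤ (fromℚ g) b g≤b))
    (fromℚ-mono-≤ (ℚₚ.≤-reflexive (solve 2 (λ g h → g :+ h :- g := h) refl g h)))

-- The interval [-1,1] has length 2, so any K ≥ 2/h steps cross it.
cell-count : ∀ {h} → 0ℚ ℚ.< h → ∃[ K ] 1ℚ ℚ.≤ ℚ.- 1ℚ ℚ.+ fromℕ K ℚ.* h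
cell-count {h} 0<h =
  let δ , _ , hδ≡2 = divide h (1ℚ ℚ.+ 1ℚ) 0<h (ℚₚ.+-mono-< 0<1 0<1)
      K , δ≤K      = archimedean δ
  in K , subst (ℚ._≤ ℚ.- 1ℚ ℚ.+ fromℕ K ℚ.* h) (cong (ℚ.- 1ℚ ℚ.+_) (trans (ℚₚ.*-comm δ h) hδ≡2))
           (ℚₚ.+-monoʳ-≤ (ℚ.- 1ℚ) (ℚₚ.*-monoʳ-≤-nonNeg h {{ℚ.nonNegative (ℚₚ.<⇒≤ 0<h)}} δ≤K))

-- Rounding the 2d real coordinates to grid cells of width `h` sends the vectors into a finite set.
-- Among one more vector than there are codes two share a code, and equal codes mean equal cells in
-- every coordinate because `funToFin` has a left inverse.
close-pair : ExcludedMiddle 0ℓ → ∀ {d h} → 0ℚ ℚ.< h → (f : ℕ → Vector ℂ d) → (∀ n i → Withinᶜ 1ℚ (f n i)) →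
             ∃[ i ] ∃[ j ] (i ℕ.< j × ∀ k → Withinᶜ h (f j k -ᶜ f i k))
close-pair em {d} {h} 0<h f f≤1 =
  let i , j , i<j , same = Finₚ.pigeonhole ℕₚ.≤-refl (code ∘ Fin.toℕ)
      sameʳ , sameⁱ      = Finₚ.combine-injective _ _ _ _ same
  in Fin.toℕ i , Fin.toℕ j , i<j , λ k → close (Fin.toℕ i) (Fin.toℕ j) k (decode sameʳ k) (decode sameⁱ k)
  where
  K = proj₁ (cell-count 0<h)

  locate : ∀ x → Within 1ℚ x → ∃[ i ] InCell (ℚ.- 1ℚ) h {suc K} i x
  locate x (x≤1 & -x≤1) = cell em 0<h K (ℚ.- 1ℚ) x
    (≤-trans (fromℚ (ℚ.- 1ℚ)) (- - x) x (neg-antimono-≤ (- x) 1ℝ -x≤1)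
      (pointwise-≤ (- - x) x λ n → ℚₚ.≤-reflexive (solve 1 (λ x → :- :- x := x) refl (seq x n))))
    (≤-trans x 1ℝ (fromℚ (ℚ.- 1ℚ ℚ.+ fromℕ K ℚ.* h)) x≤1 (fromℚ-mono-≤ (proj₂ (cell-count 0<h))))

  cellʳ cellⁱ : ℕ → Fin d → Fin (suc K)
  cellʳ n k = proj₁ (locate (re (f n k)) (proj₁ (f≤1 n k)))
  cellⁱ n k = proj₁ (locate (im (f n k)) (proj₂ (f≤1 n k)))

  code : ℕ → Fin ((suc K ℕ.^ d) ℕ.* (suc K ℕ.^ d))
  code n = Fin.combine (Fin.funToFin (cellʳ n)) (Fin.funToFin (cellⁱ n))

  decode : ∀ {p q : Fin d → Fin (suc K)} → Fin.funToFin p ≡ Fin.funToFin q → ∀ k → q k ≡ p k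
  decode {p} {q} eq k = trans (sym (Finₚ.finToFun-funToFin q k))
    (trans (cong (λ c → Fin.finToFun c k) (sym eq)) (Finₚ.finToFun-funToFin p k))

  close : ∀ i j k → cellʳ j k ≡ cellʳ i k → cellⁱ j k ≡ cellⁱ i k → Withinᶜ h (f j k -ᶜ f i k)
  close i j k sameʳ sameⁱ =
    same-cell (ℚ.- 1ℚ) h (cellʳ j k) (cellʳ i k) (re (f j k)) (re (f i k)) sameʳ
      (proj₂ (locate (re (f j k)) (proj₁ (f≤1 j k)))) (proj₂ (locate (re (f i k)) (proj₁ (f≤1 i k)))) ,
    same-cell (ℚ.- 1ℚ) h (cellⁱ j k) (cellⁱ i k) (im (f j k)) (im (f i k)) sameⁱ
      (proj₂ (locate (im (f j k)) (proj₂ (f≤1 j k)))) (proj₂ (locate (im (f i k)) (proj₂ (f≤1 i k))))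

-- The error of `∣∣²-perturbation` for the bounds that `inner-Within` supplies on an inner product
-- of unit vectors and on its change; it equals 16d²h.
error : ℕ → ℚ → ℚ
error d h = AB ℚ.+ AB ℚ.+ (AB ℚ.+ AB)
  where AB = (twice d ℚ.* 1ℚ) ℚ.* (twice d ℚ.* h)

choose-mesh : ∀ d {ε} → 0ℚ ℚ.< ε → ∃[ h ] (0ℚ ℚ.< h × error d h ℚ.≤ ε)
choose-mesh d {ε} 0<ε =
  let h , 0<h , Ch≡ε = divide C ε 0<C 0<ε
  in h , 0<h , ≤-by-difference (ℚₚ.<⇒≤ 0<h) (trans
       (solve 2 (λ κ h → let ab = (κ :* con 1ℚ) :* (κ :* h) in
           ab :+ ab :+ (ab :+ ab) :+ h := (con 1ℚ :+ (κ :* κ :+ κ :* κ :+ (κ :* κ :+ κ :* κ))) :* h) refl κ h)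
       Ch≡ε)
  where
  κ C : ℚ
  κ = twice d
  -- The error is 4κ²h; the summand 1 keeps the divisor positive even when d = 0.
  C = 1ℚ ℚ.+ (κ ℚ.* κ ℚ.+ κ ℚ.* κ ℚ.+ (κ ℚ.* κ ℚ.+ κ ℚ.* κ))

  0<C : 0ℚ ℚ.< C
  0<C = ℚₚ.+-mono-<-≤ 0<1
    (ℚₚ.+-mono-≤ (ℚₚ.+-mono-≤ (0≤-square κ) (0≤-square κ)) (ℚₚ.+-mono-≤ (0≤-square κ) (0≤-square κ)))

inner-perturbation : ExcludedMiddle 0ℓ → ∀ {d h} (φ ψ χ : Vector ℂ d) → IsUnit φ → IsUnit ψ →
  (∀ k → Withinᶜ h (χ k -ᶜ ψ k)) → ∣ ⟨ φ ∣ ψ ⟩ ∣² ≤ ∣ ⟨ φ ∣ χ ⟩ ∣² + fromℚ (error d h)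
inner-perturbation em {d} {h} φ ψ χ φ-unit ψ-unit close =
  let φ-Within = unit-Within em φ φ-unit
      r , i    = inner-Within em {d} {h} φ (λ k → χ k -ᶜ ψ k) φ-Within close
  in ∣∣²-perturbation em {twice d ℚ.* 1ℚ} {twice d ℚ.* h} ⟨ φ ∣ ψ ⟩ ⟨ φ ∣ χ ⟩
       (inner-Within em {d} {1ℚ} φ ψ φ-Within (unit-Within em ψ ψ-unit))
       (Within-≐ (re ⟨ φ ∣ (λ k → χ k -ᶜ ψ k) ⟩) (re ⟨ φ ∣ χ ⟩ - re ⟨ φ ∣ ψ ⟩)
          (λ n → proj₁ (inner-difference φ χ ψ n)) r ,
        Within-≐ (im ⟨ φ ∣ (λ k → χ k -ᶜ ψ k) ⟩) (im ⟨ φ ∣ χ ⟩ - im ⟨ φ ∣ ψ ⟩)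
          (λ n → proj₂ (inner-difference φ χ ψ n)) i)

-- Two points Uⁱs and Uʲs of the orbit are close; since ⟨φ|Uʲ⁻ⁱs⟩ = ⟨Uⁱφ|Uʲs⟩,
-- this amplitude is close to ⟨Uⁱφ|Uⁱs⟩ = ⟨φ|s⟩.
recurrence : ExcludedMiddle 0ℓ → ∀ {d} (U : Matrix d) → IsUnitary U → ∀ φ s → IsUnit φ → IsUnit s →
             ∀ {ε} → 0ℚ ℚ.< ε →
             ∃[ n ] ∣ ⟨ φ ∣ s ⟩ ∣² ≤ ∣ ⟨ φ ∣ iterate U (suc n) s ⟩ ∣² + fromℚ ε
recurrence em {d} U U-unitary φ s φ-unit s-unit {ε} 0<ε =
  let h , 0<h , error≤ε   = choose-mesh d 0<ε
      i , j , i<j , close = close-pair em 0<h (λ n → iterate U n s)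
                              λ n → unit-Within em (iterate U n s) (iterate-unit U U-unitary n s s-unit)
      -- Strictness of i < j makes the return time `suc o` nonzero, hence N ≥ 1 in the pumped word.
      o , 1+i+o≡j         = ℕₚ.m≤n⇒∃[o]m+o≡n i<j
  in o , bound h error≤ε i o (iterate U j s)
           (trans (cong (λ j → iterate U j s) (sym (trans (ℕₚ.+-suc i o) 1+i+o≡j))) (iterate-+ U i (suc o) s)) close
  where
  bound : ∀ h → error d h ℚ.≤ ε → ∀ i o t → t ≡ iterate U i (iterate U (suc o) s) →
          (∀ k → Withinᶜ h (t k -ᶜ iterate U i s k)) →
          ∣ ⟨ φ ∣ s ⟩ ∣² ≤ ∣ ⟨ φ ∣ iterate U (suc o) s ⟩ ∣² + fromℚ ε
  bound h error≤ε i o .(iterate U i (iterate U (suc o) s)) refl close =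
    ≤-trans ∣ ⟨ φ ∣ s ⟩ ∣² ∣ ⟨ iterate U i φ ∣ iterate U i s ⟩ ∣² (∣ ⟨ φ ∣ iterate U (suc o) s ⟩ ∣² + fromℚ ε)
      (≈⇒≥ ∣ ⟨ iterate U i φ ∣ iterate U i s ⟩ ∣² ∣ ⟨ φ ∣ s ⟩ ∣²
        (∣∣²-cong ⟨ iterate U i φ ∣ iterate U i s ⟩ ⟨ φ ∣ s ⟩ (iterate-inner U U-unitary i φ s)))
      (≤-trans ∣ ⟨ iterate U i φ ∣ iterate U i s ⟩ ∣²
        (∣ ⟨ iterate U i φ ∣ iterate U i (iterate U (suc o) s) ⟩ ∣² + fromℚ (error d h))
        (∣ ⟨ φ ∣ iterate U (suc o) s ⟩ ∣² + fromℚ ε)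
        (inner-perturbation em {d} {h} (iterate U i φ) (iterate U i s) (iterate U i (iterate U (suc o) s))
          (iterate-unit U U-unitary i φ φ-unit) (iterate-unit U U-unitary i s s-unit) close)
        (+-mono-≤ ∣ ⟨ iterate U i φ ∣ iterate U i (iterate U (suc o) s) ⟩ ∣² ∣ ⟨ φ ∣ iterate U (suc o) s ⟩ ∣²
          (fromℚ (error d h)) (fromℚ ε)
          (≈⇒≤ ∣ ⟨ iterate U i φ ∣ iterate U i (iterate U (suc o) s) ⟩ ∣² ∣ ⟨ φ ∣ iterate U (suc o) s ⟩ ∣²
            (∣∣²-cong ⟨ iterate U i φ ∣ iterate U i (iterate U (suc o) s) ⟩ ⟨ φ ∣ iterate U (suc o) s ⟩
              (iterate-inner U U-unitary i φ (iterate U (suc o) s))))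
          (fromℚ-mono-≤ error≤ε)))

-- The power of `V` is absorbed into the test vector through its adjoint, which leaves plain
-- recurrence of `s` under `U`.
recurrence-after : ExcludedMiddle 0ℓ → ∀ {d} (U V : Matrix d) → IsUnitary U → IsUnitary V →
  ∀ m ψ s → IsUnit ψ → IsUnit s → ∀ {ε} → 0ℚ ℚ.< ε →
  ∃[ n ] ∣ ⟨ ψ ∣ iterate V m s ⟩ ∣² ≤ ∣ ⟨ ψ ∣ iterate V m (iterate U (suc n) s) ⟩ ∣² + fromℚ ε
recurrence-after em U V U-unitary V-unitary m ψ s ψ-unit s-unit {ε} 0<ε =
  let χ , χ-unit , pull = iterate-adjoint V V-unitary m ψ ψ-unit
      n , le            = recurrence em U U-unitary χ s χ-unit s-unit 0<ε
  in n , transport χ pull (iterate U (suc n) s) le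
  where
  transport : ∀ χ → (∀ φ → ⟨ ψ ∣ iterate V m φ ⟩ ≈ᶜ ⟨ χ ∣ φ ⟩) → ∀ t →
              ∣ ⟨ χ ∣ s ⟩ ∣² ≤ ∣ ⟨ χ ∣ t ⟩ ∣² + fromℚ ε →
              ∣ ⟨ ψ ∣ iterate V m s ⟩ ∣² ≤ ∣ ⟨ ψ ∣ iterate V m t ⟩ ∣² + fromℚ ε
  transport χ pull t le =
    ≤-trans ∣ ⟨ ψ ∣ iterate V m s ⟩ ∣² ∣ ⟨ χ ∣ s ⟩ ∣² (∣ ⟨ ψ ∣ iterate V m t ⟩ ∣² + fromℚ ε)
      (≈⇒≤ ∣ ⟨ ψ ∣ iterate V m s ⟩ ∣² ∣ ⟨ χ ∣ s ⟩ ∣² (∣∣²-cong ⟨ ψ ∣ iterate V m s ⟩ ⟨ χ ∣ s ⟩ (pull s)))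
      (≤-trans ∣ ⟨ χ ∣ s ⟩ ∣² (∣ ⟨ χ ∣ t ⟩ ∣² + fromℚ ε) (∣ ⟨ ψ ∣ iterate V m t ⟩ ∣² + fromℚ ε) le
        (+-mono-≤ ∣ ⟨ χ ∣ t ⟩ ∣² ∣ ⟨ ψ ∣ iterate V m t ⟩ ∣² (fromℚ ε) (fromℚ ε)
          (≈⇒≥ ∣ ⟨ ψ ∣ iterate V m t ⟩ ∣² ∣ ⟨ χ ∣ t ⟩ ∣² (∣∣²-cong ⟨ ψ ∣ iterate V m t ⟩ ⟨ χ ∣ t ⟩ (pull t)))
          (≤-refl (fromℚ ε))))

≤-cancel-+ : ∀ x y z → x + z ≤ y + z → x ≤ y
≤-cancel-+ x y z le = ≤-by-difference-ℝ x y (y + z - (x + z)) (0≤-difference (x + z) (y + z) le)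
  λ n → solve 3 (λ x y z → x :+ (y :+ z :- (x :+ z)) := y) refl (seq x n) (seq y n) (seq z n)

≤-from-slack : ∀ u t x y ε → u + ε ≤ t → t ≤ x → x ≤ y + ε → u ≤ y
≤-from-slack u t x y ε u+ε≤t t≤x x≤y+ε =
  ≤-cancel-+ u y ε (≤-trans (u + ε) t (y + ε) u+ε≤t (≤-trans t x (y + ε) t≤x x≤y+ε))

-- Words aⁿcᵚ

module _ {k} (a c : Fin k) where

  prefixed : ℕ → ωWord k
  prefixed zero    m       = c
  prefixed (suc n) zero    = a
  prefixed (suc n) (suc m) = prefixed n m

  prefixed-prefix : ∀ {n m} → m ℕ.< n → prefixed n m ≡ a
  prefixed-prefix {suc n} {zero}  _           = refl
  prefixed-prefix {suc n} {suc m} (ℕ.s≤s m<n) = prefixed-prefix m<n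

  prefixed-suffix : ∀ {n m} → n ℕ.≤ m → prefixed n m ≡ c
  prefixed-suffix ℕ.z≤n       = refl
  prefixed-suffix (ℕ.s≤s n≤m) = prefixed-suffix n≤m

-- Checkpoint sequences and their position relative to a block.

open Checkpoints

at-mono : ∀ cs {i j} → i ℕ.≤ j → at cs i ℕ.≤ at cs j
at-mono cs {i} i≤j = go (ℕₚ.≤⇒≤′ i≤j)
  where
  go : ∀ {j} → i ℕ.≤′ j → at cs i ℕ.≤ at cs j
  go ℕ.≤′-refl         = ℕₚ.≤-refl
  go (ℕ.≤′-step {j} p) = ℕₚ.≤-trans (go p) (ℕₚ.<⇒≤ (increasing cs j))

before-first : ∀ cs {m} → m ℕ.< at cs zero → ¬ (∃[ i ] at cs i ≡ m)
before-first cs m<at₀ (i , refl) = ℕₚ.<⇒≱ m<at₀ (at-mono cs ℕ.z≤n)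

shift : ℕ → Checkpoints → Checkpoints
shift n cs .at i         = at cs i ℕ.+ n
shift n cs .increasing i = ℕₚ.+-monoˡ-< n (increasing cs i)

everywhere : Checkpoints
everywhere .at i         = i
everywhere .increasing i = ℕₚ.≤-refl

-- Since `N ≤ at cs N`, a downward search from index `N` finds the first checkpoint that is not
-- inside the block of length `N`; the segment leading to it contains the end of the block.
crossing : ∀ cs N → N ℕ.≤ at cs zero ⊎ ∃[ i ] (at cs i ℕ.< N × N ℕ.≤ at cs (suc i))
crossing cs N = search N (i≤at cs N)
  where
  search : ∀ K → N ℕ.≤ at cs K → N ℕ.≤ at cs zero ⊎ ∃[ i ] (at cs i ℕ.< N × N ℕ.≤ at cs (suc i))
  search zero    N≤ = inj₁ N≤
  search (suc K) N≤ with N ℕ.≤? at cs K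
  ... | yes N≤at = search K N≤at
  ... | no  N≰at = inj₂ (K , ℕₚ.≰⇒> N≰at , N≤)

between : ∀ cs i {m} → at cs i ℕ.< m → m ℕ.< at cs (suc i) → ¬ (∃[ k ] at cs k ≡ m)
between cs i lo hi (k , refl) with k ℕ.≤? i
... | yes k≤i = ℕₚ.<⇒≱ lo (at-mono cs k≤i)
... | no  k≰i = ℕₚ.<⇒≱ hi (at-mono cs (ℕₚ.≰⇒> k≰i))

∣1∣²≈1 : ∣ 1ᶜ ∣² ≈ 1ℝ
∣1∣²≈1 = pointwise-≈ ∣ 1ᶜ ∣² 1ℝ λ _ → refl

-- Disturbing runs on stretches of equal letters and under shifted checkpoints.

module _ {k} (𝒜 : QuantumAutomaton k) where
  open QuantumAutomaton 𝒜

  letter-cong : ∀ σ τ φ ψ → σ ≡ τ → φ ≡ ψ → U σ · φ ≡ U τ · ψ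
  letter-cong σ .σ φ .φ refl refl = refl

  run-at-checkpoint : ∀ w ψ cs n → ∃[ i ] at cs i ≡ n → disturbingRun 𝒜 w ψ cs (suc n) ≡ U (w n) · ψ
  run-at-checkpoint w ψ cs n cp = letter-cong (w n) (w n)
    (if does (isCheckpoint? cs n) then ψ else disturbingRun 𝒜 w ψ cs n) ψ refl
    (cong (if_then ψ else disturbingRun 𝒜 w ψ cs n) (dec-true (isCheckpoint? cs n) cp))

  run-off-checkpoint : ∀ w ψ cs n → ¬ (∃[ i ] at cs i ≡ n) →
                       disturbingRun 𝒜 w ψ cs (suc n) ≡ U (w n) · disturbingRun 𝒜 w ψ cs n
  run-off-checkpoint w ψ cs n ¬cp = letter-cong (w n) (w n)
    (if does (isCheckpoint? cs n) then ψ else disturbingRun 𝒜 w ψ cs n) (disturbingRun 𝒜 w ψ cs n) refl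
    (cong (if_then ψ else disturbingRun 𝒜 w ψ cs n) (dec-false (isCheckpoint? cs n) ¬cp))

  -- The stretch must avoid checkpoints at its start `n`, but its end `m + n` may be one: a reset
  -- affects only the state after the checkpoint.
  run-iterate : ∀ w ψ cs σ n m → (∀ j → j ℕ.< m → w (j ℕ.+ n) ≡ σ) →
                (∀ j → j ℕ.< m → ¬ (∃[ i ] at cs i ≡ j ℕ.+ n)) →
                disturbingRun 𝒜 w ψ cs (m ℕ.+ n) ≡ iterate (U σ) m (disturbingRun 𝒜 w ψ cs n)
  run-iterate w ψ cs σ n zero    letter off = sym (iterate-zero (U σ) (disturbingRun 𝒜 w ψ cs n))
  run-iterate w ψ cs σ n (suc m) letter off = trans
    (run-off-checkpoint w ψ cs (m ℕ.+ n) (off m ℕₚ.≤-refl))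
    (trans
      (letter-cong (w (m ℕ.+ n)) σ (disturbingRun 𝒜 w ψ cs (m ℕ.+ n)) (iterate (U σ) m (disturbingRun 𝒜 w ψ cs n))
        (letter m ℕₚ.≤-refl)
        (run-iterate w ψ cs σ n m (λ j j<m → letter j (ℕₚ.m<n⇒m<1+n j<m)) (λ j j<m → off j (ℕₚ.m<n⇒m<1+n j<m))))
      (sym (iterate-suc (U σ) m (disturbingRun 𝒜 w ψ cs n))))

  run-initial : ∀ w ψ cs σ m → (∀ j → j ℕ.< m → w j ≡ σ) → (∀ j → j ℕ.< m → ¬ (∃[ i ] at cs i ≡ j)) →
                disturbingRun 𝒜 w ψ cs m ≡ iterate (U σ) m s₀
  run-initial w ψ cs σ zero    letter off = sym (iterate-zero (U σ) s₀)
  run-initial w ψ cs σ (suc m) letter off = trans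
    (run-off-checkpoint w ψ cs m (off m ℕₚ.≤-refl))
    (trans
      (letter-cong (w m) σ (disturbingRun 𝒜 w ψ cs m) (iterate (U σ) m s₀) (letter m ℕₚ.≤-refl)
        (run-initial w ψ cs σ m (λ j j<m → letter j (ℕₚ.m<n⇒m<1+n j<m)) (λ j j<m → off j (ℕₚ.m<n⇒m<1+n j<m))))
      (sym (iterate-suc (U σ) m s₀)))

  module _ (a c : Fin k) (n : ℕ) (ψ : Vector ℂ dim) (cs : Checkpoints) where
    run-first : disturbingRun 𝒜 (prefixed a c zero) ψ cs (at cs zero) ≡ iterate (U c) (at cs zero) s₀
    run-first = run-initial (prefixed a c zero) ψ cs c (at cs zero) (λ _ _ → refl) λ j → before-first cs {j}

    shifted-run-first : disturbingRun 𝒜 (prefixed a c n) ψ (shift n cs) (at (shift n cs) zero) ≡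
                        iterate (U c) (at cs zero) (iterate (U a) n s₀)
    shifted-run-first = trans
      (run-iterate (prefixed a c n) ψ (shift n cs) c n (at cs zero) (λ j _ → prefixed-suffix a c (ℕₚ.m≤n+m n j))
        λ j j<at₀ (i , eq) → before-first cs j<at₀ (i , ℕₚ.+-cancelʳ-≡ n (at cs i) j eq))
      (cong (iterate (U c) (at cs zero))
        (run-initial (prefixed a c n) ψ (shift n cs) a n (λ j j<n → prefixed-prefix a c j<n)
          λ j j<n (i , eq) → ℕₚ.<⇒≱ j<n (subst (n ℕ.≤_) eq (ℕₚ.m≤n+m n (at cs i)))))

    -- The first checkpoint resets both runs to ψ, and from there on both read only c and meet
    -- checkpoints at corresponding positions. What the prefix aⁿ did before is forgotten.
    shifted-run : ∀ m → at cs zero ℕ.< m →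
                  disturbingRun 𝒜 (prefixed a c n) ψ (shift n cs) (m ℕ.+ n) ≡
                  disturbingRun 𝒜 (prefixed a c zero) ψ cs m
    shifted-run (suc m) (ℕ.s≤s at₀≤m) = cases (isCheckpoint? cs m)
      where
      letter : prefixed a c n (m ℕ.+ n) ≡ prefixed a c zero m
      letter = prefixed-suffix a c (ℕₚ.m≤n+m n m)

      cases : Dec (∃[ i ] at cs i ≡ m) →
              disturbingRun 𝒜 (prefixed a c n) ψ (shift n cs) (suc m ℕ.+ n) ≡
              disturbingRun 𝒜 (prefixed a c zero) ψ cs (suc m)
      cases (yes cp@(i , eq)) = trans
        (run-at-checkpoint (prefixed a c n) ψ (shift n cs) (m ℕ.+ n) (i , cong (ℕ._+ n) eq))
        (trans (letter-cong (prefixed a c n (m ℕ.+ n)) (prefixed a c zero m) ψ ψ letter refl)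
          (sym (run-at-checkpoint (prefixed a c zero) ψ cs m cp)))
      cases (no ¬cp) = trans
        (run-off-checkpoint (prefixed a c n) ψ (shift n cs) (m ℕ.+ n)
          λ (i , eq) → ¬cp (i , ℕₚ.+-cancelʳ-≡ n (at cs i) m eq))
        (trans
          (letter-cong (prefixed a c n (m ℕ.+ n)) (prefixed a c zero m)
            (disturbingRun 𝒜 (prefixed a c n) ψ (shift n cs) (m ℕ.+ n))
            (disturbingRun 𝒜 (prefixed a c zero) ψ cs m) letter
            -- The first checkpoint is excluded here, so `m` lies strictly after it and the
            -- induction hypothesis applies.
            (shifted-run m (ℕₚ.≤∧≢⇒< at₀≤m λ at₀≡m → ¬cp (0 , at₀≡m))))
          (sym (run-off-checkpoint (prefixed a c zero) ψ cs m ¬cp)))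

    shifted-run-later : ∀ i → disturbingRun 𝒜 (prefixed a c n) ψ (shift n cs) (at (shift n cs) (suc i)) ≡
                              disturbingRun 𝒜 (prefixed a c zero) ψ cs (at cs (suc i))
    shifted-run-later i = shifted-run (at cs (suc i)) (ℕₚ.≤-<-trans (at-mono cs ℕ.z≤n) (increasing cs i))

    -- The loss `ε` occurs at the first checkpoint alone and is paid for by lowering the bound from
    -- `t` to `u`.
    shifted-values : ∀ t → (∀ i → t ≤ ∣ ⟨ ψ ∣ disturbingRun 𝒜 (prefixed a c zero) ψ cs (at cs i) ⟩ ∣²) →
      ∀ u → u ≤ t → ∀ ε → u + fromℚ ε ≤ t →
      ∣ ⟨ ψ ∣ iterate (U c) (at cs zero) s₀ ⟩ ∣² ≤
        ∣ ⟨ ψ ∣ iterate (U c) (at cs zero) (iterate (U a) n s₀) ⟩ ∣² + fromℚ ε →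
      ∀ i → u ≤ ∣ ⟨ ψ ∣ disturbingRun 𝒜 (prefixed a c n) ψ (shift n cs) (at (shift n cs) i) ⟩ ∣²
    shifted-values t t≤values u u≤t ε u+ε≤t recurs zero = subst (λ χ → u ≤ ∣ ⟨ ψ ∣ χ ⟩ ∣²)
      {iterate (U c) (at cs zero) (iterate (U a) n s₀)}
      {disturbingRun 𝒜 (prefixed a c n) ψ (shift n cs) (at (shift n cs) zero)}
      (sym shifted-run-first)
      (≤-from-slack u t ∣ ⟨ ψ ∣ iterate (U c) (at cs zero) s₀ ⟩ ∣²
        ∣ ⟨ ψ ∣ iterate (U c) (at cs zero) (iterate (U a) n s₀) ⟩ ∣² (fromℚ ε) u+ε≤t
        (subst (λ χ → t ≤ ∣ ⟨ ψ ∣ χ ⟩ ∣²)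
          {disturbingRun 𝒜 (prefixed a c zero) ψ cs (at cs zero)} {iterate (U c) (at cs zero) s₀}
          run-first (t≤values zero))
        recurs)
    shifted-values t t≤values u u≤t ε u+ε≤t recurs (suc i) = subst (λ χ → u ≤ ∣ ⟨ ψ ∣ χ ⟩ ∣²)
      {disturbingRun 𝒜 (prefixed a c zero) ψ cs (at cs (suc i))}
      {disturbingRun 𝒜 (prefixed a c n) ψ (shift n cs) (at (shift n cs) (suc i))}
      (sym (shifted-run-later i))
      (≤-trans u t ∣ ⟨ ψ ∣ disturbingRun 𝒜 (prefixed a c zero) ψ cs (at cs (suc i)) ⟩ ∣² u≤t (t≤values (suc i)))

  -- Acceptance of cᵚ and rejection of aᴺcᵚ when c acts as the identity.

  module _ (a c : Fin k) where
    open Subspace F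

    module _ (U-c-fixes : ∀ φ → U c · φ ≈ᵛ φ) (s₀∈F : s₀ ∈F) where

      -- With ψ = `s₀` and every position a checkpoint, each test compares `s₀` with itself, so 1 is
      -- attained at every level.
      accepts-cᵚ : 𝓛⁼¹ 𝒜 (prefixed a c zero)
      accepts-cᵚ = unit , (λ x (_ , _ , _ , (_ , x≤1) , _) → x≤1) ,
                   λ u _ u-above → u-above 1ℝ (s₀ , s₀∈F , s₀-unit , sup)
        where
        unit : UnitInterval 1ℝ
        unit = fromℚ-mono-≤ (ℚₚ.<⇒≤ 0<1) , ≤-refl 1ℝ

        amplitude : ∀ i → ⟨ s₀ ∣ disturbingRun 𝒜 (prefixed a c zero) s₀ everywhere i ⟩ ≈ᶜ ⟨ s₀ ∣ s₀ ⟩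
        amplitude zero    = inner-congʳ s₀ (disturbingRun 𝒜 (prefixed a c zero) s₀ everywhere zero) s₀
          (≡⇒≈ᵛ (disturbingRun 𝒜 (prefixed a c zero) s₀ everywhere zero) s₀ refl)
        amplitude (suc n) = subst (λ χ → ⟨ s₀ ∣ χ ⟩ ≈ᶜ ⟨ s₀ ∣ s₀ ⟩)
          {U c · s₀} {disturbingRun 𝒜 (prefixed a c zero) s₀ everywhere (suc n)}
          (sym (trans (run-at-checkpoint (prefixed a c zero) s₀ everywhere n (n , refl))
                      (letter-cong (prefixed a c zero n) c s₀ s₀ refl refl)))
          (inner-congʳ s₀ (U c · s₀) s₀ (U-c-fixes s₀))

        value : ∀ i → ∣ ⟨ s₀ ∣ disturbingRun 𝒜 (prefixed a c zero) s₀ everywhere i ⟩ ∣² ≈ 1ℝ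
        value i = ≈-trans ∣ ⟨ s₀ ∣ disturbingRun 𝒜 (prefixed a c zero) s₀ everywhere i ⟩ ∣² ∣ 1ᶜ ∣² 1ℝ
          (∣∣²-cong ⟨ s₀ ∣ disturbingRun 𝒜 (prefixed a c zero) s₀ everywhere i ⟩ 1ᶜ
            (≈ᶜ-trans ⟨ s₀ ∣ disturbingRun 𝒜 (prefixed a c zero) s₀ everywhere i ⟩ ⟨ s₀ ∣ s₀ ⟩ 1ᶜ (amplitude i) s₀-unit))
          ∣1∣²≈1

        inf : IsInfOverCheckpoints 𝒜 (prefixed a c zero) s₀ everywhere 1ℝ
        inf = unit ,
          (λ x (i , x≈) → ≈⇒≥ x 1ℝ
            (≈-trans x ∣ ⟨ s₀ ∣ disturbingRun 𝒜 (prefixed a c zero) s₀ everywhere (at everywhere i) ⟩ ∣² 1ℝ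
              x≈ (value (at everywhere i)))) ,
          λ l (_ , l≤1) _ → l≤1

        sup : IsSupOverSequences 𝒜 (prefixed a c zero) s₀ 1ℝ
        sup = unit , (λ x (_ , (_ , x≤1) , _) → x≤1) , λ u _ u-above → u-above 1ℝ (everywhere , inf)

      module _ (N : ℕ) (u : ℝ) (u∈[0,1] : UnitInterval u)
               (bound : ∀ n → n ℕ.< N → ∀ φ ψ → φ ∈F → IsUnit φ → ψ ∈F → IsUnit ψ →
                        ∣ ⟨ ψ ∣ iterate (U a) (suc n) φ ⟩ ∣² ≤ u) where

        -- The state after the block aᴺ comes, through a nonempty power of a, from
        -- a unit vector of F: either s₀ or the ψ of the last checkpoint inside aᴺ.
        CrossingState : Vector ℂ dim → Checkpoints → Set
        CrossingState ψ cs = ∃[ i ] ∃[ m ] ∃[ n ] ∃[ φ ] (n ℕ.< N × φ ∈F × IsUnit φ ×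
          disturbingRun 𝒜 (prefixed a c N) ψ cs (at cs i) ≡ iterate (U c) m (iterate (U a) (suc n) φ))

        crossing-from-start : 0 ℕ.< N → ∀ ψ cs → N ℕ.≤ at cs zero → CrossingState ψ cs
        crossing-from-start 0<N ψ cs N≤at₀ =
          zero , m , ℕ.pred N , s₀ , ℕₚ.≤-reflexive 1+n≡N , s₀∈F , s₀-unit ,
          trans (cong (disturbingRun 𝒜 (prefixed a c N) ψ cs) (sym m+N≡at₀))
            (trans
              (run-iterate (prefixed a c N) ψ cs c N m
                (λ j _ → prefixed-suffix a c (ℕₚ.m≤n+m N j))
                (λ j j<m → before-first cs (subst (j ℕ.+ N ℕ.<_) m+N≡at₀ (ℕₚ.+-monoˡ-< N j<m))))
              (cong (iterate (U c) m)
                (trans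
                  (run-initial (prefixed a c N) ψ cs a N (λ j j<N → prefixed-prefix a c j<N)
                    (λ j j<N → before-first cs (ℕₚ.<-≤-trans j<N N≤at₀)))
                  (cong (λ n → iterate (U a) n s₀) (sym 1+n≡N)))))
          where
          m : ℕ
          m = at cs zero ℕ.∸ N

          m+N≡at₀ : m ℕ.+ N ≡ at cs zero
          m+N≡at₀ = ℕₚ.m∸n+n≡m N≤at₀

          1+n≡N : suc (ℕ.pred N) ≡ N
          1+n≡N = ℕₚ.suc-pred N {{ℕ.>-nonZero 0<N}}

        crossing-from-checkpoint : ∀ ψ → ψ ∈F → IsUnit ψ → ∀ cs i → at cs i ℕ.< N → N ℕ.≤ at cs (suc i) →
                                   CrossingState ψ cs
        crossing-from-checkpoint ψ ψ∈F ψ-unit cs i at<N N≤at =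
          suc i , m , n , ψ , subst (n ℕ.<_) n+≡N (ℕₚ.m<m+n n ℕₚ.0<1+n) , ψ∈F , ψ-unit ,
          trans (cong (disturbingRun 𝒜 (prefixed a c N) ψ cs) (sym m+N≡at))
            (trans
              (run-iterate (prefixed a c N) ψ cs c N m
                (λ j _ → prefixed-suffix a c (ℕₚ.m≤n+m N j))
                (λ j j<m → between cs i (ℕₚ.<-≤-trans at<N (ℕₚ.m≤n+m N j))
                  (subst (j ℕ.+ N ℕ.<_) m+N≡at (ℕₚ.+-monoˡ-< N j<m))))
              (cong (iterate (U c) m)
                (trans (cong (disturbingRun 𝒜 (prefixed a c N) ψ cs) (sym n+≡N))
                  (trans
                    (run-iterate (prefixed a c N) ψ cs a (suc (at cs i)) n
                      (λ j j<n → prefixed-prefix a c (before j j<n))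
                      (λ j j<n → between cs i (ℕₚ.m≤n+m (suc (at cs i)) j) (ℕₚ.<-≤-trans (before j j<n) N≤at)))
                    (trans
                      (cong (iterate (U a) n)
                        (trans (run-at-checkpoint (prefixed a c N) ψ cs (at cs i) (i , refl))
                          (letter-cong (prefixed a c N (at cs i)) a ψ ψ (prefixed-prefix a c at<N) refl)))
                      (iterate-shift (U a) n ψ))))))
          where
          m n : ℕ
          m = at cs (suc i) ℕ.∸ N
          -- The letter read at the checkpoint itself is counted separately, so ψ undergoes `suc n`
          -- letters a before the block ends.
          n = N ℕ.∸ suc (at cs i)

          m+N≡at : m ℕ.+ N ≡ at cs (suc i)
          m+N≡at = ℕₚ.m∸n+n≡m N≤at

          n+≡N : n ℕ.+ suc (at cs i) ≡ N
          n+≡N = ℕₚ.m∸n+n≡m at<N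

          before : ∀ j → j ℕ.< n → j ℕ.+ suc (at cs i) ℕ.< N
          before j j<n = subst (j ℕ.+ suc (at cs i) ℕ.<_) n+≡N (ℕₚ.+-monoˡ-< (suc (at cs i)) j<n)

        crossing-state : 0 ℕ.< N → ∀ ψ → ψ ∈F → IsUnit ψ → ∀ cs → CrossingState ψ cs
        crossing-state 0<N ψ ψ∈F ψ-unit cs = cases (crossing cs N)
          where
          cases : N ℕ.≤ at cs zero ⊎ ∃[ i ] (at cs i ℕ.< N × N ℕ.≤ at cs (suc i)) → CrossingState ψ cs
          cases (inj₁ N≤at₀)             = crossing-from-start 0<N ψ cs N≤at₀
          cases (inj₂ (i , at<N , N≤at)) = crossing-from-checkpoint ψ ψ∈F ψ-unit cs i at<N N≤at

        crossing-value : 0 ℕ.< N → ∀ ψ → ψ ∈F → IsUnit ψ → ∀ cs →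
          ∃[ i ] ∣ ⟨ ψ ∣ disturbingRun 𝒜 (prefixed a c N) ψ cs (at cs i) ⟩ ∣² ≤ u
        crossing-value 0<N ψ ψ∈F ψ-unit cs =
          let i , m , n , φ , n<N , φ∈F , φ-unit , eq = crossing-state 0<N ψ ψ∈F ψ-unit cs
          in i , subst (λ χ → ∣ ⟨ ψ ∣ χ ⟩ ∣² ≤ u)
               {iterate (U c) m (iterate (U a) (suc n) φ)} {disturbingRun 𝒜 (prefixed a c N) ψ cs (at cs i)} (sym eq)
               (≤-trans ∣ ⟨ ψ ∣ iterate (U c) m (iterate (U a) (suc n) φ) ⟩ ∣² ∣ ⟨ ψ ∣ iterate (U a) (suc n) φ ⟩ ∣² u
                 (≈⇒≤ ∣ ⟨ ψ ∣ iterate (U c) m (iterate (U a) (suc n) φ) ⟩ ∣² ∣ ⟨ ψ ∣ iterate (U a) (suc n) φ ⟩ ∣²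
                   (∣∣²-cong ⟨ ψ ∣ iterate (U c) m (iterate (U a) (suc n) φ) ⟩ ⟨ ψ ∣ iterate (U a) (suc n) φ ⟩
                     (inner-congʳ ψ (iterate (U c) m (iterate (U a) (suc n) φ)) (iterate (U a) (suc n) φ)
                       (iterate-fixed (U c) U-c-fixes m (iterate (U a) (suc n) φ)))))
                 (bound n n<N φ ψ φ∈F φ-unit ψ∈F ψ-unit))

        -- One small amplitude for each ψ and each checkpoint sequence is enough: `u` then bounds
        -- every infimum, hence both suprema, and leastness of 1 would give 1 ≤ `u`.
        rejects-aᴺcᵚ : 0 ℕ.< N → u < 1ℝ → ¬ 𝓛⁼¹ 𝒜 (prefixed a c N)
        rejects-aᴺcᵚ 0<N u<1 (_ , _ , least) = <⇒≱ u 1ℝ u<1 (least u u∈[0,1] λ x (ψ , ψ∈F , ψ-unit , x-sup) →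
          proj₂ (proj₂ x-sup) u u∈[0,1] λ y (cs , _ , y-below , _) →
            let i , value≤u = crossing-value 0<N ψ ψ∈F ψ-unit cs
            in ≤-trans y ∣ ⟨ ψ ∣ disturbingRun 𝒜 (prefixed a c N) ψ cs (at cs i) ⟩ ∣² u
                 (y-below ∣ ⟨ ψ ∣ disturbingRun 𝒜 (prefixed a c N) ψ cs (at cs i) ⟩ ∣²
                   (i , ≈-refl ∣ ⟨ ψ ∣ disturbingRun 𝒜 (prefixed a c N) ψ cs (at cs i) ⟩ ∣²))
                 value≤u)

-- Threshold languages and pumping.

0≤∣z∣² : ∀ z → 0ℝ ≤ ∣ z ∣²
0≤∣z∣² z = 0≤-+-ℝ (re z * re z) (im z * im z) (0≤-square-ℝ (re z)) (0≤-square-ℝ (im z))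

-- Membership asks for the value itself, so the infimum and both suprema are constructed, and `t` is
-- carried through them as a lower bound. The margin between `r` and `t` keeps the final inequality
-- strict.
above-threshold : ExcludedMiddle 0ℓ → ∀ {k} (𝒜 : QuantumAutomaton k) w r t → r < t → UnitInterval t →
  ∀ ψ → Subspace._∈F (QuantumAutomaton.F 𝒜) ψ → IsUnit ψ → ∀ cs →
  (∀ i → t ≤ ∣ ⟨ ψ ∣ disturbingRun 𝒜 w ψ cs (at cs i) ⟩ ∣²) → 𝓛^> r 𝒜 w
above-threshold em 𝒜 w r t r<t t∈[0,1] ψ ψ∈F ψ-unit cs t≤values =
  let value = λ i → ∣ ⟨ ψ ∣ disturbingRun 𝒜 w ψ cs (at cs i) ⟩ ∣²
      y , y-inf@(_ , _ , y-greatest) = inf-exists em (λ x → ∃[ i ] x ≈ value i)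
        λ x (i , x≈) → ≤-trans 0ℝ (value i) x (0≤∣z∣² ⟨ ψ ∣ disturbingRun 𝒜 w ψ cs (at cs i) ⟩) (≈⇒≥ x (value i) x≈)
      x , x-sup@(_ , x-above , _) = sup-exists em (λ x → ∃[ cs ] IsInfOverCheckpoints 𝒜 w ψ cs x)
        λ _ (_ , (_ , x≤1) , _) → x≤1
      v , v-sup@(_ , v-above , _) = sup-exists em
        (λ x → ∃[ ψ ] (Subspace._∈F (QuantumAutomaton.F 𝒜) ψ × IsUnit ψ × IsSupOverSequences 𝒜 w ψ x))
        λ _ (_ , _ , _ , (_ , x≤1) , _) → x≤1
      t≤y = y-greatest t t∈[0,1] λ x (i , x≈) → ≤-trans t (value i) x (t≤values i) (≈⇒≥ x (value i) x≈)
      y≤x = x-above y (cs , y-inf)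
      x≤v = v-above x (ψ , ψ∈F , ψ-unit , x-sup)
  in v , v-sup , <-≤-trans r t v r<t (≤-trans t y v t≤y (≤-trans y x v y≤x x≤v))

<-dense : ∀ x y → x < y → ∃[ z ] (x < z × z < y)
<-dense x y x<y =
  let ε , 0<ε , x+ε≤y = <⇒+ε≤ x y x<y
      z = x + fromℚ (half ε)
  in z , +ε≤⇒< x z (half-pos 0<ε) (≤-refl z) ,
     +ε≤⇒< z y (half-pos 0<ε) (≤-trans (z + fromℚ (half ε)) (x + fromℚ ε) y
       (pointwise-≤ (z + fromℚ (half ε)) (x + fromℚ ε) λ n → ℚₚ.≤-reflexive
         (trans (ℚₚ.+-assoc (seq x n) (half ε) (half ε)) (cong (seq x n ℚ.+_) (half+half ε)))) x+ε≤y)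

-- A number `t` strictly between `r` and the value is exceeded by some element of the outer supremum
-- and then of the inner one, which fixes ψ and the checkpoints. The bounds 0 ≤ `r` and value ≤ 1
-- put `t` in [0,1], the range over which leastness can be applied.
witnesses : ExcludedMiddle 0ℓ → ∀ {k} (𝒜 : QuantumAutomaton k) w r → 0ℝ ≤ r → 𝓛^> r 𝒜 w →
  ∃[ t ] (r < t × t ≤ 1ℝ × ∃[ ψ ] (Subspace._∈F (QuantumAutomaton.F 𝒜) ψ × IsUnit ψ × ∃[ cs ]
    (∀ i → t ≤ ∣ ⟨ ψ ∣ disturbingRun 𝒜 w ψ cs (at cs i) ⟩ ∣²)))
witnesses em 𝒜 w r 0≤r (v , v-sup@((_ , v≤1) , _) , r<v) =
  let t , r<t , t<v = <-dense r v r<v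
      t∈[0,1] = ≤-trans 0ℝ r t 0≤r (<⇒≤ r t r<t) , ≤-trans t v 1ℝ (<⇒≤ t v t<v) v≤1
      x , (ψ , ψ∈F , ψ-unit , x-sup) , t<x = exceeded-below-sup em
        (λ x → ∃[ ψ ] (Subspace._∈F (QuantumAutomaton.F 𝒜) ψ × IsUnit ψ × IsSupOverSequences 𝒜 w ψ x))
        {v} v-sup t t∈[0,1] t<v
      y , (cs , _ , y-below , _) , t<y = exceeded-below-sup em
        (λ x → ∃[ cs ] IsInfOverCheckpoints 𝒜 w ψ cs x) {x} x-sup t t∈[0,1] t<x
      value = λ i → ∣ ⟨ ψ ∣ disturbingRun 𝒜 w ψ cs (at cs i) ⟩ ∣²
  in t , r<t , proj₂ t∈[0,1] , ψ , ψ∈F , ψ-unit , cs ,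
     λ i → ≤-trans t y (value i) (<⇒≤ t y t<y) (y-below (value i) (i , ≈-refl (value i)))

-- Two nested margins are needed: the gap between `u` and `t` is the precision demanded of the
-- return time, and the gap between `r` and `u` survives as strict acceptance.
pumping : ExcludedMiddle 0ℓ → ∀ {k} (𝒜 : QuantumAutomaton k) a c r → 0ℝ ≤ r →
          𝓛^> r 𝒜 (prefixed a c zero) → ∃[ n ] 𝓛^> r 𝒜 (prefixed a c (suc n))
pumping em 𝒜 a c r 0≤r accepted =
  let t , r<t , t≤1 , ψ , ψ∈F , ψ-unit , cs , t≤values = witnesses em 𝒜 (prefixed a c zero) r 0≤r accepted
      u , r<u , u<t   = <-dense r t r<t
      ε , 0<ε , u+ε≤t = <⇒+ε≤ u t u<t
      n , recurs      = recurrence-after em (U a) (U c) (U-unitary a) (U-unitary c) (at cs zero) ψ s₀ ψ-unit s₀-unit 0<ε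
  in n , above-threshold em 𝒜 (prefixed a c (suc n)) r u r<u
       (≤-trans 0ℝ r u 0≤r (<⇒≤ r u r<u) , ≤-trans u t 1ℝ (<⇒≤ u t u<t) t≤1)
       ψ ψ∈F ψ-unit (shift (suc n) cs)
       (shifted-values 𝒜 a c (suc n) ψ cs t t≤values u (<⇒≤ u t u<t) ε u+ε≤t recurs)
  where open QuantumAutomaton 𝒜

-- The separating automaton

⅗ ⅘ : ℚ
⅗ = + 3 ℚ./ 5
⅘ = + 4 ℚ./ 5

-- (cosine n, sine n) is the n-th power of the point (3/5, 4/5) of the unit circle.
cosine sine : ℕ → ℚ
cosine zero    = 1ℚ
cosine (suc n) = ⅗ ℚ.* cosine n ℚ.- ⅘ ℚ.* sine n
sine zero    = 0ℚ
sine (suc n) = ⅘ ℚ.* cosine n ℚ.+ ⅗ ℚ.* sine n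

cosine²+sine²≡1 : ∀ n → cosine n ℚ.* cosine n ℚ.+ sine n ℚ.* sine n ≡ 1ℚ
cosine²+sine²≡1 zero    = refl
cosine²+sine²≡1 (suc n) = trans
  (solve 2 (λ c s → let c′ = con ⅗ :* c :- con ⅘ :* s ; s′ = con ⅘ :* c :+ con ⅗ :* s in
      c′ :* c′ :+ s′ :* s′ := c :* c :+ s :* s) refl (cosine n) (sine n))
  (cosine²+sine²≡1 n)

5^ : ℕ → ℚ
5^ zero    = 1ℚ
5^ (suc n) = fromℕ 5 ℚ.* 5^ n

-- (3 + 4i)² ≡ 3 + 4i modulo 5, so (3 + 4i)ⁿ ≡ 3 + 4i for every n ≥ 1.
numerators-mod-5 : ∀ n → ∃[ x ] ∃[ y ]
  (5^ (suc n) ℚ.* cosine (suc n) ≡ fromℕ 5 ℚ.* fromℤ x ℚ.+ fromℕ 3 ×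
   5^ (suc n) ℚ.* sine (suc n) ≡ fromℕ 5 ℚ.* fromℤ y ℚ.+ fromℕ 4)
numerators-mod-5 zero = + 0 , + 0 , refl , refl
numerators-mod-5 (suc n) =
  let x , y , eqᶜ , eqˢ = numerators-mod-5 n
      P = 5^ (suc n) ; C = cosine (suc n) ; S = sine (suc n)
      X = fromℤ x ; Y = fromℤ y
  -- Multiplication by 3 + 4i gives 3(5x + 3) - 4(5y + 4) = 5(3x - 4y - 2) + 3 and 4(5x + 3) + 3(5y
  -- + 4) = 5(4x + 3y + 4) + 4.
  in + 3 ℤ.* x ℤ.+ ℤ.- + 4 ℤ.* y ℤ.+ ℤ.- + 2 , + 4 ℤ.* x ℤ.+ + 3 ℤ.* y ℤ.+ + 4 ,
     trans (solve 3 (λ P C S → con (fromℕ 5) :* P :* (con ⅗ :* C :- con ⅘ :* S)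
               := con (fromℕ 3) :* (P :* C) :- con (fromℕ 4) :* (P :* S)) refl P C S)
       (trans (cong₂ (λ c s → fromℕ 3 ℚ.* c ℚ.- fromℕ 4 ℚ.* s) eqᶜ eqˢ)
         (trans (solve 2 (λ X Y → con (fromℕ 3) :* (con (fromℕ 5) :* X :+ con (fromℕ 3))
                     :- con (fromℕ 4) :* (con (fromℕ 5) :* Y :+ con (fromℕ 4))
                   := con (fromℕ 5) :* (con (fromℕ 3) :* X :+ con (fromℤ (ℤ.- + 4)) :* Y :+ con (fromℤ (ℤ.- + 2))) :+ con (fromℕ 3)) refl X Y)
           (cong (λ t → fromℕ 5 ℚ.* t ℚ.+ fromℕ 3) (sym (fromℤ-affine (+ 3) x (ℤ.- + 4) y (ℤ.- + 2)))))) ,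
     trans (solve 3 (λ P C S → con (fromℕ 5) :* P :* (con ⅘ :* C :+ con ⅗ :* S)
               := con (fromℕ 4) :* (P :* C) :+ con (fromℕ 3) :* (P :* S)) refl P C S)
       (trans (cong₂ (λ c s → fromℕ 4 ℚ.* c ℚ.+ fromℕ 3 ℚ.* s) eqᶜ eqˢ)
         (trans (solve 2 (λ X Y → con (fromℕ 4) :* (con (fromℕ 5) :* X :+ con (fromℕ 3))
                     :+ con (fromℕ 3) :* (con (fromℕ 5) :* Y :+ con (fromℕ 4))
                   := con (fromℕ 5) :* (con (fromℕ 4) :* X :+ con (fromℕ 3) :* Y :+ con (fromℕ 4)) :+ con (fromℕ 4)) refl X Y)
           (cong (λ t → fromℕ 5 ℚ.* t ℚ.+ fromℕ 4) (sym (fromℤ-affine (+ 4) x (+ 3) y (+ 4))))))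
  where
  fromℤ-affine : ∀ p x q y r →
    fromℤ (p ℤ.* x ℤ.+ q ℤ.* y ℤ.+ r) ≡ fromℤ p ℚ.* fromℤ x ℚ.+ fromℤ q ℚ.* fromℤ y ℚ.+ fromℤ r
  fromℤ-affine p x q y r = trans (fromℤ-+ (p ℤ.* x ℤ.+ q ℤ.* y) r)
    (cong (ℚ._+ fromℤ r) (trans (fromℤ-+ (p ℤ.* x) (q ℤ.* y)) (cong₂ ℚ._+_ (fromℤ-* p x) (fromℤ-* q y))))

-- Otherwise 5 would divide 4.
5y+4≢0 : ∀ y → ¬ (+ 5 ℤ.* y ℤ.+ + 4 ≡ + 0)
5y+4≢0 y eq = ℕₚ.<⇒≱ (ℕₚ.≤-refl {5}) (ℕ∣.∣⇒≤ (ℕ∣.divides ℤ.∣ y ∣ 4≡∣y∣*5))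
  where
  open ≡-Reasoning
  4≡∣y∣*5 : 4 ≡ ℤ.∣ y ∣ ℕ.* 5
  4≡∣y∣*5 = begin
    4                      ≡⟨⟩
    ℤ.∣ ℤ.- + 4 ∣          ≡⟨ cong ℤ.∣_∣ (ℤₚ.+-identityˡ (ℤ.- + 4)) ⟨
    ℤ.∣ + 0 ℤ.- + 4 ∣      ≡⟨ cong (λ t → ℤ.∣ t ℤ.- + 4 ∣) eq ⟨
    ℤ.∣ + 5 ℤ.* y ℤ.+ + 4 ℤ.- + 4 ∣  ≡⟨ cong ℤ.∣_∣ (ℤₚ.+-assoc (+ 5 ℤ.* y) (+ 4) (ℤ.- + 4)) ⟩
    ℤ.∣ + 5 ℤ.* y ℤ.+ + 0 ∣          ≡⟨ cong ℤ.∣_∣ (ℤₚ.+-identityʳ (+ 5 ℤ.* y)) ⟩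
    ℤ.∣ + 5 ℤ.* y ∣        ≡⟨ ℤₚ.abs-* (+ 5) y ⟩
    5 ℕ.* ℤ.∣ y ∣          ≡⟨ ℕₚ.*-comm 5 ℤ.∣ y ∣ ⟩
    ℤ.∣ y ∣ ℕ.* 5          ∎

sine≢0 : ∀ n → ¬ (sine (suc n) ≡ 0ℚ)
sine≢0 n sine≡0 =
  let _ , y , _ , eq = numerators-mod-5 n
  in 5y+4≢0 y (fromℤ-injective (trans (fromℤ-+ (+ 5 ℤ.* y) (+ 4)) (trans (cong (ℚ._+ fromℕ 4) (fromℤ-* (+ 5) y))
       (trans (sym eq) (trans (cong (5^ (suc n) ℚ.*_) sine≡0) (ℚₚ.*-zeroʳ (5^ (suc n))))))))

0<-square : ∀ p → ¬ (p ≡ 0ℚ) → 0ℚ ℚ.< p ℚ.* p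
0<-square p p≢0 with ℚₚ.<-cmp p 0ℚ
... | tri< p<0 _ _ = ℚₚ.positive⁻¹ (p ℚ.* p) {{ℚₚ.neg*neg⇒pos p {{ℚ.negative p<0}} p {{ℚ.negative p<0}}}}
... | tri≈ _ p≡0 _ = contradiction p≡0 p≢0
... | tri> _ _ 0<p = ℚₚ.positive⁻¹ (p ℚ.* p) {{ℚₚ.pos*pos⇒pos p {{ℚ.positive 0<p}} p {{ℚ.positive 0<p}}}}

cosine²<1 : ∀ n → cosine (suc n) ℚ.* cosine (suc n) ℚ.< 1ℚ
cosine²<1 n = subst₂ ℚ._<_ (ℚₚ.+-identityʳ (cosine (suc n) ℚ.* cosine (suc n))) (cosine²+sine²≡1 (suc n))
  (ℚₚ.+-monoʳ-< (cosine (suc n) ℚ.* cosine (suc n)) (0<-square (sine (suc n)) (sine≢0 n)))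

-- A maximum of finitely many numbers below 1. The bound has to depend on `N`, since by recurrence
-- these squares come arbitrarily close to 1.
cosine²-bound : ∀ N → ∃[ q ] (0ℚ ℚ.≤ q × q ℚ.< 1ℚ × (∀ n → n ℕ.< N → cosine (suc n) ℚ.* cosine (suc n) ℚ.≤ q))
cosine²-bound zero    = 0ℚ , ℚₚ.≤-refl , 0<1 , λ _ ()
cosine²-bound (suc N) with cosine²-bound N
... | q , 0≤q , q<1 , bound with ℚₚ.≤-total q (cosine (suc N) ℚ.* cosine (suc N))
...   | inj₁ q≤c = cosine (suc N) ℚ.* cosine (suc N) , ℚₚ.≤-trans 0≤q q≤c , cosine²<1 N ,
  λ n n<1+N → extend n (ℕₚ.m≤n⇒m<n∨m≡n (ℕₚ.≤-pred n<1+N))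
  where
  extend : ∀ n → n ℕ.< N ⊎ n ≡ N → cosine (suc n) ℚ.* cosine (suc n) ℚ.≤ cosine (suc N) ℚ.* cosine (suc N)
  extend n (inj₁ n<N)  = ℚₚ.≤-trans (bound n n<N) q≤c
  extend n (inj₂ refl) = ℚₚ.≤-refl
...   | inj₂ c≤q = q , 0≤q , q<1 , λ n n<1+N → extend n (ℕₚ.m≤n⇒m<n∨m≡n (ℕₚ.≤-pred n<1+N))
  where
  extend : ∀ n → n ℕ.< N ⊎ n ≡ N → cosine (suc n) ℚ.* cosine (suc n) ℚ.≤ q
  extend n (inj₁ n<N)  = bound n n<N
  extend n (inj₂ refl) = c≤q

-- The rotation matrix and its orbits on the axis.

real : ℚ → ℂ
real q = fromℚ q +i 0ℝ

pair : ℂ → ℂ → Vector ℂ 2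
pair z w zero       = z
pair z w (suc zero) = w

rotation : Matrix 2
rotation zero       zero       = real ⅗
rotation zero       (suc zero) = real (ℚ.- ⅘)
rotation (suc zero) zero       = real ⅘
rotation (suc zero) (suc zero) = real ⅗

OnAxis : Pred (Vector ℂ 2) 0ℓ
OnAxis ψ = ψ (suc zero) ≈ᶜ 0ᶜ

rotation-unitary : IsUnitary rotation
rotation-unitary = left , right
  where
  left : ∀ i j → ((rotation †) ⊗ rotation) i j ≈ᶜ identity i j
  left zero       zero       = pointwise-≈ᶜ (((rotation †) ⊗ rotation) zero zero) 1ᶜ (λ _ → refl) (λ _ → refl)
  left zero       (suc zero) = pointwise-≈ᶜ (((rotation †) ⊗ rotation) zero (suc zero)) 0ᶜ (λ _ → refl) (λ _ → refl)
  left (suc zero) zero       = pointwise-≈ᶜ (((rotation †) ⊗ rotation) (suc zero) zero) 0ᶜ (λ _ → refl) (λ _ → refl)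
  left (suc zero) (suc zero) = pointwise-≈ᶜ (((rotation †) ⊗ rotation) (suc zero) (suc zero)) 1ᶜ (λ _ → refl) (λ _ → refl)

  right : ∀ i j → (rotation ⊗ (rotation †)) i j ≈ᶜ identity i j
  right zero       zero       = pointwise-≈ᶜ ((rotation ⊗ (rotation †)) zero zero) 1ᶜ (λ _ → refl) (λ _ → refl)
  right zero       (suc zero) = pointwise-≈ᶜ ((rotation ⊗ (rotation †)) zero (suc zero)) 0ᶜ (λ _ → refl) (λ _ → refl)
  right (suc zero) zero       = pointwise-≈ᶜ ((rotation ⊗ (rotation †)) (suc zero) zero) 0ᶜ (λ _ → refl) (λ _ → refl)
  right (suc zero) (suc zero) = pointwise-≈ᶜ ((rotation ⊗ (rotation †)) (suc zero) (suc zero)) 1ᶜ (λ _ → refl) (λ _ → refl)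

identity-unitary : IsUnitary {2} identity
identity-unitary = left , right
  where
  left : ∀ i j → ((identity †) ⊗ identity {2}) i j ≈ᶜ identity i j
  left zero       zero       = pointwise-≈ᶜ (((identity †) ⊗ identity {2}) zero zero) 1ᶜ (λ _ → refl) (λ _ → refl)
  left zero       (suc zero) = pointwise-≈ᶜ (((identity †) ⊗ identity {2}) zero (suc zero)) 0ᶜ (λ _ → refl) (λ _ → refl)
  left (suc zero) zero       = pointwise-≈ᶜ (((identity †) ⊗ identity {2}) (suc zero) zero) 0ᶜ (λ _ → refl) (λ _ → refl)
  left (suc zero) (suc zero) = pointwise-≈ᶜ (((identity †) ⊗ identity {2}) (suc zero) (suc zero)) 1ᶜ (λ _ → refl) (λ _ → refl)

  right : ∀ i j → (identity {2} ⊗ (identity †)) i j ≈ᶜ identity i j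
  right zero       zero       = pointwise-≈ᶜ ((identity {2} ⊗ (identity †)) zero zero) 1ᶜ (λ _ → refl) (λ _ → refl)
  right zero       (suc zero) = pointwise-≈ᶜ ((identity {2} ⊗ (identity †)) zero (suc zero)) 0ᶜ (λ _ → refl) (λ _ → refl)
  right (suc zero) zero       = pointwise-≈ᶜ ((identity {2} ⊗ (identity †)) (suc zero) zero) 0ᶜ (λ _ → refl) (λ _ → refl)
  right (suc zero) (suc zero) = pointwise-≈ᶜ ((identity {2} ⊗ (identity †)) (suc zero) (suc zero)) 1ᶜ (λ _ → refl) (λ _ → refl)

scale : ℚ → ℂ → ℂ
scale q z = (fromℚ q * re z) +i (fromℚ q * im z)

-- Orbits of axis vectors stay in this form, z·(p, q) with rational p and q, which reduces the
-- dynamics to the rational recurrences for `cosine` and `sine`.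
scale-pair : ℚ → ℚ → ℂ → Vector ℂ 2
scale-pair p q z = pair (scale p z) (scale q z)

rotation-step : ∀ p q p′ q′ z → p′ ≡ ⅗ ℚ.* p ℚ.- ⅘ ℚ.* q → q′ ≡ ⅘ ℚ.* p ℚ.+ ⅗ ℚ.* q →
                rotation · scale-pair p q z ≈ᵛ scale-pair p′ q′ z
rotation-step p q p′ q′ z refl refl zero = pointwise-≈ᶜ ((rotation · scale-pair p q z) zero) (scale-pair p′ q′ z zero)
  (λ n → solve 4 (λ p q x y → (con ⅗ :* (p :* x) :- con 0ℚ :* (p :* y))
        :+ ((con (ℚ.- ⅘) :* (q :* x) :- con 0ℚ :* (q :* y)) :+ con 0ℚ)
      := (con ⅗ :* p :- con ⅘ :* q) :* x) refl p q (seq (re z) n) (seq (im z) n))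
  (λ n → solve 4 (λ p q x y → (con ⅗ :* (p :* y) :+ con 0ℚ :* (p :* x))
        :+ ((con (ℚ.- ⅘) :* (q :* y) :+ con 0ℚ :* (q :* x)) :+ con 0ℚ)
      := (con ⅗ :* p :- con ⅘ :* q) :* y) refl p q (seq (re z) n) (seq (im z) n))
rotation-step p q p′ q′ z refl refl (suc zero) = pointwise-≈ᶜ
  ((rotation · scale-pair p q z) (suc zero)) (scale-pair p′ q′ z (suc zero))
  (λ n → solve 4 (λ p q x y → (con ⅘ :* (p :* x) :- con 0ℚ :* (p :* y))
        :+ ((con ⅗ :* (q :* x) :- con 0ℚ :* (q :* y)) :+ con 0ℚ)
      := (con ⅘ :* p :+ con ⅗ :* q) :* x) refl p q (seq (re z) n) (seq (im z) n))
  (λ n → solve 4 (λ p q x y → (con ⅘ :* (p :* y) :+ con 0ℚ :* (p :* x))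
        :+ ((con ⅗ :* (q :* y) :+ con 0ℚ :* (q :* x)) :+ con 0ℚ)
      := (con ⅘ :* p :+ con ⅗ :* q) :* y) refl p q (seq (re z) n) (seq (im z) n))

axis : ℂ → Vector ℂ 2
axis z = pair z 0ᶜ

axis-scale-pair : ∀ p q z → p ≡ 1ℚ → q ≡ 0ℚ → axis z ≈ᵛ scale-pair p q z
axis-scale-pair p q z refl refl zero = pointwise-≈ᶜ (axis z zero) (scale-pair p q z zero)
  (λ n → sym (ℚₚ.*-identityˡ (seq (re z) n))) (λ n → sym (ℚₚ.*-identityˡ (seq (im z) n)))
axis-scale-pair p q z refl refl (suc zero) = pointwise-≈ᶜ (axis z (suc zero)) (scale-pair p q z (suc zero))
  (λ n → sym (ℚₚ.*-zeroˡ (seq (re z) n))) (λ n → sym (ℚₚ.*-zeroˡ (seq (im z) n)))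

rotation-iterate : ∀ n z → iterate rotation n (axis z) ≈ᵛ scale-pair (cosine n) (sine n) z
rotation-iterate zero z =
  ≈ᵛ-trans (iterate rotation zero (axis z)) (axis z) (scale-pair (cosine zero) (sine zero) z)
    (≡⇒≈ᵛ (iterate rotation zero (axis z)) (axis z) (iterate-zero rotation (axis z)))
    (axis-scale-pair (cosine zero) (sine zero) z refl refl)
rotation-iterate (suc n) z =
  ≈ᵛ-trans (iterate rotation (suc n) (axis z)) (rotation · iterate rotation n (axis z)) (scale-pair (cosine (suc n)) (sine (suc n)) z)
    (≡⇒≈ᵛ (iterate rotation (suc n) (axis z)) (rotation · iterate rotation n (axis z)) (iterate-suc rotation n (axis z)))
    (≈ᵛ-trans (rotation · iterate rotation n (axis z)) (rotation · scale-pair (cosine n) (sine n) z) (scale-pair (cosine (suc n)) (sine (suc n)) z)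
      (H.$-congʳ rotation {iterate rotation n (axis z)} {scale-pair (cosine n) (sine n) z} (rotation-iterate n z))
      (rotation-step (cosine n) (sine n) (cosine (suc n)) (sine (suc n)) z refl refl))

on-axis : ∀ φ → OnAxis φ → φ ≈ᵛ axis (φ zero)
on-axis φ φ₁≈0 zero       = ≈ᶜ-refl (φ zero)
on-axis φ φ₁≈0 (suc zero) = φ₁≈0

∣axis∣²≈1 : ∀ φ → OnAxis φ → IsUnit φ → ∣ φ zero ∣² ≈ 1ℝ
∣axis∣²≈1 φ φ-axis (φφ≈1 , _) =
  ≈-trans ∣ φ zero ∣² (re ⟨ axis (φ zero) ∣ axis (φ zero) ⟩) 1ℝ
    (pointwise-≈ ∣ φ zero ∣² (re ⟨ axis (φ zero) ∣ axis (φ zero) ⟩)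
      λ n → solve 2 (λ x y → x :* x :+ y :* y := x :* x :- :- y :* y :+ con 0ℚ) refl (seq (re (φ zero)) n) (seq (im (φ zero)) n))
    (≈-trans (re ⟨ axis (φ zero) ∣ axis (φ zero) ⟩) (re ⟨ φ ∣ φ ⟩) 1ℝ
      (≈-sym (re ⟨ φ ∣ φ ⟩) (re ⟨ axis (φ zero) ∣ axis (φ zero) ⟩)
        (proj₁ (H.inner-cong {φ = φ} {axis (φ zero)} {φ} {axis (φ zero)} (on-axis φ φ-axis) (on-axis φ φ-axis))))
      φφ≈1)

-- The second coordinate meets a zero, and modulus squared is multiplicative. The phases of w and z
-- cancel, so all unit vectors of the complex line F give the same value.
axis-value : ∀ p q w z → ∣ ⟨ axis w ∣ scale-pair p q z ⟩ ∣² ≈ fromℚ (p ℚ.* p) * (∣ w ∣² * ∣ z ∣²)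
axis-value p q w z = pointwise-≈ ∣ ⟨ axis w ∣ scale-pair p q z ⟩ ∣² (fromℚ (p ℚ.* p) * (∣ w ∣² * ∣ z ∣²)) λ n →
  solve 6 (λ p q a b x y →
      let r = (a :* (p :* x) :- :- b :* (p :* y)) :+ ((con 0ℚ :* (q :* x) :- con 0ℚ :* (q :* y)) :+ con 0ℚ)
          i = (a :* (p :* y) :+ :- b :* (p :* x)) :+ ((con 0ℚ :* (q :* y) :+ con 0ℚ :* (q :* x)) :+ con 0ℚ)
      in r :* r :+ i :* i := (p :* p) :* ((a :* a :+ b :* b) :* (x :* x :+ y :* y))) refl
    p q (seq (re w) n) (seq (im w) n) (seq (re z) n) (seq (im z) n)

rotation-value : ∀ n φ ψ → OnAxis φ → IsUnit φ → OnAxis ψ → IsUnit ψ →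
                 ∣ ⟨ ψ ∣ iterate rotation n φ ⟩ ∣² ≈ fromℚ (cosine n ℚ.* cosine n)
rotation-value n φ ψ φ-axis φ-unit ψ-axis ψ-unit =
  ≈-trans ∣ ⟨ ψ ∣ iterate rotation n φ ⟩ ∣² ∣ ⟨ axis (ψ zero) ∣ scale-pair (cosine n) (sine n) (φ zero) ⟩ ∣² (fromℚ C²)
    (∣∣²-cong ⟨ ψ ∣ iterate rotation n φ ⟩ ⟨ axis (ψ zero) ∣ scale-pair (cosine n) (sine n) (φ zero) ⟩
      (H.inner-cong {φ = ψ} {axis (ψ zero)} {iterate rotation n φ} {scale-pair (cosine n) (sine n) (φ zero)}
        (on-axis ψ ψ-axis)
        (≈ᵛ-trans (iterate rotation n φ) (iterate rotation n (axis (φ zero))) (scale-pair (cosine n) (sine n) (φ zero))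
          (iterate-cong rotation n φ (axis (φ zero)) (on-axis φ φ-axis))
          (rotation-iterate n (φ zero)))))
    (≈-trans ∣ ⟨ axis (ψ zero) ∣ scale-pair (cosine n) (sine n) (φ zero) ⟩ ∣² (fromℚ C² * (∣ ψ zero ∣² * ∣ φ zero ∣²)) (fromℚ C²)
      (axis-value (cosine n) (sine n) (ψ zero) (φ zero))
      (≈-trans (fromℚ C² * (∣ ψ zero ∣² * ∣ φ zero ∣²)) (fromℚ C² * (1ℝ * 1ℝ)) (fromℚ C²)
        (*-congˡ (∣ ψ zero ∣² * ∣ φ zero ∣²) (1ℝ * 1ℝ) (fromℚ C²)
          (*-cong ∣ ψ zero ∣² 1ℝ ∣ φ zero ∣² 1ℝ (∣axis∣²≈1 ψ ψ-axis ψ-unit) (∣axis∣²≈1 φ φ-axis φ-unit)))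
        (pointwise-≈ (fromℚ C² * (1ℝ * 1ℝ)) (fromℚ C²) λ _ → ℚₚ.*-identityʳ C²)))
  where C² = cosine n ℚ.* cosine n

-- Stated for any data equal to the concrete ones, so that the projections of
-- the automaton below need not be unfolded inside inner products.
rotation-bound : ∀ {d} (R : Matrix d) (P : Pred (Vector ℂ d) 0ℓ) →
  _≡_ {A = Σ ℕ λ d → Matrix d × Pred (Vector ℂ d) 0ℓ} (d , R , P) (2 , rotation , OnAxis) →
  ∀ N q → (∀ n → n ℕ.< N → cosine (suc n) ℚ.* cosine (suc n) ℚ.≤ q) →
  ∀ n → n ℕ.< N → ∀ φ ψ → P φ → IsUnit φ → P ψ → IsUnit ψ →
  ∣ ⟨ ψ ∣ iterate R (suc n) φ ⟩ ∣² ≤ fromℚ q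
rotation-bound .rotation .OnAxis refl N q bound n n<N φ ψ φ-axis φ-unit ψ-axis ψ-unit =
  ≤-trans ∣ ⟨ ψ ∣ iterate rotation (suc n) φ ⟩ ∣² (fromℚ (cosine (suc n) ℚ.* cosine (suc n))) (fromℚ q)
    (≈⇒≤ ∣ ⟨ ψ ∣ iterate rotation (suc n) φ ⟩ ∣² (fromℚ (cosine (suc n) ℚ.* cosine (suc n)))
      (rotation-value (suc n) φ ψ φ-axis φ-unit ψ-axis ψ-unit))
    (fromℚ-mono-≤ (bound n n<N))

identity-fixes : ∀ {d} (I : Matrix d) → I ≡ identity → ∀ φ → I · φ ≈ᵛ φ
identity-fixes .identity refl φ = H.𝟙-$ φ

-- The automaton and the separation of the two classes.

axisSubspace : Subspace 2
axisSubspace = record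
  { _∈F   = OnAxis
  ; resp  = λ {φ} {ψ} φ≈ψ φ∈ → ≈ᶜ-trans (ψ (suc zero)) (φ (suc zero)) 0ᶜ
                                 (≈ᶜ-sym (φ (suc zero)) (ψ (suc zero)) (φ≈ψ (suc zero))) φ∈
  ; zero∈ = ≈ᶜ-refl 0ᶜ
  ; +∈    = λ {φ} {ψ} φ∈ ψ∈ → ≈ᶜ-trans (φ (suc zero) +ᶜ ψ (suc zero)) (0ᶜ +ᶜ 0ᶜ) 0ᶜ
                                 (+ᶜ-cong (φ (suc zero)) 0ᶜ (ψ (suc zero)) 0ᶜ φ∈ ψ∈)
                                 (pointwise-≈ᶜ (0ᶜ +ᶜ 0ᶜ) 0ᶜ (λ _ → refl) (λ _ → refl))
  ; *∈    = λ z {ψ} ψ∈ → ≈ᶜ-trans (z *ᶜ ψ (suc zero)) (z *ᶜ 0ᶜ) 0ᶜ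
                                 (*ᶜ-cong z z (ψ (suc zero)) 0ᶜ (≈ᶜ-refl z) ψ∈)
                                 (pointwise-≈ᶜ (z *ᶜ 0ᶜ) 0ᶜ
                                   (λ n → solve 2 (λ x y → x :* con 0ℚ :- y :* con 0ℚ := con 0ℚ) refl (seq (re z) n) (seq (im z) n))
                                   (λ n → solve 2 (λ x y → x :* con 0ℚ :+ y :* con 0ℚ := con 0ℚ) refl (seq (re z) n) (seq (im z) n)))
  }

automaton : QuantumAutomaton 2
automaton = record
  { dim       = 2
  ; s₀        = axis 1ᶜ
  ; s₀-unit   = pointwise-≈ᶜ ⟨ axis 1ᶜ ∣ axis 1ᶜ ⟩ 1ᶜ (λ _ → refl) (λ _ → refl)
  ; U         = letter
  ; U-unitary = letter-unitary
  ; F         = axisSubspace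
  }
  where
  letter : Fin 2 → Matrix 2
  letter zero       = rotation
  letter (suc zero) = identity

  letter-unitary : ∀ σ → IsUnitary (letter σ)
  letter-unitary zero       = rotation-unitary
  letter-unitary (suc zero) = identity-unitary

automaton-accepts : 𝓛⁼¹ automaton (prefixed zero (suc zero) zero)
automaton-accepts = accepts-cᵚ automaton zero (suc zero)
  (identity-fixes (QuantumAutomaton.U automaton (suc zero)) refl) (≈ᶜ-refl 0ᶜ)

automaton-rejects : ∀ n → ¬ 𝓛⁼¹ automaton (prefixed zero (suc zero) (suc n))
automaton-rejects n =
  let q , 0≤q , q<1 , bound = cosine²-bound (suc n)
      η , 0<η , q+η≡1 = gap q<1
  in rejects-aᴺcᵚ automaton zero (suc zero)
       (identity-fixes (QuantumAutomaton.U automaton (suc zero)) refl) (≈ᶜ-refl 0ᶜ)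
       (suc n) (fromℚ q) (fromℚ-mono-≤ 0≤q , fromℚ-mono-≤ (ℚₚ.<⇒≤ q<1))
       (rotation-bound (QuantumAutomaton.U automaton zero) OnAxis refl (suc n) q bound)
       ℕₚ.0<1+n (η , 0<η , always λ _ → ℚₚ.≤-reflexive q+η≡1)
  where
  gap : ∀ {q} → q ℚ.< 1ℚ → ∃[ η ] (0ℚ ℚ.< η × q ℚ.+ η ≡ 1ℚ)
  gap {q} q<1 = 1ℚ ℚ.- q , subst (ℚ._< 1ℚ ℚ.- q) (ℚₚ.+-inverseʳ q) (ℚₚ.+-monoˡ-< (ℚ.- q) q<1) ,
    solve 1 (λ q → q :+ (con 1ℚ :- q) := con 1ℚ) refl q

not-above-threshold : ExcludedMiddle 0ℓ → ∀ r → 0ℝ ≤ r → ∀ {k} (a c : Fin k) (L : Pred (ωWord k) 0ℓ) →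
  L (prefixed a c zero) → (∀ n → ¬ L (prefixed a c (suc n))) → ¬ 𝕃^> r (k , L)
not-above-threshold em r 0≤r a c L cᵚ∈L aⁿcᵚ∉L (ℬ , L⊆ , ⊆L) =
  let n , accepted = pumping em ℬ a c r 0≤r (L⊆ cᵚ∈L)
  in aⁿcᵚ∉L n (⊆L accepted)

automaton-language-∈ : 𝕃⁼¹ (2 , 𝓛⁼¹ automaton)
automaton-language-∈ = automaton , ≐-refl {x = 𝓛⁼¹ automaton}

automaton-language-∉ : ExcludedMiddle 0ℓ → ∀ r → 0ℝ ≤ r → ¬ 𝕃^> r (2 , 𝓛⁼¹ automaton)
automaton-language-∉ em r 0≤r =
  not-above-threshold em r 0≤r {2} zero (suc zero) (𝓛⁼¹ automaton) automaton-accepts automaton-rejects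

theorem6 : ExcludedMiddle 0ℓ →
    (r : ℝ) → 0ℝ ≤ r → r < 1ℝ →
    𝕃⁼¹ ⊈ 𝕃^> r
theorem6 em r 0≤r r<1 𝕃⁼¹⊆𝕃^> =
  automaton-language-∉ em r 0≤r (𝕃⁼¹⊆𝕃^> {2 , 𝓛⁼¹ automaton} automaton-language-∈)
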